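{- There exist an absolute constant $c>0$, an absolute constant $C>0$ and an integer $n_0$ such that for every $n \ge n_0$ and every set $S \subseteq \mathbb{C}[x]$ consisting of $n$ monic polynomials, $$|S.S| < n^{1+c} \quad\Longrightarrow\quad |S+S| \ge C n^2 .$$
   Context: For a finite subset $S$ of a ring, $S.S := \{st : s,t\in S\}$ and $S+S := \{s+t : s,t\in S\}$. -}

module Defs where

open import Algebra.Bundles.Raw using (RawRing)
open import Data.Fin.Base using (Fin)
open import Data.Integer.Base using (+_; ∣_∣)
open import Data.List.Base using (List; []; _∷_; map)
open import Data.Nat.Base as ℕ using (ℕ; zero; suc; _⊔_)
import Data.Nat.Properties as ℕ
open import Data.Product.Base using (∃; ∃-syntax; _×_; _,_; proj₁)
open import Data.Rational.Base as ℚ using (ℚ; 0ℚ; 1ℚ; ½; ↥_; ↧ₙ_)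
import Data.Rational.Properties as ℚ
open import Data.Rational.Solver using (module +-*-Solver)
open import Function.Base using (_on_)
open import Function.Definitions using (Bijective)
open import Level using (Level; 0ℓ)
open import Relation.Binary.PropositionalEquality
open import Relation.Unary using (Pred)

------------------------------------------------------------------------
-- Real numbers: Cauchy sequences of rationals, with `_≈ᴿ_` as equality

IsCauchy : (ℕ → ℚ) → Set
IsCauchy x = ∀ ε → 0ℚ ℚ.< ε →
  ∃[ N ] (∀ m n → N ℕ.≤ m → N ℕ.≤ n → ℚ.∣ x m ℚ.- x n ∣ ℚ.< ε)

record ℝ : Set where
  constructor mkℝ
  field
    seq    : ℕ → ℚ
    cauchy : IsCauchy seq

open ℝ public

infix 4 _≈ᴿ_

_≈ᴿ_ : ℝ → ℝ → Set
x ≈ᴿ y = ∀ ε → 0ℚ ℚ.< ε →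
  ∃[ N ] (∀ n → N ℕ.≤ n → ℚ.∣ seq x n ℚ.- seq y n ∣ ℚ.< ε)

module _ where
  open import Data.Rational.Base using (_+_; _*_; _-_; -_; _<_; _≤_)
    renaming (∣_∣ to abs)
  open +-*-Solver

  private
    half-pos : ∀ {ε} → 0ℚ < ε → 0ℚ < ½ * ε
    half-pos {ε} ε>0 =
      ℚ.positive⁻¹ (½ * ε) {{ℚ.pos*pos⇒pos ½ ε {{ℚ.positive ε>0}}}}

    halves : ∀ ε → ½ * ε + ½ * ε ≡ ε
    halves ε = trans (sym (ℚ.*-distribʳ-+ ε ½ ½)) (ℚ.*-identityˡ ε)

    a≡a-b+b : ∀ a b → a ≡ (a - b) + b
    a≡a-b+b = solve 2 (λ a b → a := (a :- b) :+ b) refl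

    ⊔-boundˡ : ∀ M N {n} → M ⊔ N ℕ.≤ n → M ℕ.≤ n
    ⊔-boundˡ M N = ℕ.≤-trans (ℕ.m≤m⊔n M N)

    ⊔-boundʳ : ∀ M N {n} → M ⊔ N ℕ.≤ n → N ℕ.≤ n
    ⊔-boundʳ M N = ℕ.≤-trans (ℕ.m≤n⊔m M N)

    eventually-bounded : ∀ x → IsCauchy x → ∃[ B ] ∃[ N ]
      (0ℚ < B × (∀ n → N ℕ.≤ n → abs (x n) ≤ B))
    eventually-bounded x cx with cx 1ℚ (ℚ.positive⁻¹ 1ℚ)
    ... | N , close = 1ℚ + abs (x N) , N , B>0 , bound
      where
      B>0 : 0ℚ < 1ℚ + abs (x N)
      B>0 = ℚ.+-mono-<-≤ (ℚ.positive⁻¹ 1ℚ) (ℚ.0≤∣p∣ (x N))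

      bound : ∀ n → N ℕ.≤ n → abs (x n) ≤ 1ℚ + abs (x N)
      bound n N≤n = begin
        abs (x n)                    ≡⟨ cong abs (a≡a-b+b (x n) (x N)) ⟩
        abs ((x n - x N) + x N)      ≤⟨ ℚ.∣p+q∣≤∣p∣+∣q∣ (x n - x N) (x N) ⟩
        abs (x n - x N) + abs (x N)  ≤⟨ ℚ.+-monoˡ-≤ (abs (x N)) (ℚ.<⇒≤ (close n N N≤n ℕ.≤-refl)) ⟩
        1ℚ + abs (x N)               ∎
        where open ℚ.≤-Reasoning

    shrink : ∀ B ε → 0ℚ < B → 0ℚ < ε → ∃[ δ ] (0ℚ < δ × B * δ ≡ ε)
    shrink B ε B>0 ε>0 = inv * ε , δ>0 , eq
      where
      instance
        posB = ℚ.positive B>0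
        posε = ℚ.positive ε>0
        nzB = ℚ.pos⇒nonZero B
      inv = ℚ.1/ B

      δ>0 : 0ℚ < inv * ε
      δ>0 = ℚ.positive⁻¹ (inv * ε)
        {{ℚ.pos*pos⇒pos inv {{ℚ.1/pos⇒pos B}} ε}}

      eq : B * (inv * ε) ≡ ε
      eq = trans (sym (ℚ.*-assoc B inv ε))
          (trans (cong (_* ε) (ℚ.*-inverseʳ B)) (ℚ.*-identityˡ ε))

    product-bound : ∀ a b δ B → 0ℚ < B → abs a ≤ B → abs b < δ →
                    abs (a * b) < B * δ
    product-bound a b δ B B>0 a≤B b<δ = begin-strict
      abs (a * b)    ≡⟨ ℚ.∣p*q∣≡∣p∣*∣q∣ a b ⟩
      abs a * abs b  ≤⟨ ℚ.*-monoʳ-≤-nonNeg (abs b) {{ℚ.∣-∣-nonNeg b}} a≤B ⟩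
      B * abs b      <⟨ ℚ.*-monoʳ-<-pos B {{ℚ.positive B>0}} b<δ ⟩
      B * δ          ∎
      where open ℚ.≤-Reasoning

    sum-bound : ∀ {ε} c a b → c ≡ a + b →
                abs a < ½ * ε → abs b < ½ * ε → abs c < ε
    sum-bound {ε} c a b eq a< b< = begin-strict
      abs c          ≡⟨ cong abs eq ⟩
      abs (a + b)    ≤⟨ ℚ.∣p+q∣≤∣p∣+∣q∣ a b ⟩
      abs a + abs b  <⟨ ℚ.+-mono-< a< b< ⟩
      ½ * ε + ½ * ε  ≡⟨ halves ε ⟩
      ε              ∎
      where open ℚ.≤-Reasoning

  const-cauchy : ∀ q → IsCauchy (λ _ → q)
  const-cauchy q ε ε>0 = 0 , λ _ _ _ _ →
    subst (λ z → abs z < ε) (sym (ℚ.+-inverseʳ q)) ε>0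

  +-cauchy : ∀ x y → IsCauchy x → IsCauchy y → IsCauchy (λ n → x n + y n)
  +-cauchy x y cx cy ε ε>0
    with cx (½ * ε) (half-pos ε>0) | cy (½ * ε) (half-pos ε>0)
  ... | M , closeˣ | N , closeʸ = M ⊔ N , λ m n m≥ n≥ →
    sum-bound _ _ _ (split (x m) (y m) (x n) (y n))
      (closeˣ m n (⊔-boundˡ M N m≥) (⊔-boundˡ M N n≥))
      (closeʸ m n (⊔-boundʳ M N m≥) (⊔-boundʳ M N n≥))
    where
    split : ∀ a b c d → (a + b) - (c + d) ≡ (a - c) + (b - d)
    split = solve 4 (λ a b c d → (a :+ b) :- (c :+ d) := (a :- c) :+ (b :- d)) refl

  neg-cauchy : ∀ x → IsCauchy x → IsCauchy (λ n → - x n)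
  neg-cauchy x cx ε ε>0 with cx ε ε>0
  ... | N , close = N , λ m n m≥ n≥ →
    subst (_< ε) (trans (sym (ℚ.∣-p∣≡∣p∣ (x m - x n))) (cong abs (flip (x m) (x n))))
      (close m n m≥ n≥)
    where
    flip : ∀ a b → - (a - b) ≡ (- a) - (- b)
    flip = solve 2 (λ a b → :- (a :- b) := (:- a) :- (:- b)) refl

  *-cauchy : ∀ x y → IsCauchy x → IsCauchy y → IsCauchy (λ n → x n * y n)
  *-cauchy x y cx cy ε ε>0 =
    let A , M , A>0 , boundˣ = eventually-bounded x cx
        B , N , B>0 , boundʸ = eventually-bounded y cy
        α , α>0 , Aα≡ = shrink A (½ * ε) A>0 (half-pos ε>0)
        β , β>0 , Bβ≡ = shrink B (½ * ε) B>0 (half-pos ε>0)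
        M′ , closeˣ = cx β β>0
        N′ , closeʸ = cy α α>0
        K  = M ⊔ N
        K′ = M′ ⊔ N′
    in K ⊔ K′ , λ m n m≥ n≥ →
      sum-bound (x m * y m - x n * y n) (x m * (y m - y n)) (y n * (x m - x n))
        (split (x m) (y m) (x n) (y n))
        (subst (abs (x m * (y m - y n)) <_) Aα≡
          (product-bound (x m) (y m - y n) α A A>0
            (boundˣ m (⊔-boundˡ M N (⊔-boundˡ K K′ m≥)))
            (closeʸ m n (⊔-boundʳ M′ N′ (⊔-boundʳ K K′ m≥))
                        (⊔-boundʳ M′ N′ (⊔-boundʳ K K′ n≥)))))
        (subst (abs (y n * (x m - x n)) <_) Bβ≡
          (product-bound (y n) (x m - x n) β B B>0
            (boundʸ n (⊔-boundʳ M N (⊔-boundˡ K K′ n≥)))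
            (closeˣ m n (⊔-boundˡ M′ N′ (⊔-boundʳ K K′ m≥))
                        (⊔-boundˡ M′ N′ (⊔-boundʳ K K′ n≥)))))
    where
    split : ∀ a b c d → a * b - c * d ≡ a * (b - d) + d * (a - c)
    split = solve 4 (λ a b c d →
      a :* b :- c :* d := a :* (b :- d) :+ d :* (a :- c)) refl

ℝ-rawRing : RawRing 0ℓ 0ℓ
ℝ-rawRing = record
  { Carrier = ℝ
  ; _≈_     = _≈ᴿ_
  ; _+_     = λ x y → mkℝ (λ n → seq x n ℚ.+ seq y n)
                        (+-cauchy (seq x) (seq y) (cauchy x) (cauchy y))
  ; _*_     = λ x y → mkℝ (λ n → seq x n ℚ.* seq y n)
                        (*-cauchy (seq x) (seq y) (cauchy x) (cauchy y))
  ; -_      = λ x → mkℝ (λ n → ℚ.- seq x n) (neg-cauchy (seq x) (cauchy x))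
  ; 0#      = mkℝ (λ _ → 0ℚ) (const-cauchy 0ℚ)
  ; 1#      = mkℝ (λ _ → 1ℚ) (const-cauchy 1ℚ)
  }

------------------------------------------------------------------------
-- Complex numbers

infix 6 _+i_

record ℂ : Set where
  constructor _+i_
  field
    re im : ℝ

open ℂ public

ℂ-rawRing : RawRing 0ℓ 0ℓ
ℂ-rawRing = record
  { Carrier = ℂ
  ; _≈_     = λ z w → re z ≈ re w × im z ≈ im w
  ; _+_     = λ z w → (re z + re w) +i (im z + im w)
  ; _*_     = λ z w → (re z * re w + - (im z * im w)) +i (re z * im w + im z * re w)
  ; -_      = λ z → (- re z) +i (- im z)
  ; 0#      = 0# +i 0#
  ; 1#      = 1# +i 0#
  }
  where open RawRing ℝ-rawRing

------------------------------------------------------------------------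
-- Univariate polynomials

module Polynomial {c ℓ : Level} (R : RawRing c ℓ) where
  open RawRing R

  -- Coefficients in increasing degree.  Trailing zeros are allowed, so the
  -- length of the list is not the degree, and equality is `_≈ᴾ_`.
  Poly : Set c
  Poly = List Carrier

  coeff : Poly → ℕ → Carrier
  coeff []      _       = 0#
  coeff (a ∷ _) zero    = a
  coeff (_ ∷ p) (suc k) = coeff p k

  infix  4 _≈ᴾ_
  infixl 6 _+ᴾ_
  infixl 7 _*ᴾ_

  _≈ᴾ_ : Poly → Poly → Set ℓ
  p ≈ᴾ q = ∀ k → coeff p k ≈ coeff q k

  _+ᴾ_ : Poly → Poly → Poly
  []      +ᴾ q       = q
  (a ∷ p) +ᴾ []      = a ∷ p
  (a ∷ p) +ᴾ (b ∷ q) = (a + b) ∷ (p +ᴾ q)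

  _*ᴾ_ : Poly → Poly → Poly
  []      *ᴾ q = []
  (a ∷ p) *ᴾ q = map (a *_) q +ᴾ (0# ∷ (p *ᴾ q))

  rawRing : RawRing c ℓ
  rawRing = record
    { Carrier = Poly
    ; _≈_     = _≈ᴾ_
    ; _+_     = _+ᴾ_
    ; _*_     = _*ᴾ_
    ; -_      = map -_
    ; 0#      = []
    ; 1#      = 1# ∷ []
    }

  Monic : Pred Poly ℓ
  Monic p = ∃[ d ] (coeff p d ≈ 1# × (∀ k → d ℕ.< k → coeff p k ≈ 0#))

------------------------------------------------------------------------
-- Subsets of a ring

module Subsets {c ℓ : Level} (R : RawRing c ℓ) where
  open RawRing R

  infixl 6 _∔_
  infixl 7 _∙_

  _∔_ : ∀ {a b} → Pred Carrier a → Pred Carrier b → Pred Carrier _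
  (A ∔ B) x = ∃[ s ] ∃[ t ] (A s × B t × x ≈ s + t)

  _∙_ : ∀ {a b} → Pred Carrier a → Pred Carrier b → Pred Carrier _
  (A ∙ B) x = ∃[ s ] ∃[ t ] (A s × B t × x ≈ s * t)

  -- Elements are counted up to `_≈_`.  This is a relation rather than a
  -- function because `_≈_` need not be decidable.  A set covered by a finite
  -- list has a cardinality only up to ¬¬, so assuming one as a hypothesis
  -- costs nothing when the conclusion is decidable.
  HasCardinality : ∀ {a} → Pred Carrier a → ℕ → Set _
  HasCardinality A m = ∃[ f ] Bijective {A = Fin m} {B = ∃ A} _≡_ (_≈_ on proj₁) f

------------------------------------------------------------------------
-- Comparison with a rational power

-- For r = p / q in lowest terms, m < n ^ (p / q) means m ^ q < n ^ p.
-- Only meaningful for r ≥ 0, since the sign of p is dropped.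
infix 4 _<_^ℚ_

_<_^ℚ_ : ℕ → ℕ → ℚ → Set
m < n ^ℚ r = m ℕ.^ (↧ₙ r) ℕ.< n ℕ.^ ∣ ↥ r ∣

ℕ→ℚ : ℕ → ℚ
ℕ→ℚ n = + n ℚ./ 1

------------------------------------------------------------------------
-- The ring ℂ[x]

open Polynomial ℂ-rawRing public
  using (Monic) renaming (Poly to ℂ[x]; rawRing to ℂ[x]-rawRing)
open RawRing ℂ[x]-rawRing public using (_≈_)
open Subsets ℂ[x]-rawRing public

{-# OPTIONS --safe #-}
-- Let K = |S.S| / n. For monic polynomials x and y write x ~ y if x / y is a k-th power of a rational
-- function, k being a large constant. If T contains one element of each ~-class, the products t sᵏ
-- (t ∈ T, s ∈ S) are distinct members of S^(k+1), so the Plünnecke inequality |S^(k+1)| ≲ K^(k+1) n shows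
-- that there are at most K^(k+1), hence at most n^(1/8), classes.
--
-- Four solutions of x + y = z + w with the same classes in each column have a vanishing 4 × 4 determinant,
-- and its 24 terms are k-th powers up to a common factor. A Fermat–Mason argument over ℂ(x) (eliminate terms
-- one by one with Wronskians, then compare degrees) shows that pairwise nonproportional k-th powers are
-- linearly independent, so each of the 24 terms is proportional to another one. But if there were more than
-- 144 n solutions with given classes, four of them could be chosen greedily so that the diagonal term is
-- isolated: each condition x_i a = x_j b to be avoided excludes at most 6 n solutions, by the same argument
-- for 3 × 3 determinants. Thus there are at most 144 n · n^(1/2) nontrivial solutions, and all other pairs
-- (x , y) are determined by x + y up to order.
--
-- Equality in ℂ is undecidable, so case distinctions are made under a double negation; this is harmless
-- because the inequality to be proved is decidable.
module Submission where

open import Algebra.Bundles using (CommutativeRing; CommutativeMonoid)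
open import Algebra.Bundles.Raw using (RawRing)
import Algebra.Properties.Semiring.Mult as SemiringMult
open import Data.Bool.Base using (true; false; if_then_else_)
open import Data.Empty using (⊥; ⊥-elim)
open import Data.Fin.Base as Fin using (Fin; zero; suc)
import Data.Fin.Properties as Fin
import Data.Integer.Base as ℤ
import Data.Integer.Properties as ℤ
open import Data.List.Base as List using (List; []; _∷_; map; length; filter; concatMap; allFin; _++_; cartesianProduct; cartesianProductWith)
import Data.List.Properties as List
open import Data.List.Membership.Propositional using (_∈_; _∉_; find; lose)
import Data.List.Membership.Propositional.Properties as ∈
open import Data.List.Relation.Unary.All as All using (All; []; _∷_)
import Data.List.Relation.Unary.All.Properties as All
open import Data.List.Relation.Unary.Any as Any using (Any; here; there)
import Data.List.Relation.Unary.Any.Properties as Any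
open import Data.List.Relation.Unary.AllPairs using (AllPairs; []; _∷_)
open import Data.List.Relation.Unary.Unique.Propositional using (Unique)
import Data.List.Relation.Unary.Unique.Propositional.Properties as Unique
open import Data.Maybe.Base using (Maybe; just; nothing)
open import Data.Nat.Base as ℕ using (ℕ; zero; suc; z≤n; s≤s)
import Data.Nat.Properties as ℕ
open import Data.Nat.Solver using () renaming (module +-*-Solver to ℕ-Solver)
import Data.Nat.Coprimality as Coprimality
import Data.Rational.Unnormalised.Base as ℚᵘ
import Data.Rational.Unnormalised.Properties as ℚᵘ
open import Data.Product.Base using (∃; ∃-syntax; Σ-syntax; _×_; _,_; proj₁; proj₂)
open import Data.Rational.Base as ℚ using (ℚ; 0ℚ; 1ℚ; ½)
import Data.Rational.Properties as ℚ
open import Data.Sum.Base using (_⊎_; inj₁; inj₂; [_,_]′)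
open import Data.Vec.Base as Vec using (Vec; []; _∷_)
import Data.Vec.Properties as Vec
open import Data.Vec.Functional using (removeAt)
open import Function.Base using (_∘_; id)
open import Level using (0ℓ)
open import Relation.Binary.Definitions as Tri using (_Respects_)
open import Relation.Binary.PropositionalEquality as ≡ using (_≡_; _≢_)
open import Relation.Nullary.Decidable as Dec using (Dec; yes; no; does; ¬?; _×-dec_)
open import Relation.Nullary.Negation using (¬_)
open import Relation.Unary using (Pred; _⊆_)

-- Monicity serves to turn proportionality into equality: elements, or products of two elements, are
-- equal as soon as their Wronskian vanishes, and no sum of two elements is zero. All else takes
-- place in an abstract differential domain with a degree.
--
-- Since the vanishing of a coefficient cannot be decided, degrees occur only as upper bounds. The
-- Fermat-Mason estimate therefore takes the form of a descent: a common bound on the heights of all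
-- ratios is lowered by one until the ratios are constant. It is applied to relations without
-- shorter subrelations, because elimination by Wronskians preserves that property, and that
-- property keeps the remaining terms nonzero.
--
-- The numbers: 144 = 3! · 4! counts the terms of the two determinants. Fewer than n^(1/8) classes
-- leave fewer than n^(1/2) choices for the four columns. For n ≥ 288² the nontrivial solutions then
-- number at most n²/2, and the remaining n²/2 pairs lie at most two over each sum, whence the
-- constant 1/4.

infixl 1 _>>=_

_>>=_ : ∀ {a b} {A : Set a} {B : Set b} → ¬ ¬ A → (A → ¬ ¬ B) → ¬ ¬ B
(m >>= f) ¬b = m λ a → f a ¬b

return : ∀ {a} {A : Set a} → A → ¬ ¬ A
return a ¬a = ¬a a

em : ∀ {a} (A : Set a) → ¬ ¬ Dec A
em A ¬d = ¬d (no λ a → ¬d (yes a))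

-- The double-negation shift, which holds because the index set is finite: the choices are made one
-- after another.
¬¬-∀Fin : ∀ {n p} {P : Fin n → Set p} → (∀ i → ¬ ¬ P i) → ¬ ¬ (∀ i → P i)
¬¬-∀Fin {zero}  h = return λ ()
¬¬-∀Fin {suc n} h = do
  p₀ ← h zero
  ps ← ¬¬-∀Fin (h ∘ suc)
  return λ { zero → p₀ ; (suc i) → ps i }

-- Ring identities

-- Integer coefficients are represented as differences of naturals, which avoids case distinctions on signs.
module RingSolver (R : CommutativeRing 0ℓ 0ℓ) where
  open CommutativeRing R
  open import Algebra.Properties.Ring ring using (-‿distribˡ-*; -‿distribʳ-*)
  open import Algebra.Properties.AbelianGroup +-abelianGroup
    using (⁻¹-∙-comm; ε⁻¹≈ε; ⁻¹-anti-homo‿-)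
  open import Algebra.Properties.CommutativeSemigroup
    (CommutativeMonoid.commutativeSemigroup +-commutativeMonoid) using (interchange)
  open import Algebra.Properties.Semiring.Mult.TCOptimised semiring using (×-homo-+; ×1-homo-*)
    renaming (_×_ to _×′_)
  open import Algebra.Solver.Ring.AlmostCommutativeRing
  open import Relation.Binary.Reasoning.Setoid setoid

  private
    Coeff : RawRing 0ℓ 0ℓ
    Coeff = record
      { Carrier = ℕ × ℕ
      ; _≈_ = _≡_
      ; _+_ = λ (a , b) (c , d) → a ℕ.+ c , b ℕ.+ d
      ; _*_ = λ (a , b) (c , d) → a ℕ.* c ℕ.+ b ℕ.* d , a ℕ.* d ℕ.+ b ℕ.* c
      ; -_ = λ (a , b) → b , a
      ; 0# = 0 , 0
      ; 1# = 1 , 0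
      }

    ι : ℕ → Carrier
    ι n = n ×′ 1#

    -‿+ : ∀ a b c d → (a + c) - (b + d) ≈ (a - b) + (c - d)
    -‿+ a b c d = trans (+-congˡ (sym (⁻¹-∙-comm b d))) (interchange a c (- b) (- d))

    -‿* : ∀ a b c d → (a * c + b * d) - (a * d + b * c) ≈ (a - b) * (c - d)
    -‿* a b c d = begin
      (a * c + b * d) - (a * d + b * c) ≈⟨ -‿+ (a * c) (a * d) (b * d) (b * c) ⟩
      (a * c - a * d) + (b * d - b * c) ≈⟨ +-cong (lem a c d) (lem b d c) ⟩
      a * (c - d) + b * (d - c) ≈⟨ +-congˡ (*-congˡ (⁻¹-anti-homo‿- c d)) ⟨
      a * (c - d) + b * (- (c - d)) ≈⟨ +-congˡ (trans (sym (-‿distribʳ-* b _)) (-‿distribˡ-* b _)) ⟩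
      a * (c - d) + - b * (c - d) ≈⟨ distribʳ (c - d) a (- b) ⟨
      (a - b) * (c - d) ∎
      where
      lem : ∀ x y z → x * y - x * z ≈ x * (y - z)
      lem x y z = trans (+-congˡ (-‿distribʳ-* x z)) (sym (distribˡ x y (- z)))

    -- A pair (a , b) stands for a - b. In particular `con (0 , 0)` denotes `0# - 0#` rather than
    -- `0#`, so chains that use it close with `-‿inverseʳ 0#`.
    morphism : Coeff -Raw-AlmostCommutative⟶ fromCommutativeRing R
    morphism = record
      { ⟦_⟧ = λ (a , b) → ι a - ι b
      ; +-homo = λ (a , b) (c , d) →
          trans (+-cong (×-homo-+ 1# a c) (-‿cong (×-homo-+ 1# b d))) (-‿+ (ι a) (ι b) (ι c) (ι d))
      ; *-homo = λ (a , b) (c , d) →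
          trans (+-cong (homo a c b d) (-‿cong (homo a d b c))) (-‿* (ι a) (ι b) (ι c) (ι d))
      ; -‿homo = λ (a , b) → sym (⁻¹-anti-homo‿- (ι a) (ι b))
      ; 0-homo = trans (+-identityˡ _) ε⁻¹≈ε
      ; 1-homo = trans (+-congˡ ε⁻¹≈ε) (+-identityʳ 1#)
      }
      where
      homo : ∀ a c b d → ι (a ℕ.* c ℕ.+ b ℕ.* d) ≈ ι a * ι c + ι b * ι d
      homo a c b d = trans (×-homo-+ 1# (a ℕ.* c) (b ℕ.* d)) (+-cong (×1-homo-* a c) (×1-homo-* b d))

    coeff≟ : ∀ x y → Maybe (ι (proj₁ x) - ι (proj₂ x) ≈ ι (proj₁ y) - ι (proj₂ y))
    coeff≟ (a , b) (c , d) with a ℕ.+ d ℕ.≟ c ℕ.+ b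
    ... | no _ = nothing
    ... | yes eq = just (begin
      ι a - ι b ≈⟨ +-identityʳ _ ⟨
      (ι a - ι b) + 0# ≈⟨ +-congˡ (-‿inverseʳ (ι d)) ⟨
      (ι a - ι b) + (ι d - ι d) ≈⟨ -‿+ (ι a) (ι b) (ι d) (ι d) ⟨
      (ι a + ι d) - (ι b + ι d) ≈⟨ +-cong (trans (sym (×-homo-+ 1# a d)) (trans (reflexive (≡.cong ι eq)) (×-homo-+ 1# c b))) (-‿cong (+-comm _ _)) ⟩
      (ι c + ι b) - (ι d + ι b) ≈⟨ -‿+ (ι c) (ι d) (ι b) (ι b) ⟩
      (ι c - ι d) + (ι b - ι b) ≈⟨ +-congˡ (-‿inverseʳ (ι b)) ⟩
      (ι c - ι d) + 0# ≈⟨ +-identityʳ _ ⟩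
      ι c - ι d ∎)

  open import Algebra.Solver.Ring Coeff (fromCommutativeRing R) morphism coeff≟ public
    using (solve; _:+_; _:*_; _:-_; :-_; _:=_; con)

-- The reals: ring axioms, stable equality, no zero divisors

module Reals where
  open import Defs using (ℝ; seq; cauchy; _≈ᴿ_; ℝ-rawRing)
  open import Data.Rational.Base using (_+_; _*_; _-_; -_; _<_; _≤_) renaming (∣_∣ to abs)
  open import Data.Rational.Solver using (module +-*-Solver)
  open +-*-Solver
  open RawRing ℝ-rawRing using () renaming (_+_ to _⊕_; _*_ to _⊗_; -_ to ⊝_; 0# to 0ᴿ; 1# to 1ᴿ)

  private
    abstract
      half : ℚ → ℚ
      half ε = ½ * ε

      half-pos : ∀ {ε} → 0ℚ < ε → 0ℚ < half ε
      half-pos {ε} ε>0 = ℚ.positive⁻¹ (½ * ε) {{ℚ.pos*pos⇒pos ½ ε {{ℚ.positive ε>0}}}}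

      halves : ∀ ε → half ε + half ε ≡ ε
      halves ε = ≡.trans (≡.sym (ℚ.*-distribʳ-+ ε ½ ½)) (ℚ.*-identityˡ ε)

    *-pos : ∀ {x y} → 0ℚ < x → 0ℚ < y → 0ℚ < x * y
    *-pos {x} {y} x>0 y>0 = ℚ.positive⁻¹ (x * y) {{ℚ.pos*pos⇒pos x {{ℚ.positive x>0}} y {{ℚ.positive y>0}}}}

    sum-bound : ∀ {ε} c a b → c ≡ a + b → abs a < half ε → abs b < half ε → abs c < ε
    sum-bound {ε} c a b eq a< b< = begin-strict
      abs c ≡⟨ ≡.cong abs eq ⟩
      abs (a + b) ≤⟨ ℚ.∣p+q∣≤∣p∣+∣q∣ a b ⟩
      abs a + abs b <⟨ ℚ.+-mono-< a< b< ⟩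
      half ε + half ε ≡⟨ halves ε ⟩
      ε ∎
      where open ℚ.≤-Reasoning

    telescope : ∀ a b c → a - c ≡ (a - b) + (b - c)
    telescope = solve 3 (λ a b c → a :- c := (a :- b) :+ (b :- c)) ≡.refl

    abs-swap : ∀ a b → abs (a - b) ≡ abs (b - a)
    abs-swap a b = ≡.trans (≡.sym (ℚ.∣-p∣≡∣p∣ (a - b))) (≡.cong abs (flip a b))
      where
      flip : ∀ a b → - (a - b) ≡ b - a
      flip = solve 2 (λ a b → :- (a :- b) := b :- a) ≡.refl

    split : ∀ a b → a ≡ (a - b) + b
    split = solve 2 (λ a b → a := (a :- b) :+ b) ≡.refl

    minus-0 : ∀ a → a - 0ℚ ≡ a
    minus-0 = ℚ.+-identityʳ

    ⊔ˡ : ∀ M N {n} → M ℕ.⊔ N ℕ.≤ n → M ℕ.≤ n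
    ⊔ˡ M N = ℕ.≤-trans (ℕ.m≤m⊔n M N)

    ⊔ʳ : ∀ M N {n} → M ℕ.⊔ N ℕ.≤ n → N ℕ.≤ n
    ⊔ʳ M N = ℕ.≤-trans (ℕ.m≤n⊔m M N)

  pointwise : ∀ {x y} → (∀ n → seq x n ≡ seq y n) → x ≈ᴿ y
  pointwise {x} {y} eq ε ε>0 = 0 , λ n _ →
    ≡.subst (λ z → abs z < ε) (≡.sym (≡.trans (≡.cong (_- seq y n) (eq n)) (ℚ.+-inverseʳ (seq y n)))) ε>0

  ≈-sym : ∀ {x y} → x ≈ᴿ y → y ≈ᴿ x
  ≈-sym {x} {y} h ε ε>0 with h ε ε>0
  ... | N , close = N , λ n N≤n → ≡.subst (_< ε) (abs-swap (seq x n) (seq y n)) (close n N≤n)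

  ≈-trans : ∀ {x y z} → x ≈ᴿ y → y ≈ᴿ z → x ≈ᴿ z
  ≈-trans {x} {y} {z} h g ε ε>0 with h (half ε) (half-pos ε>0) | g (half ε) (half-pos ε>0)
  ... | M , c | N , d = M ℕ.⊔ N , λ n le →
    sum-bound _ _ _ (telescope (seq x n) (seq y n) (seq z n)) (c n (⊔ˡ M N le)) (d n (⊔ʳ M N le))

  ⊕-cong : ∀ {x x′ y y′} → x ≈ᴿ x′ → y ≈ᴿ y′ → (x ⊕ y) ≈ᴿ (x′ ⊕ y′)
  ⊕-cong {x} {x′} {y} {y′} h g ε ε>0 with h (half ε) (half-pos ε>0) | g (half ε) (half-pos ε>0)
  ... | M , c | N , d = M ℕ.⊔ N , λ n le →
    sum-bound _ _ _ (rearrange (seq x n) (seq y n) (seq x′ n) (seq y′ n)) (c n (⊔ˡ M N le)) (d n (⊔ʳ M N le))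
    where
    rearrange : ∀ a b c d → (a + b) - (c + d) ≡ (a - c) + (b - d)
    rearrange = solve 4 (λ a b c d → (a :+ b) :- (c :+ d) := (a :- c) :+ (b :- d)) ≡.refl

  ⊝-cong : ∀ {x y} → x ≈ᴿ y → (⊝ x) ≈ᴿ (⊝ y)
  ⊝-cong {x} {y} h ε ε>0 with h ε ε>0
  ... | N , close = N , λ n N≤n →
    ≡.subst (_< ε) (≡.trans (abs-swap (seq x n) (seq y n)) (≡.cong abs (flip (seq x n) (seq y n)))) (close n N≤n)
    where
    flip : ∀ a b → b - a ≡ (- a) - (- b)
    flip = solve 2 (λ a b → b :- a := (:- a) :- (:- b)) ≡.refl

  eventually-bounded : ∀ x → ∃[ B ] ∃[ N ] (0ℚ < B × (∀ n → N ℕ.≤ n → abs (seq x n) ≤ B))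
  eventually-bounded x with cauchy x 1ℚ (ℚ.positive⁻¹ 1ℚ)
  ... | N , close = 1ℚ + abs (seq x N) , N , ℚ.+-mono-<-≤ (ℚ.positive⁻¹ 1ℚ) (ℚ.0≤∣p∣ (seq x N)) , bound
    where
    bound : ∀ n → N ℕ.≤ n → abs (seq x n) ≤ 1ℚ + abs (seq x N)
    bound n N≤n = begin
      abs (seq x n) ≡⟨ ≡.cong abs (split (seq x n) (seq x N)) ⟩
      abs ((seq x n - seq x N) + seq x N) ≤⟨ ℚ.∣p+q∣≤∣p∣+∣q∣ (seq x n - seq x N) (seq x N) ⟩
      abs (seq x n - seq x N) + abs (seq x N) ≤⟨ ℚ.+-monoˡ-≤ (abs (seq x N)) (ℚ.<⇒≤ (close n N N≤n ℕ.≤-refl)) ⟩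
      1ℚ + abs (seq x N) ∎
      where open ℚ.≤-Reasoning

  private
    shrink : ∀ B ε → 0ℚ < B → 0ℚ < ε → ∃[ δ ] (0ℚ < δ × B * δ ≡ ε)
    shrink B ε B>0 ε>0 = inv * ε , *-pos (ℚ.positive⁻¹ inv {{ℚ.1/pos⇒pos B}}) ε>0 , eq
      where
      instance
        posB = ℚ.positive B>0
        nzB = ℚ.pos⇒nonZero B
      inv = ℚ.1/ B

      eq : B * (inv * ε) ≡ ε
      eq = ≡.trans (≡.sym (ℚ.*-assoc B inv ε)) (≡.trans (≡.cong (_* ε) (ℚ.*-inverseʳ B)) (ℚ.*-identityˡ ε))

    product-bound : ∀ a b δ B → 0ℚ < B → abs a ≤ B → abs b < δ → abs (a * b) < B * δ
    product-bound a b δ B B>0 a≤B b<δ = begin-strict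
      abs (a * b) ≡⟨ ℚ.∣p*q∣≡∣p∣*∣q∣ a b ⟩
      abs a * abs b ≤⟨ ℚ.*-monoʳ-≤-nonNeg (abs b) {{ℚ.∣-∣-nonNeg b}} a≤B ⟩
      B * abs b <⟨ ℚ.*-monoʳ-<-pos B {{ℚ.positive B>0}} b<δ ⟩
      B * δ ∎
      where open ℚ.≤-Reasoning

    *-distribˡ-- : ∀ a b c → a * b - a * c ≡ a * (b - c)
    *-distribˡ-- = solve 3 (λ a b c → a :* b :- a :* c := a :* (b :- c)) ≡.refl

  ⊗-congˡ : ∀ x {y y′} → y ≈ᴿ y′ → (x ⊗ y) ≈ᴿ (x ⊗ y′)
  ⊗-congˡ x {y} {y′} h ε ε>0 =
    let B , M , B>0 , bound = eventually-bounded x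
        δ , δ>0 , Bδ = shrink B ε B>0 ε>0
        N , close = h δ δ>0
    in M ℕ.⊔ N , λ n le →
      ≡.subst₂ _<_ (≡.cong abs (≡.sym (*-distribˡ-- (seq x n) (seq y n) (seq y′ n)))) Bδ
        (product-bound (seq x n) (seq y n - seq y′ n) δ B B>0 (bound n (⊔ˡ M N le)) (close n (⊔ʳ M N le)))

  ⊗-comm : ∀ x y → (x ⊗ y) ≈ᴿ (y ⊗ x)
  ⊗-comm x y = pointwise {x ⊗ y} {y ⊗ x} λ n → ℚ.*-comm (seq x n) (seq y n)

  ⊗-cong : ∀ {x x′ y y′} → x ≈ᴿ x′ → y ≈ᴿ y′ → (x ⊗ y) ≈ᴿ (x′ ⊗ y′)
  ⊗-cong {x} {x′} {y} {y′} h g =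
    ≈-trans {x ⊗ y} {x ⊗ y′} {x′ ⊗ y′} (⊗-congˡ x {y} {y′} g)
      (≈-trans {x ⊗ y′} {y′ ⊗ x} {x′ ⊗ y′} (⊗-comm x y′)
        (≈-trans {y′ ⊗ x} {y′ ⊗ x′} {x′ ⊗ y′} (⊗-congˡ y′ {x} {x′} h) (⊗-comm y′ x′)))

  ℝ-commutativeRing : CommutativeRing 0ℓ 0ℓ
  ℝ-commutativeRing = record
    { Carrier = ℝ
    ; _≈_ = _≈ᴿ_
    ; _+_ = _⊕_
    ; _*_ = _⊗_
    ; -_ = ⊝_
    ; 0# = 0ᴿ
    ; 1# = 1ᴿ
    ; isCommutativeRing = record
      { isRing = record
        { +-isAbelianGroup = record
          { isGroup = record
            { isMonoid = record
              { isSemigroup = record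
                { isMagma = record
                  { isEquivalence = record
                    { refl = λ {x} → pointwise {x} {x} λ _ → ≡.refl
                    ; sym = λ {x} {y} → ≈-sym {x} {y}
                    ; trans = λ {x} {y} {z} → ≈-trans {x} {y} {z}
                    }
                  ; ∙-cong = λ {x} {x′} {y} {y′} → ⊕-cong {x} {x′} {y} {y′}
                  }
                ; assoc = λ x y z → pointwise {(x ⊕ y) ⊕ z} {x ⊕ (y ⊕ z)} λ n → ℚ.+-assoc (seq x n) (seq y n) (seq z n)
                }
              ; identity = (λ x → pointwise {0ᴿ ⊕ x} {x} λ n → ℚ.+-identityˡ (seq x n))
                         , (λ x → pointwise {x ⊕ 0ᴿ} {x} λ n → ℚ.+-identityʳ (seq x n))
              }
            ; inverse = (λ x → pointwise {(⊝ x) ⊕ x} {0ᴿ} λ n → ℚ.+-inverseˡ (seq x n))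
                      , (λ x → pointwise {x ⊕ (⊝ x)} {0ᴿ} λ n → ℚ.+-inverseʳ (seq x n))
            ; ⁻¹-cong = λ {x} {y} → ⊝-cong {x} {y}
            }
          ; comm = λ x y → pointwise {x ⊕ y} {y ⊕ x} λ n → ℚ.+-comm (seq x n) (seq y n)
          }
        ; *-cong = λ {x} {x′} {y} {y′} → ⊗-cong {x} {x′} {y} {y′}
        ; *-assoc = λ x y z → pointwise {(x ⊗ y) ⊗ z} {x ⊗ (y ⊗ z)} λ n → ℚ.*-assoc (seq x n) (seq y n) (seq z n)
        ; *-identity = (λ x → pointwise {1ᴿ ⊗ x} {x} λ n → ℚ.*-identityˡ (seq x n))
                     , (λ x → pointwise {x ⊗ 1ᴿ} {x} λ n → ℚ.*-identityʳ (seq x n))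
        ; distrib = (λ x y z → pointwise {x ⊗ (y ⊕ z)} {(x ⊗ y) ⊕ (x ⊗ z)} λ n → ℚ.*-distribˡ-+ (seq x n) (seq y n) (seq z n))
                  , (λ x y z → pointwise {(y ⊕ z) ⊗ x} {(y ⊗ x) ⊕ (z ⊗ x)} λ n → ℚ.*-distribʳ-+ (seq x n) (seq y n) (seq z n))
        }
      ; *-comm = ⊗-comm
      }
    }

  -- The modulus of convergence of x and y fixes N independently of the doubly negated hypothesis.
  ≈-stable : ∀ {x y} → ¬ ¬ x ≈ᴿ y → x ≈ᴿ y
  ≈-stable {x} {y} ¬¬h ε ε>0 with cauchy x (half ε) (half-pos ε>0) | cauchy y (half (half ε)) (half-pos (half-pos ε>0))
  ... | M , c | N , d = M ℕ.⊔ N , λ n le → claim n (⊔ˡ M N le) (⊔ʳ M N le)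
    where
    claim : ∀ n → M ℕ.≤ n → N ℕ.≤ n → abs (seq x n - seq y n) < ε
    claim n M≤n N≤n with abs (seq x n - seq y n) ℚ.<? ε
    ... | yes lt = lt
    ... | no ≮ = ⊥-elim (¬¬h λ h → ≮ (go (h (half (half ε)) (half-pos (half-pos ε>0)))))
      where
      go : ∃[ K ] (∀ n → K ℕ.≤ n → abs (seq x n - seq y n) < half (half ε)) → abs (seq x n - seq y n) < ε
      go (K , e) =
        let m = M ℕ.⊔ (N ℕ.⊔ K)
            M≤m = ⊔ˡ M (N ℕ.⊔ K) {m} ℕ.≤-refl
            N≤m = ⊔ˡ N K {m} (⊔ʳ M (N ℕ.⊔ K) {m} ℕ.≤-refl)
            K≤m = ⊔ʳ N K {m} (⊔ʳ M (N ℕ.⊔ K) {m} ℕ.≤-refl)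
        in sum-bound _ _ _ (telescope (seq x n) (seq x m) (seq y n)) (c n m M≤n M≤m)
             (sum-bound _ _ _ (telescope (seq x m) (seq y m) (seq y n)) (e m K≤m) (d m n N≤m N≤n))

  BoundedAway : ℝ → Set
  BoundedAway x = ∃[ ε ] ∃[ N ] (0ℚ < ε × (∀ n → N ℕ.≤ n → ε ≤ abs (seq x n)))

  -- Past an index N where the sequence varies by less than ε/4, the decidable test |x N| < ε/2
  -- settles the matter: if it holds, all later terms are below ε, and if it fails, they stay at
  -- least ε/4 away from 0.
  ≉0⇒boundedAway : ∀ x → ¬ x ≈ᴿ 0ᴿ → ¬ ¬ BoundedAway x
  ≉0⇒boundedAway x x≉0 ¬away = x≉0 x≈0
    where
    x≈0 : x ≈ᴿ 0ᴿ
    x≈0 ε ε>0 with cauchy x (half (half ε)) (half-pos (half-pos ε>0))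
    ... | N , c with abs (seq x N) ℚ.<? half ε
    ... | yes lt = N , λ n N≤n →
        sum-bound _ _ _ (≡.trans (≡.cong (_- 0ℚ) (split (seq x n) (seq x N))) (minus-0 _))
          (ℚ.<-trans (c n N N≤n ℕ.≤-refl) quarter<half) lt
      where
      quarter<half : half (half ε) < half ε
      quarter<half = begin-strict
        half (half ε) ≡⟨ ℚ.+-identityʳ _ ⟨
        half (half ε) + 0ℚ <⟨ ℚ.+-monoʳ-< (half (half ε)) (half-pos (half-pos ε>0)) ⟩
        half (half ε) + half (half ε) ≡⟨ halves (half ε) ⟩
        half ε ∎
        where open ℚ.≤-Reasoning
    ... | no ≮ = ⊥-elim (¬away (half (half ε) , N , half-pos (half-pos ε>0) , λ n N≤n → ℚ.≮⇒≥ λ lt →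
        ≮ (sum-bound _ _ _ (split (seq x N) (seq x n)) (c N n ℕ.≤-refl N≤n) lt)))

  -- With ε a lower bound for |x|, tolerance η for `y` follows from tolerance ε η for the product.
  -- Stability of `_≈ᴿ_` pays for the lower bound, which is known only under a double negation.
  ⊗-domain : ∀ x y → (x ⊗ y) ≈ᴿ 0ᴿ → ¬ x ≈ᴿ 0ᴿ → y ≈ᴿ 0ᴿ
  ⊗-domain x y xy≈0 x≉0 = ≈-stable {y} {0ᴿ} do
    (ε , N , ε>0 , away) ← ≉0⇒boundedAway x x≉0
    return λ η η>0 → let M , small = xy≈0 (ε * η) (*-pos ε>0 η>0) in
      N ℕ.⊔ M , λ n le → ≡.subst (λ z → abs z < η) (≡.sym (minus-0 _)) (ℚ.≰⇒> λ η≤ → ℚ.<-irrefl ≡.refl (begin-strict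
        ε * η ≤⟨ ℚ.*-monoˡ-≤-nonNeg ε {{ℚ.pos⇒nonNeg ε {{ℚ.positive ε>0}}}} η≤ ⟩
        ε * abs (seq y n) ≤⟨ ℚ.*-monoʳ-≤-nonNeg (abs (seq y n)) {{ℚ.∣-∣-nonNeg (seq y n)}} (away n (⊔ˡ N M le)) ⟩
        abs (seq x n) * abs (seq y n) ≡⟨ ℚ.∣p*q∣≡∣p∣*∣q∣ (seq x n) (seq y n) ⟨
        abs (seq x n * seq y n) ≡⟨ ≡.cong abs (minus-0 _) ⟨
        abs (seq x n * seq y n - 0ℚ) <⟨ small n (⊔ʳ N M le) ⟩
        ε * η ∎))
    where open ℚ.≤-Reasoning

  private
    abs-sq : ∀ a → abs a * abs a ≡ a * a
    abs-sq a with ℚ.∣p∣≡p∨∣p∣≡-p a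
    ... | inj₁ eq = ≡.cong₂ _*_ eq eq
    ... | inj₂ eq = ≡.trans (≡.cong₂ _*_ eq eq) (neg² a)
      where
      neg² : ∀ a → (- a) * (- a) ≡ a * a
      neg² = solve 1 (λ a → (:- a) :* (:- a) := a :* a) ≡.refl

    0≤sq : ∀ a → 0ℚ ≤ a * a
    0≤sq a = ≡.subst (0ℚ ≤_) (abs-sq a) (ℚ.nonNegative⁻¹ (abs a * abs a) {{ℚ.nonNeg*nonNeg⇒nonNeg (abs a) {{ℚ.∣-∣-nonNeg a}} (abs a) {{ℚ.∣-∣-nonNeg a}}}})

  -- Were |x| at least ε at a late index, x² + y² would be at least ε², which is the tolerance asked
  -- of the sum.
  sum-of-squares : ∀ x y → ((x ⊗ x) ⊕ (y ⊗ y)) ≈ᴿ 0ᴿ → x ≈ᴿ 0ᴿ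
  sum-of-squares x y h ε ε>0 with h (ε * ε) (*-pos ε>0 ε>0)
  ... | N , small = N , λ n N≤n → ≡.subst (λ z → abs z < ε) (≡.sym (minus-0 _)) (ℚ.≰⇒> λ ε≤ → ℚ.<-irrefl ≡.refl (begin-strict
      ε * ε ≤⟨ ℚ.*-monoˡ-≤-nonNeg ε {{ℚ.pos⇒nonNeg ε {{ℚ.positive ε>0}}}} ε≤ ⟩
      ε * abs (seq x n) ≤⟨ ℚ.*-monoʳ-≤-nonNeg (abs (seq x n)) {{ℚ.∣-∣-nonNeg (seq x n)}} ε≤ ⟩
      abs (seq x n) * abs (seq x n) ≡⟨ abs-sq (seq x n) ⟩
      seq x n * seq x n ≡⟨ ℚ.+-identityʳ _ ⟨
      seq x n * seq x n + 0ℚ ≤⟨ ℚ.+-monoʳ-≤ (seq x n * seq x n) (0≤sq (seq y n)) ⟩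
      seq x n * seq x n + seq y n * seq y n ≡⟨ ℚ.0≤p⇒∣p∣≡p (ℚ.+-mono-≤ (0≤sq (seq x n)) (0≤sq (seq y n))) ⟨
      abs (seq x n * seq x n + seq y n * seq y n) ≡⟨ ≡.cong abs (minus-0 _) ⟨
      abs ((seq x n * seq x n + seq y n * seq y n) - 0ℚ) <⟨ small n N≤n ⟩
      ε * ε ∎))
    where open ℚ.≤-Reasoning

  open CommutativeRing ℝ-commutativeRing using (semiring)
  open import Algebra.Properties.Semiring.Mult semiring using (×-assoc-*; ×-congʳ) renaming (_×_ to _·_)

  -- The real number n + 1 has all entries at least 1, so it is nonzero and can be cancelled.
  ℝ-char0 : ∀ n x → (suc n · x) ≈ᴿ 0ᴿ → x ≈ᴿ 0ᴿ
  ℝ-char0 n x h = ⊗-domain (suc n · 1ᴿ) x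
    (≈-trans {(suc n · 1ᴿ) ⊗ x} {suc n · (1ᴿ ⊗ x)} {0ᴿ} (×-assoc-* (suc n) 1ᴿ x)
      (≈-trans {suc n · (1ᴿ ⊗ x)} {suc n · x} {0ᴿ} (×-congʳ (suc n) {1ᴿ ⊗ x} {x} (pointwise {1ᴿ ⊗ x} {x} λ n → ℚ.*-identityˡ (seq x n))) h))
    sn≉0
    where
    nonneg : ∀ n k → 0ℚ ≤ seq (n · 1ᴿ) k
    nonneg zero k = ℚ.≤-refl
    nonneg (suc n) k = ℚ.+-mono-≤ (ℚ.nonNegative⁻¹ 1ℚ) (nonneg n k)

    sn≥1 : ∀ k → 1ℚ ≤ seq (suc n · 1ᴿ) k
    sn≥1 k = ≡.subst (_≤ seq (suc n · 1ᴿ) k) (ℚ.+-identityʳ 1ℚ) (ℚ.+-monoʳ-≤ 1ℚ (nonneg n k))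

    sn≉0 : ¬ (suc n · 1ᴿ) ≈ᴿ 0ᴿ
    sn≉0 h with h 1ℚ (ℚ.positive⁻¹ 1ℚ)
    ... | N , small = ℚ.<-irrefl ≡.refl (ℚ.<-≤-trans (small N ℕ.≤-refl)
      (≡.subst (1ℚ ≤_) (≡.sym (≡.trans (≡.cong abs (minus-0 _)) (ℚ.0≤p⇒∣p∣≡p (ℚ.≤-trans (ℚ.nonNegative⁻¹ 1ℚ) (sn≥1 N))))) (sn≥1 N)))

  ℝ-nontrivial : ¬ 1ᴿ ≈ᴿ 0ᴿ
  ℝ-nontrivial h with h 1ℚ (ℚ.positive⁻¹ 1ℚ)
  ... | N , small = ℚ.<-irrefl ≡.refl (small N ℕ.≤-refl)

-- The complex numbers as pairs of reals

module Gaussian (R : CommutativeRing 0ℓ 0ℓ) where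
  open CommutativeRing R
  open RingSolver R

  rawRing² : RawRing 0ℓ 0ℓ
  rawRing² = record
    { Carrier = Carrier × Carrier
    ; _≈_ = λ (a , b) (c , d) → a ≈ c × b ≈ d
    ; _+_ = λ (a , b) (c , d) → a + c , b + d
    ; _*_ = λ (a , b) (c , d) → a * c + - (b * d) , a * d + b * c
    ; -_ = λ (a , b) → - a , - b
    ; 0# = 0# , 0#
    ; 1# = 1# , 0#
    }

  commutativeRing² : CommutativeRing 0ℓ 0ℓ
  commutativeRing² = record
    { RawRing rawRing²
    ; isCommutativeRing = record
      { isRing = record
        { +-isAbelianGroup = record
          { isGroup = record
            { isMonoid = record
              { isSemigroup = record
                { isMagma = record
                  { isEquivalence = record
                    { refl = refl , refl
                    ; sym = λ (p , q) → sym p , sym q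
                    ; trans = λ (p , q) (r , s) → trans p r , trans q s
                    }
                  ; ∙-cong = λ (p , q) (r , s) → +-cong p r , +-cong q s
                  }
                ; assoc = λ x y z → +-assoc (proj₁ x) (proj₁ y) (proj₁ z) , +-assoc (proj₂ x) (proj₂ y) (proj₂ z)
                }
              ; identity = (λ x → +-identityˡ (proj₁ x) , +-identityˡ (proj₂ x))
                         , (λ x → +-identityʳ (proj₁ x) , +-identityʳ (proj₂ x))
              }
            ; inverse = (λ x → -‿inverseˡ (proj₁ x) , -‿inverseˡ (proj₂ x))
                      , (λ x → -‿inverseʳ (proj₁ x) , -‿inverseʳ (proj₂ x))
            ; ⁻¹-cong = λ (p , q) → -‿cong p , -‿cong q
            }
          ; comm = λ x y → +-comm (proj₁ x) (proj₁ y) , +-comm (proj₂ x) (proj₂ y)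
          }
        ; *-cong = λ (p , q) (r , s) →
            +-cong (*-cong p r) (-‿cong (*-cong q s)) , +-cong (*-cong p s) (*-cong q r)
        ; *-assoc = λ x y z →
            solve 6 (λ a b c d e f →
              (a :* c :+ (:- (b :* d))) :* e :+ (:- ((a :* d :+ b :* c) :* f))
                := a :* (c :* e :+ (:- (d :* f))) :+ (:- (b :* (c :* f :+ d :* e))))
              refl (proj₁ x) (proj₂ x) (proj₁ y) (proj₂ y) (proj₁ z) (proj₂ z) ,
            solve 6 (λ a b c d e f →
              (a :* c :+ (:- (b :* d))) :* f :+ (a :* d :+ b :* c) :* e
                := a :* (c :* f :+ d :* e) :+ b :* (c :* e :+ (:- (d :* f))))
              refl (proj₁ x) (proj₂ x) (proj₁ y) (proj₂ y) (proj₁ z) (proj₂ z)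
        ; *-identity = (λ x → identityʳᵉ (proj₁ x) (proj₂ x) , identityⁱᵐ (proj₁ x) (proj₂ x))
                     , (λ x → trans (+-cong (*-comm (proj₁ x) 1#) (-‿cong (*-comm (proj₂ x) 0#))) (identityʳᵉ (proj₁ x) (proj₂ x))
                            , trans (+-comm _ _) (trans (+-cong (*-comm (proj₂ x) 1#) (*-comm (proj₁ x) 0#)) (identityⁱᵐ (proj₁ x) (proj₂ x))))
        ; distrib = (λ x y z →
              solve 6 (λ a b c d e f → a :* (c :+ e) :+ (:- (b :* (d :+ f)))
                := (a :* c :+ (:- (b :* d))) :+ (a :* e :+ (:- (b :* f))))
                refl (proj₁ x) (proj₂ x) (proj₁ y) (proj₂ y) (proj₁ z) (proj₂ z) ,
              solve 6 (λ a b c d e f → a :* (d :+ f) :+ b :* (c :+ e)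
                := (a :* d :+ b :* c) :+ (a :* f :+ b :* e))
                refl (proj₁ x) (proj₂ x) (proj₁ y) (proj₂ y) (proj₁ z) (proj₂ z))
          , (λ x y z →
              solve 6 (λ a b c d e f → (c :+ e) :* a :+ (:- ((d :+ f) :* b))
                := (c :* a :+ (:- (d :* b))) :+ (e :* a :+ (:- (f :* b))))
                refl (proj₁ x) (proj₂ x) (proj₁ y) (proj₂ y) (proj₁ z) (proj₂ z) ,
              solve 6 (λ a b c d e f → (c :+ e) :* b :+ (d :+ f) :* a
                := (c :* b :+ d :* a) :+ (e :* b :+ f :* a))
                refl (proj₁ x) (proj₂ x) (proj₁ y) (proj₂ y) (proj₁ z) (proj₂ z))
        }
      ; *-comm = λ x y →
          +-cong (*-comm (proj₁ x) (proj₁ y)) (-‿cong (*-comm (proj₂ x) (proj₂ y))) ,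
          trans (+-comm _ _) (+-cong (*-comm (proj₂ x) (proj₁ y)) (*-comm (proj₁ x) (proj₂ y)))
      }
    }
    where
    open import Algebra.Properties.Ring ring using (-0#≈0#)
    identityʳᵉ : ∀ a b → 1# * a + - (0# * b) ≈ a
    identityʳᵉ a b = trans (+-cong (*-identityˡ a) (trans (-‿cong (zeroˡ b)) -0#≈0#)) (+-identityʳ a)
    identityⁱᵐ : ∀ a b → 1# * b + 0# * a ≈ b
    identityⁱᵐ a b = trans (+-cong (*-identityˡ b) (zeroˡ a)) (+-identityʳ b)

  -- The norm a² + b² of z = a + bi is nonzero, and ‖z‖·w = z̄·(zw).
  domain : (∀ x y → x * y ≈ 0# → ¬ x ≈ 0# → y ≈ 0#) →
           (∀ x y → x * x + y * y ≈ 0# → x ≈ 0#) →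
           ∀ a b c d → a * c + - (b * d) ≈ 0# → a * d + b * c ≈ 0# →
           ¬ (a ≈ 0# × b ≈ 0#) → c ≈ 0# × d ≈ 0#
  domain dom sos a b c d p q z≉0 =
    dom _ c norm-c norm≉0 , dom _ d norm-d norm≉0
    where
    kill : ∀ u v {x y} → x ≈ 0# → y ≈ 0# → u * x + v * y ≈ 0#
    kill u v x≈0 y≈0 = trans (+-cong (trans (*-congˡ x≈0) (zeroʳ u)) (trans (*-congˡ y≈0) (zeroʳ v))) (+-identityˡ 0#)

    norm≉0 : ¬ a * a + b * b ≈ 0#
    norm≉0 h = z≉0 (sos a b h , sos b a (trans (+-comm _ _) h))

    norm-c : (a * a + b * b) * c ≈ 0#
    norm-c = trans (solve 4 (λ a b c d → (a :* a :+ b :* b) :* c :=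
      a :* (a :* c :+ (:- (b :* d))) :+ b :* (a :* d :+ b :* c)) refl a b c d) (kill a b p q)

    norm-d : (a * a + b * b) * d ≈ 0#
    norm-d = trans (solve 4 (λ a b c d → (a :* a :+ b :* b) :* d :=
      a :* (a :* d :+ b :* c) :+ (:- b) :* (a :* c :+ (:- (b :* d)))) refl a b c d) (kill a (- b) q p)

module Complexes where
  open import Defs using (ℝ; ℂ; _+i_; re; im; ℂ-rawRing)
  open Reals
  open CommutativeRing ℝ-commutativeRing using (_≈_; _+_; 0#; semiring)
  open RawRing ℂ-rawRing using () renaming (_≈_ to _≈ᶜ_; _+_ to _+ᶜ_; _*_ to _*ᶜ_; -_ to -ᶜ_; 0# to 0ᶜ; 1# to 1ᶜ)
  open import Algebra.Properties.Semiring.Mult semiring using () renaming (_×_ to _·_)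
  open import Algebra.Definitions.RawMonoid (RawRing.+-rawMonoid ℂ-rawRing) using () renaming (_×_ to _·ᶜ_)

  private
    module ℝ² = Gaussian ℝ-commutativeRing
    module ≈² = CommutativeRing ℝ².commutativeRing²

    parts : ℂ → ℝ × ℝ
    parts z = re z , im z

  -- The ring laws are transported from pairs along `parts`, whose homomorphism conditions hold by
  -- reflexivity.
  ℂ-commutativeRing : CommutativeRing 0ℓ 0ℓ
  ℂ-commutativeRing = record { RawRing ℂ-rawRing ; isCommutativeRing = isCommutativeRing² }
    where
    open import Algebra.Morphism.Structures using (module RingMorphisms)
    open RingMorphisms ℂ-rawRing ℝ².rawRing² using (IsRingMonomorphism)

    monomorphism : IsRingMonomorphism parts
    monomorphism = record
      { isRingHomomorphism = record
        { isSemiringHomomorphism = record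
          { isNearSemiringHomomorphism = record
            { +-isMonoidHomomorphism = record
              { isMagmaHomomorphism = record
                { isRelHomomorphism = record { cong = id }
                ; homo = λ z w → ≈².refl {parts (z +ᶜ w)}
                }
              ; ε-homo = ≈².refl {parts 0ᶜ}
              }
            ; *-homo = λ z w → ≈².refl {parts (z *ᶜ w)}
            }
          ; 1#-homo = ≈².refl {parts 1ᶜ}
          }
        ; -‿homo = λ z → ≈².refl {parts (-ᶜ z)}
        }
      ; injective = id
      }

    import Algebra.Morphism.RingMonomorphism monomorphism as Mono
    isCommutativeRing² = Mono.isCommutativeRing ≈².isCommutativeRing

  ℂ-stable : ∀ {z w} → ¬ ¬ z ≈ᶜ w → z ≈ᶜ w
  ℂ-stable {z} {w} ¬¬h =
    ≈-stable {re z} {re w} (¬¬h >>= λ h → return (proj₁ h)) ,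
    ≈-stable {im z} {im w} (¬¬h >>= λ h → return (proj₂ h))

  ℂ-domain : ∀ z w → (z *ᶜ w) ≈ᶜ 0ᶜ → ¬ z ≈ᶜ 0ᶜ → w ≈ᶜ 0ᶜ
  ℂ-domain (a +i b) (c +i d) (p , q) z≉0 =
    ℝ².domain ⊗-domain sum-of-squares a b c d p q z≉0

  ℂ-char0 : ∀ n z → (suc n ·ᶜ z) ≈ᶜ 0ᶜ → z ≈ᶜ 0ᶜ
  ℂ-char0 n z (p , q) = ℝ-char0 n (re z) (≡.subst (_≈ 0#) (re-· (suc n)) p)
                      , ℝ-char0 n (im z) (≡.subst (_≈ 0#) (im-· (suc n)) q)
    where
    re-· : ∀ m → re (m ·ᶜ z) ≡ m · re z
    re-· zero = ≡.refl
    re-· (suc m) = ≡.cong (λ u → re z + u) (re-· m)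
    im-· : ∀ m → im (m ·ᶜ z) ≡ m · im z
    im-· zero = ≡.refl
    im-· (suc m) = ≡.cong (λ u → im z + u) (im-· m)

-- Differential domains with a degree

record DifferentialDomain : Set₁ where
  field
    commutativeRing : CommutativeRing 0ℓ 0ℓ
  open CommutativeRing commutativeRing public hiding (zero)
  open SemiringMult semiring public using () renaming (_×_ to _·_)
  field
    stable    : ∀ {x y} → ¬ ¬ x ≈ y → x ≈ y
    1≉0       : ¬ 1# ≈ 0#
    char0     : ∀ n {x} → suc n · x ≈ 0# → x ≈ 0#
    δ         : Carrier → Carrier
    δ-cong    : ∀ {x y} → x ≈ y → δ x ≈ δ y
    δ-+       : ∀ x y → δ (x + y) ≈ δ x + δ y
    δ-*       : ∀ x y → δ (x * y) ≈ δ x * y + x * δ y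
    -- Only bounds on the degree appear, since exact degrees cannot be computed. Zero, and nothing
    -- else, has degree below 0, so `¬ Deg< 0 x` says that `x` is nonzero.
    Deg<      : ℕ → Carrier → Set
    Deg<-cong : ∀ {n x y} → x ≈ y → Deg< n x → Deg< n y
    Deg<-mono : ∀ {m n x} → m ℕ.≤ n → Deg< m x → Deg< n x
    Deg<-+    : ∀ {n x y} → Deg< n x → Deg< n y → Deg< n (x + y)
    Deg<-neg  : ∀ {n x} → Deg< n x → Deg< n (- x)
    -- The successors turn strict bounds into weak ones: degrees at most m and n add up.
    Deg<-*    : ∀ {m n x y} → Deg< (suc m) x → Deg< (suc n) y → Deg< (suc (m ℕ.+ n)) (x * y)
    Deg<-δ    : ∀ {n x} → Deg< n x → Deg< n (δ x)
    Deg<-1    : Deg< 1 1#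
    Deg<-fin  : ∀ x → ∃[ n ] Deg< n x
    Deg<0⇒≈0  : ∀ {x} → Deg< 0 x → x ≈ 0#
    ≈0⇒Deg<0  : ∀ {x} → x ≈ 0# → Deg< 0 x
    Deg<1⇒δ≈0 : ∀ {x} → Deg< 1 x → δ x ≈ 0#
    Deg≥-*    : ∀ {m n x y} → ¬ Deg< m x → ¬ Deg< n y → ¬ Deg< (m ℕ.+ n) (x * y)
    -- A quotient with derivative zero is constant. It is written as a pair `c`, `d` because there
    -- is no division.
    ∝⇒multiple : ∀ {x y} → δ x * y ≈ x * δ y → ¬ y ≈ 0# →
      ¬ ¬ (∃[ c ] ∃[ d ] (Deg< 1 c × Deg< 1 d × (¬ c ≈ 0#) × c * x ≈ d * y))
    -- Reduction of x / y to lowest terms x′ / y′, certified by a Bézout combination with nonzero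
    -- constant value.
    bezout : ∀ x y → ¬ y ≈ 0# → ¬ ¬ (∃[ x′ ] ∃[ y′ ] ∃[ u ] ∃[ v ]
      (x * y′ ≈ y * x′ × (¬ y′ ≈ 0#) × Deg< 1 (u * x′ + v * y′) × ¬ u * x′ + v * y′ ≈ 0#))

  infix 4 _∝_

  -- The Wronskian vanishes, i.e. x / y is constant.
  _∝_ : Carrier → Carrier → Set
  x ∝ y = δ x * y ≈ x * δ y

  Constant : Carrier → Set
  Constant = Deg< 1

-- Polynomials over a domain of characteristic zero

record CharacteristicZeroDomain : Set₁ where
  field
    commutativeRing : CommutativeRing 0ℓ 0ℓ
  open CommutativeRing commutativeRing public hiding (zero)
  open SemiringMult semiring public using (×-congʳ; ×-comm-*; ×-assoc-*) renaming (_×_ to _·_)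
  field
    stable : ∀ {x y} → ¬ ¬ x ≈ y → x ≈ y
    1≉0    : ¬ 1# ≈ 0#
    domain : ∀ x y → x * y ≈ 0# → ¬ x ≈ 0# → y ≈ 0#
    char0  : ∀ n x → suc n · x ≈ 0# → x ≈ 0#

module PolynomialDomain (F : CharacteristicZeroDomain) where
  open CharacteristicZeroDomain F
  open import Defs using (module Polynomial)
  open Polynomial rawRing using (Poly; coeff; _≈ᴾ_; _+ᴾ_; _*ᴾ_; Monic)
  open import Algebra.Properties.CommutativeMonoid.Mult +-commutativeMonoid using (×-distrib-+)
  open import Algebra.Properties.Ring ring using (-‿distribˡ-*; -‿distribʳ-*; -0#≈0#)

  infix 4 _≋_

  -- A record, so that p and q can be inferred from a proof of p ≋ q.
  record _≋_ (p q : Poly) : Set where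
    constructor mk
    field at : p ≈ᴾ q
  open _≋_ public

  -ᴾ_ : Poly → Poly
  -ᴾ_ = map (λ a → - a)

  scale : Carrier → Poly → Poly
  scale a = map (a *_)

  coeff-+ : ∀ p q k → coeff (p +ᴾ q) k ≈ coeff p k + coeff q k
  coeff-+ []      q       k       = sym (+-identityˡ _)
  coeff-+ (a ∷ p) []      k       = sym (+-identityʳ _)
  coeff-+ (a ∷ p) (b ∷ q) zero    = refl
  coeff-+ (a ∷ p) (b ∷ q) (suc k) = coeff-+ p q k

  coeff-neg : ∀ p k → coeff (-ᴾ p) k ≈ - coeff p k
  coeff-neg []      k       = sym -0#≈0#
  coeff-neg (a ∷ p) zero    = refl
  coeff-neg (a ∷ p) (suc k) = coeff-neg p k

  coeff-scale : ∀ a p k → coeff (scale a p) k ≈ a * coeff p k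
  coeff-scale a []      k       = sym (zeroʳ a)
  coeff-scale a (b ∷ p) zero    = refl
  coeff-scale a (b ∷ p) (suc k) = coeff-scale a p k

  ≋-refl : ∀ {p} → p ≋ p
  ≋-refl = mk λ k → refl

  ≋-sym : ∀ {p q} → p ≋ q → q ≋ p
  ≋-sym h = mk λ k → sym (at h k)

  ≋-trans : ∀ {p q r} → p ≋ q → q ≋ r → p ≋ r
  ≋-trans h g = mk λ k → trans (at h k) (at g k)

  via-+ : ∀ {p q x} → (∀ k → coeff p k + coeff q k ≈ coeff x k) → p +ᴾ q ≋ x
  via-+ {p} {q} h = mk λ k → trans (coeff-+ p q k) (h k)

  +ᴾ-cong : ∀ {p p′ q q′} → p ≋ p′ → q ≋ q′ → p +ᴾ q ≋ p′ +ᴾ q′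
  +ᴾ-cong {p} {p′} {q} {q′} h g = mk λ k →
    trans (coeff-+ p q k) (trans (+-cong (at h k) (at g k)) (sym (coeff-+ p′ q′ k)))

  +ᴾ-assoc : ∀ p q r → (p +ᴾ q) +ᴾ r ≋ p +ᴾ (q +ᴾ r)
  +ᴾ-assoc p q r = mk λ k → trans (coeff-+ (p +ᴾ q) r k) (trans (+-congʳ (coeff-+ p q k))
    (trans (+-assoc _ _ _) (sym (trans (coeff-+ p (q +ᴾ r) k) (+-congˡ (coeff-+ q r k))))))

  +ᴾ-comm : ∀ p q → p +ᴾ q ≋ q +ᴾ p
  +ᴾ-comm p q = mk λ k → trans (coeff-+ p q k) (trans (+-comm _ _) (sym (coeff-+ q p k)))

  +ᴾ-identityʳ : ∀ p → p +ᴾ [] ≋ p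
  +ᴾ-identityʳ p = via-+ {p} {[]} λ k → +-identityʳ _

  +ᴾ-inverseʳ : ∀ p → p +ᴾ (-ᴾ p) ≋ []
  +ᴾ-inverseʳ p = via-+ {p} { -ᴾ p} λ k → trans (+-congˡ (coeff-neg p k)) (-‿inverseʳ _)

  -ᴾ-cong : ∀ {p q} → p ≋ q → (-ᴾ p) ≋ (-ᴾ q)
  -ᴾ-cong {p} {q} h = mk λ k → trans (coeff-neg p k) (trans (-‿cong (at h k)) (sym (coeff-neg q k)))

  ∷-cong : ∀ {a b p q} → a ≈ b → p ≋ q → a ∷ p ≋ b ∷ q
  ∷-cong h g = mk λ { zero → h ; (suc k) → at g k }

  ≋-tail : ∀ {a b p q} → a ∷ p ≋ b ∷ q → p ≋ q
  ≋-tail h = mk λ k → at h (suc k)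

  ∷-zero : ∀ {a p} → a ≈ 0# → p ≋ [] → a ∷ p ≋ []
  ∷-zero h g = mk λ { zero → h ; (suc k) → at g k }

  shift-+ : ∀ p q → 0# ∷ (p +ᴾ q) ≋ (0# ∷ p) +ᴾ (0# ∷ q)
  shift-+ p q = ∷-cong (sym (+-identityˡ 0#)) ≋-refl

  scale-cong : ∀ {a b p q} → a ≈ b → p ≋ q → scale a p ≋ scale b q
  scale-cong {a} {b} {p} {q} h g = mk λ k →
    trans (coeff-scale a p k) (trans (*-cong h (at g k)) (sym (coeff-scale b q k)))

  scale-zero : ∀ p → scale 0# p ≋ []
  scale-zero p = mk λ k → trans (coeff-scale 0# p k) (zeroˡ _)

  scale-one : ∀ p → scale 1# p ≋ p
  scale-one p = mk λ k → trans (coeff-scale 1# p k) (*-identityˡ _)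

  scale-+ : ∀ a p q → scale a (p +ᴾ q) ≋ scale a p +ᴾ scale a q
  scale-+ a p q = mk λ k → trans (coeff-scale a (p +ᴾ q) k) (trans (*-congˡ (coeff-+ p q k))
    (trans (distribˡ a _ _) (sym (trans (coeff-+ (scale a p) (scale a q) k)
      (+-cong (coeff-scale a p k) (coeff-scale a q k))))))

  scale-+ˡ : ∀ a b p → scale (a + b) p ≋ scale a p +ᴾ scale b p
  scale-+ˡ a b p = mk λ k → trans (coeff-scale (a + b) p k) (trans (distribʳ _ a b)
    (sym (trans (coeff-+ (scale a p) (scale b p) k) (+-cong (coeff-scale a p k) (coeff-scale b p k)))))

  scale-scale : ∀ a b p → scale a (scale b p) ≋ scale (a * b) p
  scale-scale a b p = mk λ k → trans (coeff-scale a (scale b p) k) (trans (*-congˡ (coeff-scale b p k))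
    (trans (sym (*-assoc a b _)) (sym (coeff-scale (a * b) p k))))

  +ᴾ-commutativeMonoid : CommutativeMonoid 0ℓ 0ℓ
  +ᴾ-commutativeMonoid = record
    { Carrier = Poly ; _≈_ = _≋_ ; _∙_ = _+ᴾ_ ; ε = []
    ; isCommutativeMonoid = record
      { isMonoid = record
        { isSemigroup = record
          { isMagma = record
            { isEquivalence = record { refl = ≋-refl ; sym = ≋-sym ; trans = ≋-trans }
            ; ∙-cong = +ᴾ-cong }
          ; assoc = +ᴾ-assoc }
        ; identity = (λ p → ≋-refl) , +ᴾ-identityʳ }
      ; comm = +ᴾ-comm }
    }

  open CommutativeMonoid +ᴾ-commutativeMonoid using () renaming (setoid to ≋-setoid; ∙-congˡ to +ᴾ-congˡ; ∙-congʳ to +ᴾ-congʳ)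
  open import Algebra.Properties.CommutativeSemigroup
    (CommutativeMonoid.commutativeSemigroup +ᴾ-commutativeMonoid)
    using () renaming (interchange to +ᴾ-interchange; x∙yz≈y∙xz to +ᴾ-swap)
  module ≋-R where
    open import Relation.Binary.Reasoning.Setoid ≋-setoid public

  *ᴾ-zeroˡ : ∀ p q → p ≋ [] → p *ᴾ q ≋ []
  *ᴾ-zeroˡ []      q h = ≋-refl
  *ᴾ-zeroˡ (a ∷ p) q h =
    ≋-trans (+ᴾ-cong (≋-trans (scale-cong (at h 0) ≋-refl) (scale-zero q))
                     (∷-zero refl (*ᴾ-zeroˡ p q (mk λ k → at h (suc k)))))
            ≋-refl

  *ᴾ-zeroʳ : ∀ p → p *ᴾ [] ≋ []
  *ᴾ-zeroʳ []      = ≋-refl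
  *ᴾ-zeroʳ (a ∷ p) = ∷-zero refl (*ᴾ-zeroʳ p)

  -- Equal polynomials may be lists of different lengths, so the induction can end with one list
  -- empty and the other full of zeros.
  *ᴾ-congʳ : ∀ {p p′} q → p ≋ p′ → p *ᴾ q ≋ p′ *ᴾ q
  *ᴾ-congʳ {[]}    {p′}    q h = ≋-sym (*ᴾ-zeroˡ p′ q (≋-sym h))
  *ᴾ-congʳ {a ∷ p} {[]}    q h = *ᴾ-zeroˡ (a ∷ p) q h
  *ᴾ-congʳ {a ∷ p} {b ∷ p′} q h =
    +ᴾ-cong (scale-cong (at h 0) ≋-refl) (∷-cong refl (*ᴾ-congʳ q (≋-tail h)))

  *ᴾ-congˡ : ∀ p {q q′} → q ≋ q′ → p *ᴾ q ≋ p *ᴾ q′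
  *ᴾ-congˡ []      h = ≋-refl
  *ᴾ-congˡ (a ∷ p) h = +ᴾ-cong (scale-cong refl h) (∷-cong refl (*ᴾ-congˡ p h))

  *ᴾ-distribˡ : ∀ p q r → p *ᴾ (q +ᴾ r) ≋ p *ᴾ q +ᴾ p *ᴾ r
  *ᴾ-distribˡ []      q r = ≋-refl
  *ᴾ-distribˡ (a ∷ p) q r = begin
    scale a (q +ᴾ r) +ᴾ (0# ∷ p *ᴾ (q +ᴾ r))
      ≈⟨ +ᴾ-cong (scale-+ a q r) (≋-trans (∷-cong refl (*ᴾ-distribˡ p q r)) (shift-+ (p *ᴾ q) (p *ᴾ r))) ⟩
    (scale a q +ᴾ scale a r) +ᴾ ((0# ∷ p *ᴾ q) +ᴾ (0# ∷ p *ᴾ r))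
      ≈⟨ +ᴾ-interchange (scale a q) (scale a r) (0# ∷ p *ᴾ q) (0# ∷ p *ᴾ r) ⟩
    (a ∷ p) *ᴾ q +ᴾ (a ∷ p) *ᴾ r ∎
    where open ≋-R

  *ᴾ-distribʳ : ∀ r p q → (p +ᴾ q) *ᴾ r ≋ p *ᴾ r +ᴾ q *ᴾ r
  *ᴾ-distribʳ r []      q       = ≋-refl
  *ᴾ-distribʳ r (a ∷ p) []      = ≋-sym (+ᴾ-identityʳ _)
  *ᴾ-distribʳ r (a ∷ p) (b ∷ q) = begin
    scale (a + b) r +ᴾ (0# ∷ (p +ᴾ q) *ᴾ r)
      ≈⟨ +ᴾ-cong (scale-+ˡ a b r) (≋-trans (∷-cong refl (*ᴾ-distribʳ r p q)) (shift-+ (p *ᴾ r) (q *ᴾ r))) ⟩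
    (scale a r +ᴾ scale b r) +ᴾ ((0# ∷ p *ᴾ r) +ᴾ (0# ∷ q *ᴾ r))
      ≈⟨ +ᴾ-interchange (scale a r) (scale b r) (0# ∷ p *ᴾ r) (0# ∷ q *ᴾ r) ⟩
    (a ∷ p) *ᴾ r +ᴾ (b ∷ q) *ᴾ r ∎
    where open ≋-R

  scale-* : ∀ a p q → scale a p *ᴾ q ≋ scale a (p *ᴾ q)
  scale-* a []      q = ≋-refl
  scale-* a (b ∷ p) q = begin
    scale (a * b) q +ᴾ (0# ∷ scale a p *ᴾ q)
      ≈⟨ +ᴾ-cong (≋-sym (scale-scale a b q)) (∷-cong (sym (zeroʳ a)) (scale-* a p q)) ⟩
    scale a (scale b q) +ᴾ scale a (0# ∷ p *ᴾ q)
      ≈⟨ scale-+ a (scale b q) (0# ∷ p *ᴾ q) ⟨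
    scale a ((b ∷ p) *ᴾ q) ∎
    where open ≋-R

  0∷-* : ∀ p q → (0# ∷ p) *ᴾ q ≋ 0# ∷ (p *ᴾ q)
  0∷-* p q = +ᴾ-congʳ (scale-zero q)

  *ᴾ-assoc : ∀ p q r → (p *ᴾ q) *ᴾ r ≋ p *ᴾ (q *ᴾ r)
  *ᴾ-assoc []      q r = ≋-refl
  *ᴾ-assoc (a ∷ p) q r = begin
    (scale a q +ᴾ (0# ∷ p *ᴾ q)) *ᴾ r ≈⟨ *ᴾ-distribʳ r (scale a q) (0# ∷ p *ᴾ q) ⟩
    scale a q *ᴾ r +ᴾ (0# ∷ p *ᴾ q) *ᴾ r ≈⟨ +ᴾ-cong (scale-* a q r) (≋-trans (0∷-* (p *ᴾ q) r) (∷-cong refl (*ᴾ-assoc p q r))) ⟩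
    (a ∷ p) *ᴾ (q *ᴾ r) ∎
    where open ≋-R

  *ᴾ-∷ : ∀ p b q → p *ᴾ (b ∷ q) ≋ scale b p +ᴾ (0# ∷ p *ᴾ q)
  *ᴾ-∷ []      b q = ≋-sym (∷-zero refl ≋-refl)
  *ᴾ-∷ (a ∷ p) b q = ∷-cong (+-congʳ (*-comm a b)) (begin
    scale a q +ᴾ p *ᴾ (b ∷ q) ≈⟨ +ᴾ-congˡ (*ᴾ-∷ p b q) ⟩
    scale a q +ᴾ (scale b p +ᴾ (0# ∷ p *ᴾ q)) ≈⟨ +ᴾ-swap (scale a q) (scale b p) (0# ∷ p *ᴾ q) ⟩
    scale b p +ᴾ (scale a q +ᴾ (0# ∷ p *ᴾ q)) ∎)
    where open ≋-R

  *ᴾ-comm : ∀ p q → p *ᴾ q ≋ q *ᴾ p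
  *ᴾ-comm []      q = ≋-sym (*ᴾ-zeroʳ q)
  *ᴾ-comm (a ∷ p) q = ≋-trans (+ᴾ-congˡ (∷-cong refl (*ᴾ-comm p q))) (≋-sym (*ᴾ-∷ q a p))

  constant : Carrier → Poly
  constant a = a ∷ []

  constant-* : ∀ a p → constant a *ᴾ p ≋ scale a p
  constant-* a p = ≋-trans (+ᴾ-congˡ (∷-zero refl ≋-refl)) (+ᴾ-identityʳ _)

  *ᴾ-identityˡ : ∀ p → constant 1# *ᴾ p ≋ p
  *ᴾ-identityˡ p = ≋-trans (constant-* 1# p) (scale-one p)

  polynomialRing : CommutativeRing 0ℓ 0ℓ
  polynomialRing = record
    { Carrier = Poly ; _≈_ = _≋_ ; _+_ = _+ᴾ_ ; _*_ = _*ᴾ_ ; -_ = -ᴾ_ ; 0# = [] ; 1# = constant 1#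
    ; isCommutativeRing = record
      { isRing = record
        { +-isAbelianGroup = record
          { isGroup = record
            { isMonoid = CommutativeMonoid.isMonoid +ᴾ-commutativeMonoid
            ; inverse = (λ p → ≋-trans (+ᴾ-comm _ p) (+ᴾ-inverseʳ p)) , +ᴾ-inverseʳ
            ; ⁻¹-cong = -ᴾ-cong
            }
          ; comm = +ᴾ-comm
          }
        ; *-cong = λ {p} {p′} {q} {q′} h g → ≋-trans (*ᴾ-congʳ q h) (*ᴾ-congˡ p′ g)
        ; *-assoc = *ᴾ-assoc
        ; *-identity = *ᴾ-identityˡ , λ p → ≋-trans (*ᴾ-comm p _) (*ᴾ-identityˡ p)
        ; distrib = *ᴾ-distribˡ , *ᴾ-distribʳ
        }
      ; *-comm = *ᴾ-comm
      }
    }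

  ≋-stable : ∀ {p q} → ¬ ¬ p ≋ q → p ≋ q
  ≋-stable h = mk λ k → stable (h >>= λ g → return (at g k))

  ·-zero : ∀ n → n · 0# ≈ 0#
  ·-zero zero    = refl
  ·-zero (suc n) = trans (+-identityˡ _) (·-zero n)

  derivative : Poly → Poly
  derivative []      = []
  derivative (a ∷ p) = p +ᴾ (0# ∷ derivative p)

  coeff-derivative : ∀ p k → coeff (derivative p) k ≈ suc k · coeff p (suc k)
  coeff-derivative []      k       = sym (·-zero (suc k))
  coeff-derivative (a ∷ p) zero    = coeff-+ p (0# ∷ derivative p) 0
  coeff-derivative (a ∷ p) (suc k) = trans (coeff-+ p (0# ∷ derivative p) (suc k)) (+-congˡ (coeff-derivative p k))

  derivative-cong : ∀ {p q} → p ≋ q → derivative p ≋ derivative q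
  derivative-cong {p} {q} h = mk λ k →
    trans (coeff-derivative p k) (trans (×-congʳ (suc k) (at h (suc k))) (sym (coeff-derivative q k)))

  derivative-+ : ∀ p q → derivative (p +ᴾ q) ≋ derivative p +ᴾ derivative q
  derivative-+ p q = mk λ k → trans (coeff-derivative (p +ᴾ q) k) (trans (×-congʳ (suc k) (coeff-+ p q (suc k)))
    (trans (×-distrib-+ _ _ (suc k)) (sym (trans (coeff-+ (derivative p) (derivative q) k)
      (+-cong (coeff-derivative p k) (coeff-derivative q k))))))

  derivative-scale : ∀ a p → derivative (scale a p) ≋ scale a (derivative p)
  derivative-scale a p = mk λ k → trans (coeff-derivative (scale a p) k) (trans (×-congʳ (suc k) (coeff-scale a p (suc k)))
    (sym (trans (coeff-scale a (derivative p) k) (trans (*-congˡ (coeff-derivative p k)) (×-comm-* (suc k) a _)))))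

  derivative-* : ∀ p q → derivative (p *ᴾ q) ≋ derivative p *ᴾ q +ᴾ p *ᴾ derivative q
  derivative-* []      q = ≋-refl
  derivative-* (a ∷ p) q = begin
    derivative (scale a q +ᴾ (0# ∷ p *ᴾ q))
      ≈⟨ derivative-+ (scale a q) (0# ∷ p *ᴾ q) ⟩
    derivative (scale a q) +ᴾ (p *ᴾ q +ᴾ (0# ∷ derivative (p *ᴾ q)))
      ≈⟨ +ᴾ-cong (derivative-scale a q) (+ᴾ-congˡ (≋-trans (∷-cong refl (derivative-* p q)) (shift-+ (derivative p *ᴾ q) (p *ᴾ derivative q)))) ⟩
    scale a (derivative q) +ᴾ (p *ᴾ q +ᴾ ((0# ∷ derivative p *ᴾ q) +ᴾ (0# ∷ p *ᴾ derivative q)))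
      ≈⟨ +ᴾ-congˡ {scale a (derivative q)} (+ᴾ-assoc (p *ᴾ q) (0# ∷ derivative p *ᴾ q) (0# ∷ p *ᴾ derivative q)) ⟨
    scale a (derivative q) +ᴾ ((p *ᴾ q +ᴾ (0# ∷ derivative p *ᴾ q)) +ᴾ (0# ∷ p *ᴾ derivative q))
      ≈⟨ +ᴾ-swap (scale a (derivative q)) (p *ᴾ q +ᴾ (0# ∷ derivative p *ᴾ q)) (0# ∷ p *ᴾ derivative q) ⟩
    (p *ᴾ q +ᴾ (0# ∷ derivative p *ᴾ q)) +ᴾ (a ∷ p) *ᴾ derivative q
      ≈⟨ +ᴾ-congʳ (≋-trans (*ᴾ-distribʳ q p (0# ∷ derivative p)) (+ᴾ-congˡ {p *ᴾ q} (0∷-* (derivative p) q))) ⟨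
    (p +ᴾ (0# ∷ derivative p)) *ᴾ q +ᴾ (a ∷ p) *ᴾ derivative q ∎
    where open ≋-R

  Below : ℕ → Poly → Set
  Below n p = ∀ k → n ℕ.≤ k → coeff p k ≈ 0#

  Below-cong : ∀ {n p q} → p ≋ q → Below n p → Below n q
  Below-cong h b k n≤k = trans (sym (at h k)) (b k n≤k)

  Below-mono : ∀ {m n p} → m ℕ.≤ n → Below m p → Below n p
  Below-mono m≤n b k n≤k = b k (ℕ.≤-trans m≤n n≤k)

  Below-+ : ∀ {n p q} → Below n p → Below n q → Below n (p +ᴾ q)
  Below-+ {_} {p} {q} b c k n≤k = trans (coeff-+ p q k) (trans (+-cong (b k n≤k) (c k n≤k)) (+-identityˡ 0#))

  Below-neg : ∀ {n p} → Below n p → Below n (-ᴾ p)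
  Below-neg {_} {p} b k n≤k = trans (coeff-neg p k) (trans (-‿cong (b k n≤k)) -0#≈0#)

  Below-scale : ∀ {n} a {p} → Below n p → Below n (scale a p)
  Below-scale a {p} b k n≤k = trans (coeff-scale a p k) (trans (*-congˡ (b k n≤k)) (zeroʳ a))

  Below-derivative : ∀ {n p} → Below n p → Below n (derivative p)
  Below-derivative {_} {p} b k n≤k = trans (coeff-derivative p k)
    (trans (×-congʳ (suc k) (b (suc k) (ℕ.m≤n⇒m≤1+n n≤k))) (·-zero (suc k)))

  Below-length : ∀ p → Below (length p) p
  Below-length []      k       _         = refl
  Below-length (a ∷ p) (suc k) (s≤s n≤k) = Below-length p k n≤k

  Below-0 : ∀ {p} → Below 0 p → p ≋ []
  Below-0 b = mk λ k → b k z≤n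

  -- The bounds m and n need not be sharp, and the two coefficients may vanish. Thus the formula
  -- applies without knowledge of any degree.
  top-coeff : ∀ p {q m n} → Below (suc m) p → Below (suc n) q →
              coeff (p *ᴾ q) (m ℕ.+ n) ≈ coeff p m * coeff q n × Below (suc (m ℕ.+ n)) (p *ᴾ q)
  top-coeff []      {q} {m} {n} b c = sym (zeroˡ _) , λ k _ → refl
  top-coeff (a ∷ p) {q} {zero}  {n} b c = trans (reduce n) (coeff-scale a q n) ,
    λ k n<k → trans (reduce k) (Below-scale a {q} c k n<k)
    where
    pq≋0 : 0# ∷ p *ᴾ q ≋ []
    pq≋0 = ∷-zero refl (*ᴾ-zeroˡ p q (mk λ k → b (suc k) (s≤s z≤n)))
    reduce : ∀ k → coeff ((a ∷ p) *ᴾ q) k ≈ coeff (scale a q) k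
    reduce k = trans (coeff-+ (scale a q) (0# ∷ p *ᴾ q) k) (trans (+-congˡ (at pq≋0 k)) (+-identityʳ _))
  top-coeff (a ∷ p) {q} {suc m} {n} b c with top-coeff p {q} {m} {n} (λ k m<k → b (suc k) (s≤s m<k)) c
  ... | top , below = trans (reduce (m ℕ.+ n) (s≤s (ℕ.m≤n+m n m))) top ,
    λ { (suc k) (s≤s le) → trans (reduce k (s≤s (ℕ.≤-trans (ℕ.m≤n+m n m) (ℕ.<⇒≤ le)))) (below k le) }
    where
    reduce : ∀ k → n ℕ.< suc k → coeff ((a ∷ p) *ᴾ q) (suc k) ≈ coeff (p *ᴾ q) k
    reduce k n<k = trans (coeff-+ (scale a q) (0# ∷ p *ᴾ q) (suc k))
      (trans (+-congʳ (Below-scale a {q} c (suc k) n<k)) (+-identityˡ _))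

  HasDegree : ℕ → Poly → Set
  HasDegree d p = Below (suc d) p × ¬ coeff p d ≈ 0#

  -- The search runs down from the length of the list; each test of a leading coefficient costs a
  -- double negation.
  degree≥ : ∀ {n} p → ¬ Below n p → ¬ ¬ (∃[ d ] (n ℕ.≤ d × HasDegree d p))
  degree≥ {n} p ¬b = go (length p) (Below-length p)
    where
    go : ∀ N → Below N p → ¬ ¬ (∃[ d ] (n ℕ.≤ d × HasDegree d p))
    go zero    b = ⊥-elim (¬b (Below-mono {p = p} z≤n b))
    go (suc N) b = em (coeff p N ≈ 0#) >>= λ where
      (yes pN≈0) → go N λ k N≤k → [ (λ N<k → b k N<k) , (λ { ≡.refl → pN≈0 }) ]′ (ℕ.m≤n⇒m<n∨m≡n N≤k)
      (no pN≉0) → return (N , ℕ.≮⇒≥ (λ N<n → ¬b (Below-mono {p = p} N<n b)) , b , pN≉0)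

  degree : ∀ p → ¬ p ≋ [] → ¬ ¬ (∃[ d ] HasDegree d p)
  degree p p≉0 = degree≥ {0} p (λ b → p≉0 (Below-0 {p} b)) >>= λ (d , _ , h) → return (d , h)

  HasDegree⇒≉0 : ∀ {d p} → HasDegree d p → ¬ p ≋ []
  HasDegree⇒≉0 (_ , top) h = top (at h _)

  *-≉0 : ∀ {x y} → ¬ x ≈ 0# → ¬ y ≈ 0# → ¬ x * y ≈ 0#
  *-≉0 x≉0 y≉0 xy≈0 = y≉0 (domain _ _ xy≈0 x≉0)

  HasDegree-* : ∀ {m n p q} → HasDegree m p → HasDegree n q → HasDegree (m ℕ.+ n) (p *ᴾ q)
  HasDegree-* {p = p} {q} (b , x) (c , y) = let top , below = top-coeff p {q} b c in
    below , λ h → *-≉0 x y (trans (sym top) h)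

  ¬Below-* : ∀ {m n p q} → ¬ Below m p → ¬ Below n q → ¬ Below (m ℕ.+ n) (p *ᴾ q)
  ¬Below-* {m} {n} {p} {q} ¬b ¬c below = (do
    (d , m≤d , hp) ← degree≥ p ¬b
    (e , n≤e , hq) ← degree≥ q ¬c
    λ _ → proj₂ (HasDegree-* {p = p} {q} hp hq) (below (d ℕ.+ e) (ℕ.+-mono-≤ m≤d n≤e)))
    (λ (x : ⊥) → x)

  ·-injective : ∀ m n {x} → ¬ x ≈ 0# → m · x ≈ n · x → m ≡ n
  ·-injective zero    zero    x≉0 h = ≡.refl
  ·-injective zero    (suc n) x≉0 h = ⊥-elim (x≉0 (char0 n _ (sym h)))
  ·-injective (suc m) zero    x≉0 h = ⊥-elim (x≉0 (char0 m _ h))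
  ·-injective (suc m) (suc n) {x} x≉0 h = ≡.cong suc (·-injective m n x≉0 (+-cancelˡ x _ _ h))
    where open import Algebra.Properties.Group +-group using () renaming (∙-cancelˡ to +-cancelˡ)

  infix 4 _∝_
  _∝_ : Poly → Poly → Set
  p ∝ q = derivative p *ᴾ q ≋ p *ᴾ derivative q

  -- x d/dx, unlike d/dx, preserves degrees.
  euler : Poly → Poly
  euler p = 0# ∷ derivative p

  coeff-euler : ∀ p k → coeff (euler p) k ≈ k · coeff p k
  coeff-euler p zero    = refl
  coeff-euler p (suc k) = coeff-derivative p k

  Below-euler : ∀ {n p} → Below n p → Below n (euler p)
  Below-euler b zero    n≤k = refl
  Below-euler {n} {p} b (suc k) n≤k = trans (coeff-derivative p k) (trans (×-congʳ (suc k) (b (suc k) n≤k)) (·-zero (suc k)))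

  -- Multiplying the relation by x replaces the derivatives by Euler operators. The coefficient at m
  -- + n then reads m a b = n a b with a and b the leading coefficients, and characteristic zero
  -- gives m = n.
  ∝-degree : ∀ {p q m n} → p ∝ q → HasDegree m p → HasDegree n q → m ≡ n
  ∝-degree {p} {q} {m} {n} p∝q (b , x) (c , y) = ·-injective m n (*-≉0 x y) (begin
    m · (coeff p m * coeff q n) ≈⟨ ×-assoc-* m _ _ ⟨
    (m · coeff p m) * coeff q n ≈⟨ *-congʳ (coeff-euler p m) ⟨
    coeff (euler p) m * coeff q n ≈⟨ proj₁ (top-coeff (euler p) {q} (Below-euler {_} {p} b) c) ⟨
    coeff (euler p *ᴾ q) (m ℕ.+ n) ≈⟨ at euler-eq (m ℕ.+ n) ⟩
    coeff (p *ᴾ euler q) (m ℕ.+ n) ≈⟨ proj₁ (top-coeff p {euler q} b (Below-euler {_} {q} c)) ⟩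
    coeff p m * coeff (euler q) n ≈⟨ *-congˡ (coeff-euler q n) ⟩
    coeff p m * (n · coeff q n) ≈⟨ ×-comm-* n _ _ ⟩
    n · (coeff p m * coeff q n) ∎)
    where
    open import Relation.Binary.Reasoning.Setoid setoid
    euler-eq : euler p *ᴾ q ≋ p *ᴾ euler q
    euler-eq = ≋-trans (0∷-* (derivative p) q) (≋-trans (∷-cong refl p∝q)
      (≋-sym (≋-trans (*ᴾ-comm p (euler q)) (≋-trans (0∷-* (derivative q) p) (∷-cong refl (*ᴾ-comm (derivative q) p))))))

  module P = CommutativeRing polynomialRing
  open SemiringMult P.semiring using () renaming (_×_ to _P′·_)

  ∝-combination : ∀ {p q} a b → p ∝ q → scale a p +ᴾ scale b q ∝ q
  ∝-combination {p} {q} a b p∝q = begin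
    derivative (scale a p +ᴾ scale b q) *ᴾ q
      ≈⟨ P.*-congʳ {q} (≋-trans (derivative-+ (scale a p) (scale b q)) (+ᴾ-cong (derivative-scale a p) (derivative-scale b q))) ⟩
    (scale a (derivative p) +ᴾ scale b (derivative q)) *ᴾ q
      ≈⟨ *ᴾ-distribʳ q (scale a (derivative p)) (scale b (derivative q)) ⟩
    scale a (derivative p) *ᴾ q +ᴾ scale b (derivative q) *ᴾ q
      ≈⟨ +ᴾ-cong (scale-* a (derivative p) q) (scale-* b (derivative q) q) ⟩
    scale a (derivative p *ᴾ q) +ᴾ scale b (derivative q *ᴾ q)
      ≈⟨ +ᴾ-cong (scale-cong refl p∝q) (scale-cong refl (*ᴾ-comm (derivative q) q)) ⟩
    scale a (p *ᴾ derivative q) +ᴾ scale b (q *ᴾ derivative q)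
      ≈⟨ +ᴾ-cong (scale-* a p (derivative q)) (scale-* b q (derivative q)) ⟨
    scale a p *ᴾ derivative q +ᴾ scale b q *ᴾ derivative q
      ≈⟨ *ᴾ-distribʳ (derivative q) (scale a p) (scale b q) ⟨
    (scale a p +ᴾ scale b q) *ᴾ derivative q ∎
    where open ≋-R

  -- With ν and μ the leading coefficients of `q` and `p`, the difference ν p - μ q is still
  -- proportional to `q`, but its coefficient in the degree of `q` is zero. By `∝-degree` it cannot
  -- be nonzero.
  ∝⇒multiple : ∀ {p q m n} → p ∝ q → HasDegree m p → HasDegree n q →
               scale (coeff q n) p ≋ scale (coeff p m) q
  ∝⇒multiple {p} {q} {m} {n} p∝q hp hq = mk λ k → begin
    coeff (scale ν p) k ≈⟨ coeff-scale ν p k ⟩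
    ν * coeff p k ≈⟨ inverseˡ-unique _ _ (trans (sym (coeff-r k)) (at r≋0 k)) ⟩
    - (- μ * coeff q k) ≈⟨ -‿cong (-‿distribˡ-* μ (coeff q k)) ⟨
    - (- (μ * coeff q k)) ≈⟨ ⁻¹-involutive _ ⟩
    μ * coeff q k ≈⟨ coeff-scale μ q k ⟨
    coeff (scale μ q) k ∎
    where
    open import Algebra.Properties.Group +-group using (⁻¹-involutive; inverseˡ-unique)
    open import Relation.Binary.Reasoning.Setoid setoid
    ν = coeff q n
    μ = coeff p m
    r = scale ν p +ᴾ scale (- μ) q
    coeff-r : ∀ k → coeff r k ≈ ν * coeff p k + - μ * coeff q k
    coeff-r k = trans (coeff-+ (scale ν p) (scale (- μ) q) k) (+-cong (coeff-scale ν p k) (coeff-scale (- μ) q k))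
    r-top : coeff r n ≈ 0#
    r-top = begin
      coeff r n ≈⟨ coeff-r n ⟩
      ν * coeff p n + - μ * ν ≡⟨ ≡.cong (λ e → ν * coeff p e + - μ * ν) (≡.sym (∝-degree {p} {q} p∝q hp hq)) ⟩
      ν * μ + - μ * ν ≈⟨ +-cong (*-comm ν μ) (sym (-‿distribˡ-* μ ν)) ⟩
      μ * ν - μ * ν ≈⟨ -‿inverseʳ _ ⟩
      0# ∎
    r≋0 : r ≋ []
    r≋0 = ≋-stable λ r≉0 → degree r r≉0 λ (d , hr) →
      proj₂ hr (≡.subst (λ d → coeff r d ≈ 0#) (≡.sym (∝-degree {r} {q} (∝-combination {p} {q} ν (- μ) p∝q) hr hq)) r-top)

  Monic⇒HasDegree : ∀ {p} → ((d , _) : Monic p) → HasDegree d p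
  Monic⇒HasDegree (d , top , below) = below , λ h → 1≉0 (trans (sym top) h)

  -- The factors that relate proportional polynomials are their leading coefficients, here both 1.
  Monic-∝⇒≋ : ∀ {p q} → Monic p → Monic q → p ∝ q → p ≋ q
  Monic-∝⇒≋ {p} {q} mp mq p∝q = ≋-trans (unscale (proj₁ (proj₂ mq)))
    (≋-trans (∝⇒multiple p∝q (Monic⇒HasDegree {p} mp) (Monic⇒HasDegree {q} mq)) (≋-sym (unscale (proj₁ (proj₂ mp)))))
    where
    unscale : ∀ {a p} → a ≈ 1# → p ≋ scale a p
    unscale {a} {p} a≈1 = ≋-sym (≋-trans (scale-cong a≈1 ≋-refl) (scale-one p))

  Monic-* : ∀ {p q} → Monic p → Monic q → Monic (p *ᴾ q)
  Monic-* {p} {q} (d , top , below) (e , top′ , below′) = let eq , b = top-coeff p {q} below below′ in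
    d ℕ.+ e , trans eq (trans (*-cong top top′) (*-identityˡ 1#)) , b

  -- With unequal degrees the leading coefficient 1 of the larger one survives; with equal degrees
  -- the leading coefficient is 2, which is nonzero in characteristic zero.
  ¬-Monic-+-≋0 : ∀ {p q} → Monic p → Monic q → ¬ p +ᴾ q ≋ []
  ¬-Monic-+-≋0 {p} {q} mp@(d , top , below) mq@(e , top′ , below′) h with ℕ.<-cmp d e
  ... | Tri.tri< d<e _ _ = 1≉0 (trans (sym top′) (trans (sym (+-identityˡ _)) (trans (+-congʳ (sym (below e d<e))) (sum e))))
    where
    sum : ∀ k → coeff p k + coeff q k ≈ 0#
    sum k = trans (sym (coeff-+ p q k)) (at h k)
  ... | Tri.tri≈ _ ≡.refl _ = 1≉0 (char0 1 1# (trans (+-congˡ (+-identityʳ 1#))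
          (trans (+-cong (sym top) (sym top′)) (trans (sym (coeff-+ p q d)) (at h d)))))
  ... | Tri.tri> _ _ e<d = 1≉0 (trans (sym top) (trans (sym (+-identityʳ _)) (trans (+-congˡ (sym (below′ d e<d))) (sum d))))
    where
    sum : ∀ k → coeff p k + coeff q k ≈ 0#
    sum k = trans (sym (coeff-+ p q k)) (at h k)

  shift : ℕ → Poly → Poly
  shift zero    p = p
  shift (suc j) p = 0# ∷ shift j p

  coeff-shift : ∀ j p k → coeff (shift j p) (j ℕ.+ k) ≈ coeff p k
  coeff-shift zero    p k = refl
  coeff-shift (suc j) p k = coeff-shift j p k

  Below-shift : ∀ j {n p} → Below n p → Below (j ℕ.+ n) (shift j p)
  Below-shift zero    b k       le       = b k le
  Below-shift (suc j) b (suc k) (s≤s le) = Below-shift j b k le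

  shift-* : ∀ j p q → shift j p *ᴾ q ≋ shift j (p *ᴾ q)
  shift-* zero    p q = ≋-refl
  shift-* (suc j) p q = ≋-trans (0∷-* (shift j p) q) (∷-cong refl (shift-* j p q))

  open RingSolver polynomialRing

  -- Coefficients have no inverses, so each reduction step multiplies the dividend by the leading
  -- coefficient ν of `q` instead of dividing by it. The constant `c` collects these factors.
  pseudo-divide : ∀ {e} q → HasDegree e q → ∀ N p → Below N p →
    ∃[ c ] ∃[ s ] ∃[ r ] ((¬ c ≈ 0#) × constant c *ᴾ p ≋ s *ᴾ q +ᴾ r × Below e r)
  pseudo-divide {e} q hq N p b with N ℕ.≤? e
  ... | yes N≤e = 1# , [] , p , 1≉0 , *ᴾ-identityˡ p , Below-mono {p = p} N≤e b
  pseudo-divide {e} q hq zero p b | no 0≰e = ⊥-elim (0≰e z≤n)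
  pseudo-divide {e} q (c , top) (suc N) p b | no N≮e
    with pseudo-divide q (c , top) N p′ below′
    where
    ν = coeff q e
    μ = coeff p N
    e≤N = ℕ.≤-pred (ℕ.≰⇒> N≮e)
    j = N ℕ.∸ e
    j+e≡N : j ℕ.+ e ≡ N
    j+e≡N = ℕ.m∸n+n≡m e≤N
    p′ = scale ν p +ᴾ scale (- μ) (shift j q)
    coeff-p′ : ∀ k → coeff p′ k ≈ ν * coeff p k + - μ * coeff (shift j q) k
    coeff-p′ k = trans (coeff-+ (scale ν p) (scale (- μ) (shift j q)) k) (+-cong (coeff-scale ν p k) (coeff-scale (- μ) (shift j q) k))
    below′ : Below N p′
    below′ k N≤k with ℕ.m≤n⇒m<n∨m≡n N≤k
    ... | inj₁ N<k = Below-+ {_} {scale ν p} {scale (- μ) (shift j q)} (Below-scale ν {p} b)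
            (Below-scale (- μ) {shift j q} (≡.subst (λ m → Below m (shift j q)) (≡.trans (ℕ.+-suc j e) (≡.cong suc j+e≡N)) (Below-shift j {suc e} {q} c))) k N<k
    ... | inj₂ ≡.refl = begin
        coeff p′ N ≈⟨ coeff-p′ N ⟩
        ν * μ + - μ * coeff (shift j q) N ≡⟨ ≡.cong (λ m → ν * μ + - μ * coeff (shift j q) m) (≡.sym j+e≡N) ⟩
        ν * μ + - μ * coeff (shift j q) (j ℕ.+ e) ≈⟨ +-congˡ (*-congˡ (coeff-shift j q e)) ⟩
        ν * μ + - μ * ν ≈⟨ +-cong (*-comm ν μ) (sym (-‿distribˡ-* μ ν)) ⟩
        μ * ν - μ * ν ≈⟨ -‿inverseʳ _ ⟩
        0# ∎
      where open import Relation.Binary.Reasoning.Setoid setoid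
  -- From d (ν p - μ x^j q) = s q + r, the quotient gains the term d μ x^j.
  ... | d , s , r , d≉0 , eq , below = d * ν , s +ᴾ constant (d * μ) *ᴾ x^j , r , *-≉0 d≉0 top , eq′ , below
    where
    ν = coeff q e
    μ = coeff p N
    j = N ℕ.∸ e
    x^j = shift j (constant 1#)
    x^j*q : shift j q ≋ x^j *ᴾ q
    x^j*q = ≋-sym (≋-trans (shift-* j (constant 1#) q) (shift-cong j (*ᴾ-identityˡ q)))
      where
      shift-cong : ∀ j {p q} → p ≋ q → shift j p ≋ shift j q
      shift-cong zero    h = h
      shift-cong (suc j) h = ∷-cong refl (shift-cong j h)
    constant-*-* : ∀ a b → constant (a * b) ≋ constant a *ᴾ constant b
    constant-*-* a b = ∷-cong (sym (+-identityʳ _)) ≋-refl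
    scaled : constant d *ᴾ (scale ν p +ᴾ scale (- μ) (shift j q)) ≋ constant d *ᴾ (constant ν *ᴾ p +ᴾ (-ᴾ constant μ) *ᴾ (x^j *ᴾ q))
    scaled = *ᴾ-congˡ (constant d) (+ᴾ-cong (≋-sym (constant-* ν p))
      (≋-trans (scale-cong refl x^j*q) (≋-sym (constant-* (- μ) (x^j *ᴾ q)))))
    open ≋-R
    eq′ : constant (d * ν) *ᴾ p ≋ (s +ᴾ constant (d * μ) *ᴾ x^j) *ᴾ q +ᴾ r
    eq′ = begin
      constant (d * ν) *ᴾ p
        ≈⟨ *ᴾ-congʳ p (constant-*-* d ν) ⟩
      (constant d *ᴾ constant ν) *ᴾ p
        ≈⟨ solve 6 (λ D V M X p q → (D :* V) :* p := D :* (V :* p :+ (:- M) :* (X :* q)) :+ D :* M :* X :* q)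
             ≋-refl (constant d) (constant ν) (constant μ) x^j p q ⟩
      constant d *ᴾ (constant ν *ᴾ p +ᴾ (-ᴾ constant μ) *ᴾ (x^j *ᴾ q)) +ᴾ constant d *ᴾ constant μ *ᴾ x^j *ᴾ q
        ≈⟨ P.+-cong (≋-trans (≋-sym scaled) eq) (P.*-congʳ {q} (P.*-congʳ {x^j} (≋-sym (constant-*-* d μ)))) ⟩
      (s *ᴾ q +ᴾ r) +ᴾ constant (d * μ) *ᴾ x^j *ᴾ q
        ≈⟨ solve 5 (λ s q r C X → (s :* q :+ r) :+ C :* X :* q := (s :+ C :* X) :* q :+ r)
             ≋-refl s q r (constant (d * μ)) x^j ⟩
      (s +ᴾ constant (d * μ) *ᴾ x^j) *ᴾ q +ᴾ r ∎

  polynomial-domain : ∀ {p q} → ¬ p ≋ [] → ¬ q ≋ [] → ¬ p *ᴾ q ≋ []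
  polynomial-domain {p} {q} p≉0 q≉0 pq≋0 =
    ¬Below-* {0} {0} {p} {q} (λ b → p≉0 (Below-0 {p} b)) (λ b → q≉0 (Below-0 {q} b)) (λ k _ → at pq≋0 k)

  -- Euclid's algorithm, by induction on a bound for the second argument. Instead of a greatest
  -- common divisor it returns the reduced fraction and its Bézout combination, so that no exact
  -- division is performed.
  bezout : ∀ N p q → Below N q → ¬ q ≋ [] → ¬ ¬ (∃[ p′ ] ∃[ q′ ] ∃[ u ] ∃[ v ] ∃[ c ]
    (p *ᴾ q′ ≋ q *ᴾ p′ × (¬ q′ ≋ []) × u *ᴾ p′ +ᴾ v *ᴾ q′ ≋ constant c × ¬ c ≈ 0#))
  bezout zero    p q b q≉0 = ⊥-elim (q≉0 (Below-0 {q} b))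
  bezout (suc N) p q b q≉0 = do
    (e , hq) ← degree q q≉0
    let (d , s , r , d≉0 , eq , r<e) = pseudo-divide q hq (length p) p (Below-length p)
    em (r ≋ []) >>= λ where
      -- Here d p = s q, so p / q = s / d, and the constant `d` is itself the combination.
      (yes r≋0) → return (s , constant d , [] , constant 1# , d ,
        ≋-trans (*ᴾ-comm p (constant d)) (≋-trans eq (≋-trans (+ᴾ-cong (*ᴾ-comm s q) r≋0) (+ᴾ-identityʳ _))) ,
        (λ h → d≉0 (at h 0)) , *ᴾ-identityˡ (constant d) , d≉0)
      -- The recursive call reduces q / r to q₁ / r₁, and d p = s q + r then turns p / q into (s q₁
      -- + r₁) / (d q₁).
      (no r≉0) → bezout N q r (Below-mono {p = r} (e≤N hq) r<e) r≉0 >>= λ (q₁ , r₁ , u , v , c , qr₁≋rq₁ , r₁≉0 , comb , c≉0) →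
        return (s *ᴾ q₁ +ᴾ r₁ , constant d *ᴾ q₁ , constant d *ᴾ v , u +ᴾ (-ᴾ (v *ᴾ s)) , d * c ,
          cross (constant d) s r q₁ r₁ eq qr₁≋rq₁ ,
          polynomial-domain {constant d} {q₁} (λ h → d≉0 (at h 0)) (q₁≉0 {r} {q₁} {r₁} qr₁≋rq₁ r₁≉0) ,
          ≋-trans (combination (constant d) s q₁ r₁ u v) (≋-trans (*ᴾ-congˡ (constant d) comb) (∷-cong (+-identityʳ _) ≋-refl)) ,
          *-≉0 d≉0 c≉0)
    where
    e≤N : ∀ {e} → HasDegree e q → e ℕ.≤ N
    e≤N (_ , top) = ℕ.≮⇒≥ λ N<e → top (b _ N<e)
    q₁≉0 : ∀ {r q₁ r₁} → q *ᴾ r₁ ≋ r *ᴾ q₁ → ¬ r₁ ≋ [] → ¬ q₁ ≋ []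
    q₁≉0 {r} qr₁≋rq₁ r₁≉0 q₁≋0 = polynomial-domain q≉0 r₁≉0 (≋-trans qr₁≋rq₁ (≋-trans (*ᴾ-congˡ r q₁≋0) (*ᴾ-zeroʳ r)))
    open ≋-R
    cross : ∀ D s r q₁ r₁ → D *ᴾ p ≋ s *ᴾ q +ᴾ r → q *ᴾ r₁ ≋ r *ᴾ q₁ → p *ᴾ (D *ᴾ q₁) ≋ q *ᴾ (s *ᴾ q₁ +ᴾ r₁)
    cross D s r q₁ r₁ eq h = begin
      p *ᴾ (D *ᴾ q₁) ≈⟨ solve 3 (λ p D q₁ → p :* (D :* q₁) := (D :* p) :* q₁) ≋-refl p D q₁ ⟩
      (D *ᴾ p) *ᴾ q₁ ≈⟨ *ᴾ-congʳ q₁ eq ⟩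
      (s *ᴾ q +ᴾ r) *ᴾ q₁ ≈⟨ *ᴾ-distribʳ q₁ (s *ᴾ q) r ⟩
      s *ᴾ q *ᴾ q₁ +ᴾ r *ᴾ q₁ ≈⟨ P.+-congˡ {s *ᴾ q *ᴾ q₁} h ⟨
      s *ᴾ q *ᴾ q₁ +ᴾ q *ᴾ r₁ ≈⟨ solve 4 (λ s q q₁ r₁ → s :* q :* q₁ :+ q :* r₁ := q :* (s :* q₁ :+ r₁)) ≋-refl s q q₁ r₁ ⟩
      q *ᴾ (s *ᴾ q₁ +ᴾ r₁) ∎
    combination : ∀ D s q₁ r₁ u v → (D *ᴾ v) *ᴾ (s *ᴾ q₁ +ᴾ r₁) +ᴾ (u +ᴾ (-ᴾ (v *ᴾ s))) *ᴾ (D *ᴾ q₁) ≋ D *ᴾ (u *ᴾ q₁ +ᴾ v *ᴾ r₁)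
    combination = solve 6 (λ D s q₁ r₁ u v → (D :* v) :* (s :* q₁ :+ r₁) :+ (u :+ (:- (v :* s))) :* (D :* q₁) := D :* (u :* q₁ :+ v :* r₁)) ≋-refl

  polynomial-char0 : ∀ n {p} → suc n P′· p ≋ [] → p ≋ []
  polynomial-char0 n {p} h = mk λ k → char0 n _ (trans (sym (coeff-· (suc n) k)) (at h k))
    where
    coeff-· : ∀ n k → coeff (n P′· p) k ≈ n · coeff p k
    coeff-· zero    k = refl
    coeff-· (suc n) k = trans (coeff-+ p (n P′· p) k) (+-congˡ (coeff-· n k))

  differentialDomain : DifferentialDomain
  differentialDomain = record
    { commutativeRing = polynomialRing
    ; stable = ≋-stable
    ; 1≉0 = λ h → 1≉0 (at h 0)
    ; char0 = polynomial-char0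
    ; δ = derivative
    ; δ-cong = derivative-cong
    ; δ-+ = derivative-+
    ; δ-* = derivative-*
    ; Deg< = Below
    ; Deg<-cong = Below-cong
    ; Deg<-mono = λ {_} {_} {p} → Below-mono {p = p}
    ; Deg<-+ = λ {_} {p} {q} → Below-+ {_} {p} {q}
    ; Deg<-neg = λ {_} {p} → Below-neg {_} {p}
    ; Deg<-* = λ {_} {_} {p} {q} b c → proj₂ (top-coeff p {q} b c)
    ; Deg<-δ = λ {_} {p} → Below-derivative {_} {p}
    ; Deg<-1 = Below-length (constant 1#)
    ; Deg<-fin = λ p → length p , Below-length p
    ; Deg<0⇒≈0 = λ {p} → Below-0 {p}
    ; ≈0⇒Deg<0 = λ h k _ → at h k
    ; Deg<1⇒δ≈0 = λ {p} b → mk λ k → trans (coeff-derivative p k) (trans (×-congʳ (suc k) (b (suc k) (s≤s z≤n))) (·-zero (suc k)))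
    ; Deg≥-* = λ {_} {_} {p} {q} → ¬Below-* {_} {_} {p} {q}
    ; ∝⇒multiple = multiple
    ; bezout = λ p q q≉0 → bezout (length q) p q (Below-length q) q≉0 >>= λ (p′ , q′ , u , v , c , eq , q′≉0 , comb , c≉0) →
        return (p′ , q′ , u , v , eq , q′≉0 , Below-cong (≋-sym comb) (Below-length (constant c)) ,
          λ h → c≉0 (at (≋-trans (≋-sym comb) h) 0))
    }
    where
    multiple : ∀ {p q} → p ∝ q → ¬ q ≋ [] → ¬ ¬ (∃[ c ] ∃[ d ]
      (Below 1 c × Below 1 d × (¬ c ≋ []) × c *ᴾ p ≋ d *ᴾ q))
    multiple {p} {q} p∝q q≉0 = do
      (n , hq) ← degree q q≉0
      em (p ≋ []) >>= λ where
        (yes p≋0) → return (constant 1# , [] , Below-length (constant 1#) , (λ _ _ → refl) , (λ h → 1≉0 (at h 0)) ,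
          ≋-trans (*ᴾ-identityˡ p) p≋0)
        (no p≉0) → degree p p≉0 >>= λ (m , hp) →
          return (constant (coeff q n) , constant (coeff p m) , Below-length (constant (coeff q n)) , Below-length (constant (coeff p m)) ,
            (λ h → proj₂ hq (at h 0)) ,
            ≋-trans (constant-* (coeff q n) p) (≋-trans (∝⇒multiple {p} {q} p∝q hp hq) (≋-sym (constant-* (coeff p m) q))))

-- Proportionality, Wronskians and rigid families

module DifferentialDomainProperties (D : DifferentialDomain) where
  open DifferentialDomain D
  open RingSolver commutativeRing
  open import Algebra.Properties.Ring ring using (-‿distribʳ-*; -0#≈0#)
  open import Algebra.Properties.Group +-group using (inverseʳ-unique)
    renaming (x∙y⁻¹≈ε⇒x≈y to x-y≈0⇒x≈y; x≈y⇒x∙y⁻¹≈ε to x≈y⇒x-y≈0)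
  open import Algebra.Properties.Semiring.Exp semiring public using (_^_; ^-congˡ)
  open import Algebra.Properties.CommutativeMonoid.Sum +-commutativeMonoid public using (sum; sum-cong-≋)
  open import Algebra.Properties.CommutativeMonoid.Sum +-commutativeMonoid using (sum-remove; ∑-distrib-+; sum-replicate-zero)
  open import Algebra.Properties.Semiring.Sum semiring using (*-distribˡ-sum)
  open import Algebra.Properties.CommutativeMonoid.Sum *-commutativeMonoid using ()
    renaming (sum to product; sum-remove to product-remove)
  open import Data.Vec.Functional using (insertAt)
  open import Data.Vec.Functional.Properties using (insertAt-lookup; insertAt-punchIn)
  open import Relation.Binary.Reasoning.Setoid setoid

  -- Being nonzero means not having degree below 0, so this is `Deg≥-*` with both bounds 0.
  *-≉0 : ∀ {x y} → ¬ x ≈ 0# → ¬ y ≈ 0# → ¬ x * y ≈ 0#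
  *-≉0 x≉0 y≉0 xy≈0 = Deg≥-* {0} {0} (x≉0 ∘ Deg<0⇒≈0) (y≉0 ∘ Deg<0⇒≈0) (≈0⇒Deg<0 xy≈0)

  *-≈0 : ∀ {x y} → ¬ x ≈ 0# → x * y ≈ 0# → y ≈ 0#
  *-≈0 x≉0 xy≈0 = stable λ y≉0 → *-≉0 x≉0 y≉0 xy≈0

  *-cancelˡ : ∀ {z x y} → ¬ z ≈ 0# → z * x ≈ z * y → x ≈ y
  *-cancelˡ {z} {x} {y} z≉0 h = x-y≈0⇒x≈y x y (*-≈0 z≉0 (begin
    z * (x - y) ≈⟨ solve 3 (λ z x y → z :* (x :- y) := z :* x :- z :* y) refl z x y ⟩
    z * x - z * y ≈⟨ x≈y⇒x-y≈0 h ⟩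
    0# ∎))

  *-≉0ʳ : ∀ {x y} → ¬ x * y ≈ 0# → ¬ y ≈ 0#
  *-≉0ʳ {x} xy≉0 y≈0 = xy≉0 (trans (*-congˡ y≈0) (zeroʳ x))

  *-≉0ˡ : ∀ {x y} → ¬ x * y ≈ 0# → ¬ x ≈ 0#
  *-≉0ˡ {x} {y} xy≉0 x≈0 = xy≉0 (trans (*-congʳ x≈0) (zeroˡ y))

  ^-≉0 : ∀ {x} n → ¬ x ≈ 0# → ¬ x ^ n ≈ 0#
  ^-≉0 zero    x≉0 = 1≉0
  ^-≉0 (suc n) x≉0 = *-≉0 x≉0 (^-≉0 n x≉0)

  product-≉0 : ∀ {n} (x : Fin n → Carrier) → (∀ i → ¬ x i ≈ 0#) → ¬ product x ≈ 0#
  product-≉0 {zero}  x x≉0 = 1≉0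
  product-≉0 {suc n} x x≉0 = *-≉0 (x≉0 zero) (product-≉0 (x ∘ suc) (x≉0 ∘ suc))

  Constant-1 : Constant 1#
  Constant-1 = Deg<-1

  Constant-0 : Constant 0#
  Constant-0 = Deg<-mono z≤n (≈0⇒Deg<0 refl)

  Constant-* : ∀ {c d} → Constant c → Constant d → Constant (c * d)
  Constant-* = Deg<-*

  Constant-^ : ∀ {c} n → Constant c → Constant (c ^ n)
  Constant-^ zero    h = Constant-1
  Constant-^ (suc n) h = Constant-* h (Constant-^ n h)

  δ-neg : ∀ x → δ (- x) ≈ - δ x
  δ-neg x = inverseʳ-unique _ _ (trans (sym (δ-+ x (- x))) (trans (δ-cong (-‿inverseʳ x)) (Deg<1⇒δ≈0 Constant-0)))

  δ-^ : ∀ x n → δ (x ^ suc n) ≈ suc n · (x ^ n * δ x)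
  δ-^ x zero = trans (δ-cong (*-identityʳ x)) (sym (trans (+-identityʳ _) (*-identityˡ _)))
  δ-^ x (suc n) = begin
    δ (x * x ^ suc n) ≈⟨ δ-* x (x ^ suc n) ⟩
    δ x * x ^ suc n + x * δ (x ^ suc n) ≈⟨ +-cong (*-comm _ _) (*-congˡ (δ-^ x n)) ⟩
    x ^ suc n * δ x + x * (suc n · (x ^ n * δ x)) ≈⟨ +-congˡ (×-comm-* (suc n) x _) ⟩
    x ^ suc n * δ x + suc n · (x * (x ^ n * δ x)) ≈⟨ +-congˡ (×-congʳ (suc n) (sym (*-assoc x _ _))) ⟩
    x ^ suc n * δ x + suc n · (x ^ suc n * δ x) ∎
    where open SemiringMult semiring using (×-comm-*; ×-congʳ)

  ∝-refl : ∀ {x} → x ∝ x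
  ∝-refl = *-comm _ _

  ∝-sym : ∀ {x y} → x ∝ y → y ∝ x
  ∝-sym h = trans (*-comm _ _) (trans (sym h) (*-comm _ _))

  ∝-cong : ∀ {x x′ y y′} → x ≈ x′ → y ≈ y′ → x ∝ y → x′ ∝ y′
  ∝-cong p q h = trans (*-cong (δ-cong (sym p)) (sym q)) (trans h (*-cong p (δ-cong q)))

  ∝-reflexive : ∀ {x y} → x ≈ y → x ∝ y
  ∝-reflexive eq = ∝-cong refl eq ∝-refl

  -- Zero is proportional to everything, so the middle element has to be nonzero.
  ∝-trans : ∀ {x y z} → ¬ y ≈ 0# → x ∝ y → y ∝ z → x ∝ z
  ∝-trans {x} {y} {z} y≉0 h g = *-cancelˡ y≉0 (begin
    y * (δ x * z) ≈⟨ solve 3 (λ y x′ z → y :* (x′ :* z) := x′ :* y :* z) refl y (δ x) z ⟩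
    δ x * y * z ≈⟨ *-congʳ h ⟩
    x * δ y * z ≈⟨ *-assoc _ _ _ ⟩
    x * (δ y * z) ≈⟨ *-congˡ g ⟩
    x * (y * δ z) ≈⟨ solve 3 (λ x y z′ → x :* (y :* z′) := y :* (x :* z′)) refl x y (δ z) ⟩
    y * (x * δ z) ∎)

  ∝-* : ∀ {x y z w} → x ∝ y → z ∝ w → x * z ∝ y * w
  ∝-* {x} {y} {z} {w} h g = begin
    δ (x * z) * (y * w) ≈⟨ *-congʳ (δ-* x z) ⟩
    (δ x * z + x * δ z) * (y * w) ≈⟨ solve 6 (λ x′ x y z′ z w → (x′ :* z :+ x :* z′) :* (y :* w) := (x′ :* y) :* (z :* w) :+ (z′ :* w) :* (x :* y)) refl (δ x) x y (δ z) z w ⟩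
    (δ x * y) * (z * w) + (δ z * w) * (x * y) ≈⟨ +-cong (*-congʳ h) (*-congʳ g) ⟩
    (x * δ y) * (z * w) + (z * δ w) * (x * y) ≈⟨ solve 6 (λ x y′ y z w′ w → (x :* y′) :* (z :* w) :+ (z :* w′) :* (x :* y) := (x :* z) :* (y′ :* w :+ y :* w′)) refl x (δ y) y z (δ w) w ⟩
    (x * z) * (δ y * w + y * δ w) ≈⟨ *-congˡ (δ-* y w) ⟨
    (x * z) * δ (y * w) ∎

  ∝-cancelʳ : ∀ {x y z} → ¬ z ≈ 0# → x * z ∝ y * z → x ∝ y
  ∝-cancelʳ {x} {y} {z} z≉0 h = *-cancelˡ (*-≉0 z≉0 z≉0) (begin
    z * z * (δ x * y) ≈⟨ solve 5 (λ x′ x y z′ z → z :* z :* (x′ :* y) := (x′ :* z :+ x :* z′) :* (y :* z) :- x :* z′ :* y :* z) refl (δ x) x y (δ z) z ⟩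
    (δ x * z + x * δ z) * (y * z) - x * δ z * y * z ≈⟨ +-congʳ (trans (*-congʳ (sym (δ-* x z))) (trans h (*-congˡ (δ-* y z)))) ⟩
    x * z * (δ y * z + y * δ z) - x * δ z * y * z ≈⟨ solve 5 (λ x y′ y z′ z → x :* z :* (y′ :* z :+ y :* z′) :- x :* z′ :* y :* z := z :* z :* (x :* y′)) refl x (δ y) y (δ z) z ⟩
    z * z * (x * δ y) ∎)

  -- The Wronskian of the two powers is (n + 1) xⁿ yⁿ times that of `x` and `y`, and it vanishes
  -- because the powers agree.
  ∝-root : ∀ {x y} n → ¬ x ≈ 0# → ¬ y ≈ 0# → x ^ suc n ≈ y ^ suc n → x ∝ y
  ∝-root {x} {y} n x≉0 y≉0 h = x-y≈0⇒x≈y _ _ (*-≈0 (*-≉0 (^-≉0 n x≉0) (^-≉0 n y≉0)) (char0 n (begin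
    suc n · (x ^ n * y ^ n * (δ x * y - x * δ y))
      ≈⟨ ×-congʳ (suc n) (solve 6 (λ X Y x′ y x y′ → X :* Y :* (x′ :* y :- x :* y′) := X :* x′ :* (y :* Y) :+ (:- (x :* X :* (Y :* y′)))) refl (x ^ n) (y ^ n) (δ x) y x (δ y)) ⟩
    suc n · (x ^ n * δ x * y ^ suc n + - (x ^ suc n * (y ^ n * δ y)))
      ≈⟨ ×-distrib-+ _ _ (suc n) ⟩
    suc n · (x ^ n * δ x * y ^ suc n) + suc n · (- (x ^ suc n * (y ^ n * δ y)))
      ≈⟨ +-cong (sym (×-assoc-* (suc n) _ _)) (trans (×-congʳ (suc n) (-‿distribʳ-* _ _)) (trans (sym (×-comm-* (suc n) _ _)) (*-congˡ (neg-· (suc n) _)))) ⟩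
    (suc n · (x ^ n * δ x)) * y ^ suc n + x ^ suc n * - (suc n · (y ^ n * δ y))
      ≈⟨ +-cong (*-congʳ (sym (δ-^ x n))) (*-congˡ (-‿cong (sym (δ-^ y n)))) ⟩
    δ (x ^ suc n) * y ^ suc n + x ^ suc n * - δ (y ^ suc n)
      ≈⟨ +-cong (trans (*-congʳ (δ-cong h)) (*-comm _ _)) (*-congʳ h) ⟩
    y ^ suc n * δ (y ^ suc n) + y ^ suc n * - δ (y ^ suc n)
      ≈⟨ solve 2 (λ y y′ → y :* y′ :+ y :* (:- y′) := con (0 , 0)) refl _ _ ⟩
    0# - 0#
      ≈⟨ -‿inverseʳ 0# ⟩
    0# ∎)))
    where
    open SemiringMult semiring using (×-comm-*; ×-congʳ; ×-assoc-*)
    open import Algebra.Properties.CommutativeMonoid.Mult +-commutativeMonoid using (×-distrib-+)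
    neg-· : ∀ n x → n · (- x) ≈ - (n · x)
    neg-· zero    x = sym -0#≈0#
    neg-· (suc n) x = trans (+-congˡ (neg-· n x)) (⁻¹-∙-comm _ _)
      where open import Algebra.Properties.AbelianGroup +-abelianGroup using (⁻¹-∙-comm)

  wronskian : Carrier → Carrier → Carrier
  wronskian x y = δ x * y - x * δ y

  wronskian-cong : ∀ {x x′ y} → x ≈ x′ → wronskian x y ≈ wronskian x′ y
  wronskian-cong h = +-cong (*-congʳ (δ-cong h)) (-‿cong (*-congʳ h))

  wronskian≈0⇒∝ : ∀ {x y} → wronskian x y ≈ 0# → x ∝ y
  wronskian≈0⇒∝ = x-y≈0⇒x≈y _ _

  wronskian-*ˡ : ∀ {c} x y → Constant c → wronskian (c * x) y ≈ c * wronskian x y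
  wronskian-*ˡ {c} x y hc = begin
    δ (c * x) * y - c * x * δ y ≈⟨ +-congʳ (*-congʳ (trans (δ-* c x) (trans (+-congʳ (trans (*-congʳ (Deg<1⇒δ≈0 hc)) (zeroˡ x))) (+-identityˡ _)))) ⟩
    c * δ x * y - c * x * δ y ≈⟨ solve 5 (λ c x′ y x y′ → c :* x′ :* y :- c :* x :* y′ := c :* (x′ :* y :- x :* y′)) refl c (δ x) y x (δ y) ⟩
    c * wronskian x y ∎

  wronskian-sum : ∀ {n} (x : Fin n → Carrier) y → wronskian (sum x) y ≈ sum (λ i → wronskian (x i) y)
  wronskian-sum {zero}  x y = begin
    δ 0# * y - 0# * δ y ≈⟨ +-cong (*-congʳ (Deg<1⇒δ≈0 Constant-0)) refl ⟩
    0# * y - 0# * δ y ≈⟨ +-cong (zeroˡ y) (-‿cong (zeroˡ _)) ⟩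
    0# - 0# ≈⟨ -‿inverseʳ 0# ⟩
    0# ∎
  wronskian-sum {suc n} x y = begin
    δ (x zero + sum (x ∘ suc)) * y - (x zero + sum (x ∘ suc)) * δ y
      ≈⟨ +-congʳ (*-congʳ (δ-+ _ _)) ⟩
    (δ (x zero) + δ (sum (x ∘ suc))) * y - (x zero + sum (x ∘ suc)) * δ y
      ≈⟨ solve 6 (λ a′ b′ y a b y′ → (a′ :+ b′) :* y :- (a :+ b) :* y′ := (a′ :* y :- a :* y′) :+ (b′ :* y :- b :* y′)) refl (δ (x zero)) (δ (sum (x ∘ suc))) y (x zero) (sum (x ∘ suc)) (δ y) ⟩
    wronskian (x zero) y + wronskian (sum (x ∘ suc)) y
      ≈⟨ +-congˡ (wronskian-sum (x ∘ suc) y) ⟩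
    wronskian (x zero) y + sum (λ i → wronskian (x (suc i)) y) ∎

  sum-insertAt : ∀ {n} (c : Fin n → Carrier) (e : Fin (suc n)) a (u : Fin (suc n) → Carrier) →
    sum (λ i → insertAt c e a i * u i) ≈ a * u e + sum (λ j → c j * u (Fin.punchIn e j))
  sum-insertAt c e a u = trans (sum-remove {i = e} (λ i → insertAt c e a i * u i))
    (+-cong (*-congʳ (reflexive (insertAt-lookup c e a))) (sum-cong-≋ λ j → *-congʳ (reflexive (insertAt-punchIn c e a j))))

  insertAt-all : ∀ {p n} (P : Carrier → Set p) (c : Fin n → Carrier) (e : Fin (suc n)) a →
    P a → (∀ j → P (c j)) → ∀ i → P (insertAt c e a i)
  insertAt-all P c e a pa pc i with e Fin.≟ i
  ... | yes ≡.refl = ≡.subst P (≡.sym (insertAt-lookup c e a)) pa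
  ... | no e≢i = ≡.subst (λ i → P (insertAt c e a i)) (Fin.punchIn-punchOut e≢i)
      (≡.subst P (≡.sym (insertAt-punchIn c e a (Fin.punchOut e≢i))) (pc _))

  -- Over the constants, every proper subfamily is linearly independent. If the family has sum zero,
  -- it is a circuit: any relation has all its coefficients equal.
  Rigid : ∀ {n} → (Fin n → Carrier) → Set
  Rigid {n} u = ∀ (c : Fin n → Carrier) → (∀ i → Constant (c i)) → sum (λ i → c i * u i) ≈ 0# →
    ∀ i → c i ≈ 0# → ∀ j → c j ≈ 0#

  sum-zero : ∀ {n} (x : Fin n → Carrier) → (∀ i → x i ≈ 0#) → sum x ≈ 0#
  sum-zero {n} x h = trans (sum-cong-≋ h) (sum-replicate-zero n)

  -- A vanishing member would give a relation whose only nonzero coefficient is 1. With at least two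
  -- members, some coefficient of this relation is zero, so rigidity applies.
  Rigid⇒≉0 : ∀ {n} {u : Fin (suc (suc n)) → Carrier} → Rigid u → ∀ i → ¬ u i ≈ 0#
  Rigid⇒≉0 {n} {u} rigid i ui≈0 = 1≉0 (trans (reflexive (≡.sym (insertAt-lookup zeros i 1#)))
    (rigid (insertAt zeros i 1#) (insertAt-all Constant zeros i 1# Constant-1 λ _ → Constant-0)
      (trans (sum-insertAt zeros i 1# u) (trans (+-cong (trans (*-congˡ ui≈0) (zeroʳ _)) (sum-zero (λ j → 0# * u (Fin.punchIn i j)) λ j → zeroˡ (u (Fin.punchIn i j)))) (+-identityˡ _)))
      (Fin.punchIn i zero) (reflexive (insertAt-punchIn zeros i 1# zero)) i))
    where
    zeros : Fin (suc n) → Carrier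
    zeros _ = 0#

  Rigid-scale : ∀ {n} {u w : Fin n → Carrier} {g h} → ¬ h ≈ 0# →
    (∀ i → g * u i ≈ h * w i) → Rigid u → (¬ g ≈ 0#) → Rigid w
  Rigid-scale {_} {u} {w} {g} {h} h≉0 eq rigid g≉0 c hc rel = rigid c hc (*-≈0 g≉0 (begin
    g * sum (λ i → c i * u i) ≈⟨ *-distribˡ-sum g (λ i → c i * u i) ⟩
    sum (λ i → g * (c i * u i)) ≈⟨ sum-cong-≋ (λ i → trans (swap g (c i) (u i)) (trans (*-congˡ (eq i)) (swap (c i) h (w i)))) ⟩
    sum (λ i → h * (c i * w i)) ≈⟨ *-distribˡ-sum h (λ i → c i * w i) ⟨
    h * sum (λ i → c i * w i) ≈⟨ *-congˡ rel ⟩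
    h * 0# ≈⟨ zeroʳ h ⟩
    0# ∎))
    where
    swap : ∀ x y z → x * (y * z) ≈ y * (x * z)
    swap = solve 3 (λ x y z → x :* (y :* z) := y :* (x :* z)) refl

  sum-scale : ∀ {n} {u w : Fin n → Carrier} {g h} → ¬ h ≈ 0# →
    (∀ i → g * u i ≈ h * w i) → sum u ≈ 0# → sum w ≈ 0#
  sum-scale {_} {u} {w} {g} {h} h≉0 eq Σu≈0 = *-≈0 h≉0 (begin
    h * sum w ≈⟨ *-distribˡ-sum h w ⟩
    sum (λ i → h * w i) ≈⟨ sum-cong-≋ eq ⟨
    sum (λ i → g * u i) ≈⟨ *-distribˡ-sum g u ⟨
    g * sum u ≈⟨ *-congˡ Σu≈0 ⟩
    g * 0# ≈⟨ zeroʳ g ⟩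
    0# ∎)

  module _ {n} (u : Fin (suc (suc (suc n))) → Carrier) (rigid : Rigid u) (e : Fin (suc (suc (suc n)))) where
    -- The Wronskian with `u e` is linear over the constants and kills `u e`.
    eliminate : Fin (suc (suc n)) → Carrier
    eliminate j = wronskian (u (Fin.punchIn e j)) (u e)

    sum-eliminate : sum u ≈ 0# → sum eliminate ≈ 0#
    sum-eliminate Σu≈0 = begin
      sum eliminate ≈⟨ wronskian-sum (u ∘ Fin.punchIn e) (u e) ⟨
      wronskian (sum (u ∘ Fin.punchIn e)) (u e) ≈⟨ wronskian-cong (inverseʳ-unique (u e) _ (trans (sym (sum-remove {i = e} u)) Σu≈0)) ⟩
      wronskian (- u e) (u e) ≈⟨ +-congʳ (*-congʳ (δ-neg (u e))) ⟩
      - δ (u e) * u e - - u e * δ (u e) ≈⟨ solve 2 (λ u u′ → (:- u′) :* u :- (:- u) :* u′ := con (0 , 0)) refl (u e) (δ (u e)) ⟩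
      0# - 0# ≈⟨ -‿inverseʳ 0# ⟩
      0# ∎

    -- A relation among the Wronskians is a vanishing Wronskian of `combination` and `u e`, so a ·
    -- combination = d · u e for constants with a nonzero. This is a relation of the original
    -- family, with coefficient -d at `e`, and it inherits the zero coefficient.
    Rigid-eliminate : Rigid eliminate
    Rigid-eliminate c hc rel i ci≈0 j = stable do
      (a , d , ha , hd , a≉0 , eq) ← ∝⇒multiple combination∝ (Rigid⇒≉0 {u = u} rigid e)
      let coef = λ j → a * c j
          sumₑ : sum (λ i → insertAt coef e (- d) i * u i) ≈ 0#
          sumₑ = begin
            sum (λ i → insertAt coef e (- d) i * u i) ≈⟨ sum-insertAt coef e (- d) u ⟩
            - d * u e + sum (λ j → a * c j * u (Fin.punchIn e j)) ≈⟨ +-congˡ (sum-cong-≋ λ j → *-assoc a (c j) (u (Fin.punchIn e j))) ⟩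
            - d * u e + sum (λ j → a * (c j * u (Fin.punchIn e j))) ≈⟨ +-congˡ (*-distribˡ-sum a (λ j → c j * u (Fin.punchIn e j))) ⟨
            - d * u e + a * combination ≈⟨ +-congˡ eq ⟩
            - d * u e + d * u e ≈⟨ solve 2 (λ d u → (:- d) :* u :+ d :* u := con (0 , 0)) refl d (u e) ⟩
            0# - 0# ≈⟨ -‿inverseʳ 0# ⟩
            0# ∎
      return (*-≈0 a≉0 (trans (reflexive (≡.sym (insertAt-punchIn coef e (- d) j)))
        (rigid (insertAt coef e (- d)) (insertAt-all Constant coef e (- d) (Deg<-neg hd) λ j → Constant-* ha (hc j))
          sumₑ (Fin.punchIn e i) (trans (reflexive (insertAt-punchIn coef e (- d) i)) (trans (*-congˡ ci≈0) (zeroʳ a)))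
          (Fin.punchIn e j))))
      where
      combination = sum (λ j → c j * u (Fin.punchIn e j))
      combination∝ : combination ∝ u e
      combination∝ = wronskian≈0⇒∝ (trans (wronskian-sum (λ j → c j * u (Fin.punchIn e j)) (u e)) (trans (sum-cong-≋ λ j → wronskian-*ˡ (u (Fin.punchIn e j)) (u e) (hc j)) rel))

-- Linear independence of nonproportional k-th powers

module LinearIndependence (D : DifferentialDomain) where
  open DifferentialDomain D
  open DifferentialDomainProperties D
  open RingSolver commutativeRing
  open import Algebra.Properties.Ring ring using (-‿distribˡ-*)
  open import Algebra.Properties.Group +-group using (inverseˡ-unique)
  open import Algebra.Properties.CommutativeSemiring.Exp commutativeSemiring using (^-distrib-*)
  open import Algebra.Properties.CommutativeMonoid.Sum +-commutativeMonoid using (sum-remove; ∑-distrib-+)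
  open import Algebra.Properties.Semiring.Sum semiring using (*-distribˡ-sum)
  open import Algebra.Properties.CommutativeMonoid.Sum *-commutativeMonoid using ()
    renaming (sum to product; sum-remove to product-remove)
  open import Relation.Binary.Reasoning.Setoid setoid

  -- Degree bound, in units of h, for the cofactors after m eliminations. A new cofactor multiplies
  -- two elements of degree at most (a + 1) h, so one elimination takes a to 2 (a + 1).
  degreeFactor : ℕ → ℕ → ℕ
  degreeFactor zero    a = a
  degreeFactor (suc m) a = degreeFactor m (suc a ℕ.+ suc a)

  -- Differentiation costs only one factor `x`; the power x ^ n survives in front.
  δ-*-^ : ∀ b x n → δ (b * x ^ suc n) ≈ x ^ n * (δ b * x + suc n · (b * δ x))
  δ-*-^ b x n = begin
    δ (b * x ^ suc n) ≈⟨ δ-* b (x ^ suc n) ⟩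
    δ b * (x * x ^ n) + b * δ (x ^ suc n) ≈⟨ +-congˡ (*-congˡ (δ-^ x n)) ⟩
    δ b * (x * x ^ n) + b * (suc n · (x ^ n * δ x)) ≈⟨ +-congˡ (×-comm-* (suc n) b _) ⟩
    δ b * (x * x ^ n) + suc n · (b * (x ^ n * δ x)) ≈⟨ +-cong (solve 3 (λ b x X → b :* (x :* X) := X :* (b :* x)) refl (δ b) x (x ^ n)) (×-congʳ (suc n) (solve 3 (λ b x X → b :* (X :* x) := X :* (b :* x)) refl b (δ x) (x ^ n))) ⟩
    x ^ n * (δ b * x) + suc n · (x ^ n * (b * δ x)) ≈⟨ +-congˡ (×-comm-* (suc n) (x ^ n) _) ⟨
    x ^ n * (δ b * x) + x ^ n * (suc n · (b * δ x)) ≈⟨ distribˡ _ _ _ ⟨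
    x ^ n * (δ b * x + suc n · (b * δ x)) ∎
    where open SemiringMult semiring using (×-comm-*; ×-congʳ)

  Deg<-· : ∀ {d x} n → Deg< (suc d) x → Deg< (suc d) (n · x)
  Deg<-· zero    h = Deg<-mono z≤n (≈0⇒Deg<0 refl)
  Deg<-· (suc n) h = Deg<-+ h (Deg<-· n h)

  avoid₂ : ∀ {n} (p q : Fin (suc (suc (suc n)))) → ∃[ e ] (e ≢ p × e ≢ q)
  avoid₂ (suc _)       (suc _)       = zero , (λ ()) , (λ ())
  avoid₂ zero          zero          = suc zero , (λ ()) , (λ ())
  avoid₂ zero          (suc zero)    = suc (suc zero) , (λ ()) , (λ ())
  avoid₂ zero          (suc (suc _)) = suc zero , (λ ()) , (λ ())
  avoid₂ (suc zero)    zero          = suc (suc zero) , (λ ()) , (λ ())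
  avoid₂ (suc (suc _)) zero          = suc zero , (λ ()) , (λ ())

  -- Each elimination replaces B H ^ (n + 1) by B′ H ^ n with a cofactor B′ of larger but controlled degree.
  eliminate-all-but-two : ∀ m K a h (B H : Fin (suc (suc m)) → Carrier) →
    (∀ i → Deg< (suc (a ℕ.* h)) (B i)) → (∀ i → Deg< (suc h) (H i)) →
    Rigid (λ i → B i * H i ^ (m ℕ.+ K)) → sum (λ i → B i * H i ^ (m ℕ.+ K)) ≈ 0# →
    ∀ p q → p ≢ q → ∃[ x ] ∃[ y ] ((¬ x ≈ 0#) × (¬ y ≈ 0#) ×
      Deg< (suc (degreeFactor m a ℕ.* h)) x × Deg< (suc (degreeFactor m a ℕ.* h)) y × x * H p ^ K ≈ y * H q ^ K)
  eliminate-all-but-two zero K a h B H degB degH rigid Σ≈0 p q p≢q =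
    B p , - B q , *-≉0ˡ (u≉0 p) , (λ h → *-≉0ˡ (u≉0 q) (trans (sym (-‿involutive _)) (trans (-‿cong h) -0#≈0#))) ,
    degB p , Deg<-neg (degB q) ,
    trans (inverseˡ-unique _ _ two) (-‿distribˡ-* _ _)
    where
    open import Algebra.Properties.Ring ring using (-0#≈0#; -‿involutive)
    u : Fin 2 → Carrier
    u i = B i * H i ^ K
    u≉0 : ∀ i → ¬ u i ≈ 0#
    u≉0 = Rigid⇒≉0 {u = u} rigid
    q-is : Fin.punchIn p zero ≡ q
    q-is = ≡.trans (≡.cong (Fin.punchIn p) (only (Fin.punchOut p≢q))) (Fin.punchIn-punchOut p≢q)
      where
      only : (i : Fin 1) → zero ≡ i
      only zero = ≡.refl
    two : u p + u q ≈ 0#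
    two = begin
      u p + u q ≈⟨ +-congˡ (reflexive (≡.cong u (≡.sym q-is))) ⟩
      u p + u (Fin.punchIn p zero) ≈⟨ +-congˡ (+-identityʳ _) ⟨
      u p + (u (Fin.punchIn p zero) + 0#) ≈⟨ sum-remove {i = p} u ⟨
      sum u ≈⟨ Σ≈0 ⟩
      0# ∎
  eliminate-all-but-two (suc m) K a h B H degB degH rigid Σ≈0 p q p≢q =
    let x , y , x≉0 , y≉0 , dx , dy , eq = eliminate-all-but-two m K (suc a ℕ.+ suc a) h B′ (H ∘ Fin.punchIn e) degB′ (degH ∘ Fin.punchIn e)
          (Rigid-scale (^-≉0 N He≉0) factor (Rigid-eliminate u rigid e) 1≉0)
          (sum-scale (^-≉0 N He≉0) factor (sum-eliminate u rigid e Σ≈0))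
          (Fin.punchOut e≢p) (Fin.punchOut e≢q) (λ eq → p≢q (≡.trans (≡.sym (Fin.punchIn-punchOut e≢p)) (≡.trans (≡.cong (Fin.punchIn e) eq) (Fin.punchIn-punchOut e≢q))))
    in x , y , x≉0 , y≉0 , dx , dy ,
      ≡.subst₂ (λ i j → x * H i ^ K ≈ y * H j ^ K) (Fin.punchIn-punchOut e≢p) (Fin.punchIn-punchOut e≢q) eq
    where
    N = m ℕ.+ K
    u : Fin (suc (suc (suc m))) → Carrier
    u i = B i * H i ^ suc N
    e = proj₁ (avoid₂ p q)
    e≢p = proj₁ (proj₂ (avoid₂ p q))
    e≢q = proj₂ (proj₂ (avoid₂ p q))
    He≉0 : ¬ H e ≈ 0#
    He≉0 = *-≉0ˡ (*-≉0ʳ (Rigid⇒≉0 {u = u} rigid e))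
    ∂ : Fin (suc (suc (suc m))) → Carrier
    ∂ i = δ (B i) * H i + suc N · (B i * δ (H i))
    B′ : Fin (suc (suc m)) → Carrier
    B′ j = let i = Fin.punchIn e j in ∂ i * (B e * H e) - (B i * H i) * ∂ e
    factor : ∀ j → 1# * eliminate u rigid e j ≈ H e ^ N * (B′ j * H (Fin.punchIn e j) ^ N)
    factor j = let i = Fin.punchIn e j in begin
      1# * (δ (u i) * u e - u i * δ (u e))
        ≈⟨ *-identityˡ _ ⟩
      δ (u i) * u e - u i * δ (u e)
        ≈⟨ +-cong (*-congʳ (δ-*-^ (B i) (H i) N)) (-‿cong (*-congˡ (δ-*-^ (B e) (H e) N))) ⟩
      (H i ^ N * ∂ i) * (B e * (H e * H e ^ N)) - (B i * (H i * H i ^ N)) * (H e ^ N * ∂ e)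
        ≈⟨ solve 8 (λ X D b h Y b′ h′ D′ → (X :* D) :* (b :* (h :* Y)) :- (b′ :* (h′ :* X)) :* (Y :* D′) := Y :* ((D :* (b :* h) :- (b′ :* h′) :* D′) :* X))
             refl (H i ^ N) (∂ i) (B e) (H e) (H e ^ N) (B i) (H i) (∂ e) ⟩
      H e ^ N * (B′ j * H i ^ N) ∎
    deg : ∀ {x y} → Deg< (suc (a ℕ.* h)) x → Deg< (suc h) y → Deg< (suc (suc a ℕ.* h)) (x * y)
    deg {x} {y} hx hy = ≡.subst (λ d → Deg< (suc d) (x * y)) (ℕ.+-comm (a ℕ.* h) h) (Deg<-* hx hy)
    deg∂ : ∀ i → Deg< (suc (suc a ℕ.* h)) (∂ i)
    deg∂ i = Deg<-+ (deg (Deg<-δ (degB i)) (degH i)) (Deg<-· (suc N) (deg (degB i) (Deg<-δ (degH i))))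
    degBH : ∀ i → Deg< (suc (suc a ℕ.* h)) (B i * H i)
    degBH i = deg (degB i) (degH i)
    degB′ : ∀ j → Deg< (suc ((suc a ℕ.+ suc a) ℕ.* h)) (B′ j)
    degB′ j = ≡.subst (λ d → Deg< (suc d) (B′ j)) (≡.sym (ℕ.*-distribʳ-+ h (suc a) (suc a)))
      (Deg<-+ (Deg<-* (deg∂ _) (degBH e)) (Deg<-neg (Deg<-* (degBH _) (deg∂ e))))

  -- When the power is expanded, all terms except the last contain α.
  comaximal-^ : ∀ {α β u v} L → ∃[ u′ ] ∃[ v′ ] (u′ * α + v′ * β ^ L ≈ (u * α + v * β) ^ L)
  comaximal-^ {α} {β} zero = 0# , 1# , trans (+-cong (zeroˡ α) (*-identityˡ 1#)) (+-identityˡ 1#)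
  comaximal-^ {α} {β} {u} {v} (suc L) = let u′ , v′ , eq = comaximal-^ {α} {β} {u} {v} L in
    u * (u′ * α + v′ * β ^ L) + v * β * u′ , v * v′ , (begin
      (u * (u′ * α + v′ * β ^ L) + v * β * u′) * α + v * v′ * (β * β ^ L)
        ≈⟨ solve 7 (λ α β u v u′ v′ B → (u :* (u′ :* α :+ v′ :* B) :+ v :* β :* u′) :* α :+ v :* v′ :* (β :* B)
             := (u :* α :+ v :* β) :* (u′ :* α :+ v′ :* B)) refl α β u v u′ v′ (β ^ L) ⟩
      (u * α + v * β) * (u′ * α + v′ * β ^ L)
        ≈⟨ *-congˡ eq ⟩
      (u * α + v * β) ^ suc L ∎)

  -- Comaximality moves one factor α at a time from β y to y. Each move costs a factor u α + v β,
  -- which is a constant in the application.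
  coprime-divides : ∀ {α β u v} → ¬ α ≈ 0# → ∀ K {x y} → α ^ K * x ≈ β * y → ∃[ e ] ((u * α + v * β) ^ K * y ≈ α ^ K * e)
  coprime-divides α≉0 zero {x} {y} h = y , refl
  coprime-divides {α} {β} {u} {v} α≉0 (suc K) {x} {y} h = u * e + v * (c ^ K * x) , (begin
      c * c ^ K * y ≈⟨ *-assoc c _ y ⟩
      c * (c ^ K * y) ≈⟨ *-congˡ eq ⟩
      c * (α ^ K * e) ≈⟨ solve 6 (λ u α v β A e → (u :* α :+ v :* β) :* (A :* e) := A :* (u :* α :* e :+ v :* (β :* e))) refl u α v β (α ^ K) e ⟩
      α ^ K * (u * α * e + v * (β * e)) ≈⟨ *-congˡ (+-congˡ (*-congˡ βe)) ⟩
      α ^ K * (u * α * e + v * (c ^ K * (α * x))) ≈⟨ solve 7 (λ u α v C x A e → A :* (u :* α :* e :+ v :* (C :* (α :* x))) := α :* A :* (u :* e :+ v :* (C :* x))) refl u α v (c ^ K) x (α ^ K) e ⟩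
      α * α ^ K * (u * e + v * (c ^ K * x)) ∎)
    where
    c = u * α + v * β
    ih = coprime-divides {α} {β} {u} {v} α≉0 K {α * x} {y} (trans (solve 3 (λ A α x → A :* (α :* x) := α :* A :* x) refl (α ^ K) α x) h)
    e = proj₁ ih
    eq = proj₂ ih
    βe : β * e ≈ c ^ K * (α * x)
    βe = *-cancelˡ (^-≉0 K α≉0) (begin
      α ^ K * (β * e) ≈⟨ solve 3 (λ A β e → A :* (β :* e) := β :* (A :* e)) refl (α ^ K) β e ⟩
      β * (α ^ K * e) ≈⟨ *-congˡ eq ⟨
      β * (c ^ K * y) ≈⟨ solve 3 (λ C β y → β :* (C :* y) := C :* (β :* y)) refl (c ^ K) β y ⟩
      c ^ K * (β * y) ≈⟨ *-congˡ h ⟨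
      c ^ K * (α * α ^ K * x) ≈⟨ solve 4 (λ C α A x → C :* (α :* A :* x) := A :* (C :* (α :* x))) refl (c ^ K) α (α ^ K) x ⟩
      α ^ K * (c ^ K * (α * x)) ∎)

  Coprime : Carrier → Carrier → Set
  Coprime α β = ∃[ u ] ∃[ v ] (Constant (u * α + v * β) × ¬ u * α + v * β ≈ 0#)

  Coprime-sym : ∀ {α β} → Coprime α β → Coprime β α
  Coprime-sym (u , v , const , ≉0) = v , u , Deg<-cong (+-comm _ _) const , λ h → ≉0 (trans (+-comm _ _) h)

  ¬Deg<-^ : ∀ {d x} K → ¬ Deg< d x → ¬ Deg< (K ℕ.* d) (x ^ K)
  ¬Deg<-^ zero    h b = 1≉0 (Deg<0⇒≈0 b)
  ¬Deg<-^ (suc K) h   = Deg≥-* h (¬Deg<-^ K h)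

  -- Up to a nonzero constant, α ^ K divides y. Hence K times the degree of α is at most E, which is
  -- less than K d.
  coprime-degree : ∀ {α β x y d E} K → Coprime α β → ¬ α ≈ 0# → α ^ K * x ≈ β ^ K * y →
    ¬ y ≈ 0# → Deg< (suc E) y → E ℕ.< K ℕ.* d → ¬ ¬ Deg< d α
  coprime-degree {α} {β} {x} {y} {d} {E} K (u , v , const , c≉0) α≉0 eq y≉0 degy E<Kd ¬deg =
    Deg≥-* (¬Deg<-^ K ¬deg) e≉0 (Deg<-mono (ℕ.≤-trans E<Kd (ℕ.≤-reflexive (≡.sym (ℕ.+-identityʳ _))))
      (Deg<-cong divides (Deg<-* (Constant-^ K const′) degy)))
    where
    c = u * α + v * β
    u′ = proj₁ (comaximal-^ {α} {β} {u} {v} K)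
    v′ = proj₁ (proj₂ (comaximal-^ {α} {β} {u} {v} K))
    c′ = u′ * α + v′ * β ^ K
    c′≈ : c′ ≈ c ^ K
    c′≈ = proj₂ (proj₂ (comaximal-^ {α} {β} {u} {v} K))
    const′ : Constant c′
    const′ = Deg<-cong (sym c′≈) (Constant-^ K const)
    e = proj₁ (coprime-divides {α} {β ^ K} {u′} {v′} α≉0 K eq)
    divides : c′ ^ K * y ≈ α ^ K * e
    divides = proj₂ (coprime-divides {α} {β ^ K} {u′} {v′} α≉0 K eq)
    e≉0 : ¬ Deg< 0 e
    e≉0 h = *-≉0 (^-≉0 K (λ c′≈0 → ^-≉0 K c≉0 (trans (sym c′≈) c′≈0))) y≉0
      (trans divides (trans (*-congˡ (Deg<0⇒≈0 h)) (zeroʳ _)))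

  Deg<-product : ∀ {n d} (x : Fin n → Carrier) → (∀ i → Deg< (suc d) (x i)) → Deg< (suc (n ℕ.* d)) (product x)
  Deg<-product {zero}  x h = Constant-1
  Deg<-product {suc n} x h = Deg<-* (h zero) (Deg<-product (x ∘ suc) (h ∘ suc))

  Deg<-fin-∀ : ∀ {n} (x : Fin n → Carrier) → ∃[ d ] (∀ i → Deg< d (x i))
  Deg<-fin-∀ {zero}  x = 0 , λ ()
  Deg<-fin-∀ {suc n} x = let d , h = Deg<-fin (x zero) ; e , g = Deg<-fin-∀ (x ∘ suc) in
    d ℕ.⊔ e , λ { zero → Deg<-mono (ℕ.m≤m⊔n d e) h ; (suc i) → Deg<-mono (ℕ.m≤n⊔m d e) (g i) }

  ^-swap : ∀ {x y z w} k → x * y ≈ z * w → x ^ k * y ^ k ≈ z ^ k * w ^ k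
  ^-swap {x} {y} {z} {w} k h = trans (sym (^-distrib-* x y k)) (trans (^-congˡ k h) (^-distrib-* z w k))

  Constant-∝ : ∀ {c d} → Constant c → Constant d → c ∝ d
  Constant-∝ {c} {d} hc hd = trans (trans (*-congʳ (Deg<1⇒δ≈0 hc)) (zeroˡ d)) (sym (trans (*-congˡ (Deg<1⇒δ≈0 hd)) (zeroʳ c)))

  -- With D bounding the heights of all ratios t i / t 0, eliminating all terms but two
  -- shows that a ratio has height at most (degreeFactor m 0 · (m + 1) / K) · D < D.
  module _ {m K}
    (K-large : degreeFactor m 0 ℕ.* suc m ℕ.< K)
    (t : Fin (suc (suc m)) → Carrier) (t≉0 : ∀ i → ¬ t i ≈ 0#)
    (a b : Fin (suc m) → Carrier) (a≉0 : ∀ i → ¬ a i ≈ 0#) (b≉0 : ∀ i → ¬ b i ≈ 0#)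
    (coprime : ∀ i → Coprime (a i) (b i))
    (ratio : ∀ i → a i ^ (m ℕ.+ K) * t (suc i) ≈ b i ^ (m ℕ.+ K) * t zero)
    (c : Fin (suc (suc m)) → Carrier) (c-const : ∀ i → Constant (c i))
    (rigid : Rigid (λ i → c i * t i)) (Σ≈0 : sum (λ i → c i * t i) ≈ 0#)
    where

    private
      k = m ℕ.+ K

      P = product a

      P≉0 : ¬ P ≈ 0#
      P≉0 = product-≉0 a a≉0

      -- Numerators over the common denominator `P`: the ratio t i / t 0 is the k-th power of H i /
      -- P.
      H : Fin (suc (suc m)) → Carrier
      H zero    = P
      H (suc i) = b i * product (removeAt a i)

      a*H : ∀ i → a i * H (suc i) ≈ b i * P
      a*H i = trans (solve 3 (λ a b p → a :* (b :* p) := b :* (a :* p)) refl (a i) (b i) _) (*-congˡ (sym (product-remove {i = i} a)))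

      H^k : ∀ i → P ^ k * t i ≈ t zero * H i ^ k
      H^k zero    = *-comm _ _
      H^k (suc i) = *-cancelˡ (^-≉0 k (a≉0 i)) (begin
        a i ^ k * (P ^ k * t (suc i)) ≈⟨ solve 3 (λ A P t → A :* (P :* t) := P :* (A :* t)) refl _ _ _ ⟩
        P ^ k * (a i ^ k * t (suc i)) ≈⟨ *-congˡ (ratio i) ⟩
        P ^ k * (b i ^ k * t zero) ≈⟨ solve 3 (λ P B t → P :* (B :* t) := t :* (B :* P)) refl _ _ _ ⟩
        t zero * (b i ^ k * P ^ k) ≈⟨ *-congˡ (^-swap {a i} {H (suc i)} {b i} {P} k (a*H i)) ⟨
        t zero * (a i ^ k * H (suc i) ^ k) ≈⟨ solve 3 (λ t A H → t :* (A :* H) := A :* (t :* H)) refl _ _ _ ⟩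
        a i ^ k * (t zero * H (suc i) ^ k) ∎)

      scaled : ∀ i → P ^ k * (c i * t i) ≈ t zero * (c i * H i ^ k)
      scaled i = begin
        P ^ k * (c i * t i) ≈⟨ solve 3 (λ P c t → P :* (c :* t) := c :* (P :* t)) refl _ _ _ ⟩
        c i * (P ^ k * t i) ≈⟨ *-congˡ (H^k i) ⟩
        c i * (t zero * H i ^ k) ≈⟨ solve 3 (λ c t H → c :* (t :* H) := t :* (c :* H)) refl _ _ _ ⟩
        t zero * (c i * H i ^ k) ∎

      rigidH : Rigid (λ i → c i * H i ^ k)
      rigidH = Rigid-scale (t≉0 zero) scaled rigid (^-≉0 k P≉0)

      ΣH≈0 : sum (λ i → c i * H i ^ k) ≈ 0#
      ΣH≈0 = sum-scale (t≉0 zero) scaled Σ≈0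

      Heights≤ : ℕ → Set
      Heights≤ d = ∀ i → Deg< (suc d) (a i) × Deg< (suc d) (b i)

      degH : ∀ {d} → Heights≤ d → ∀ i → Deg< (suc (suc m ℕ.* d)) (H i)
      degH h zero    = Deg<-product a (proj₁ ∘ h)
      degH h (suc i) = Deg<-* (proj₂ (h i)) (Deg<-product (removeAt a i) (proj₁ ∘ h ∘ Fin.punchIn i))

      descend : ∀ {d} → Heights≤ (suc d) → ¬ ¬ Heights≤ d
      descend {d} h = ¬¬-∀Fin λ i →
        let x , y , x≉0 , y≉0 , degx , degy , eq = eliminate-all-but-two m K 0 (suc m ℕ.* suc d) c H c-const (degH h) rigidH ΣH≈0 (suc i) zero (λ ())
            eq′ : a i ^ K * y ≈ b i ^ K * x
            eq′ = *-cancelˡ (^-≉0 K P≉0) (begin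
              P ^ K * (a i ^ K * y) ≈⟨ solve 3 (λ P A y → P :* (A :* y) := A :* (y :* P)) refl _ _ _ ⟩
              a i ^ K * (y * P ^ K) ≈⟨ *-congˡ eq ⟨
              a i ^ K * (x * H (suc i) ^ K) ≈⟨ solve 3 (λ A x H → A :* (x :* H) := x :* (A :* H)) refl _ _ _ ⟩
              x * (a i ^ K * H (suc i) ^ K) ≈⟨ *-congˡ (^-swap {a i} {H (suc i)} {b i} {P} K (a*H i)) ⟩
              x * (b i ^ K * P ^ K) ≈⟨ solve 3 (λ x B P → x :* (B :* P) := P :* (B :* x)) refl _ _ _ ⟩
              P ^ K * (b i ^ K * x) ∎)
        in do
          dega ← coprime-degree K (coprime i) (a≉0 i) eq′ x≉0 degx E<Kd
          degb ← coprime-degree K (Coprime-sym (coprime i)) (b≉0 i) (sym eq′) y≉0 degy E<Kd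
          return (dega , degb)
        where
        E<Kd : degreeFactor m 0 ℕ.* (suc m ℕ.* suc d) ℕ.< K ℕ.* suc d
        E<Kd = ≡.subst (ℕ._< K ℕ.* suc d) (ℕ.*-assoc (degreeFactor m 0) (suc m) (suc d)) (ℕ.*-monoˡ-< (suc d) K-large)

      descend-to-0 : ∀ d → Heights≤ d → ¬ ¬ Heights≤ 0
      descend-to-0 zero    h = return h
      descend-to-0 (suc d) h = descend h >>= descend-to-0 d

      initial : ∃[ d ] Heights≤ d
      initial = let d , h = Deg<-fin-∀ a ; e , g = Deg<-fin-∀ b in
        d ℕ.⊔ e , λ i → Deg<-mono (ℕ.m≤n⇒m≤1+n (ℕ.m≤m⊔n d e)) (h i) , Deg<-mono (ℕ.m≤n⇒m≤1+n (ℕ.m≤n⊔m d e)) (g i)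

    -- Once the descent has reached height 0, the numerators and denominators are constant, and so
    -- are the ratios.
    rigid⇒∝ : ∀ i → t (suc i) ∝ t zero
    rigid⇒∝ i = stable do
      h ← descend-to-0 (proj₁ initial) (proj₂ initial)
      let A = a i ^ k ; B = b i ^ k
          A≉0 = ^-≉0 k (a≉0 i) ; B≉0 = ^-≉0 k (b≉0 i)
          A-const = Constant-^ k (proj₁ (h i)) ; B-const = Constant-^ k (proj₂ (h i))
      return (∝-cancelʳ B≉0 (∝-trans (*-≉0 (t≉0 (suc i)) A≉0)
        (∝-* (∝-refl {t (suc i)}) (Constant-∝ B-const A-const))
        (∝-cong refl (trans (*-comm _ _) (trans (ratio i) (*-comm _ _))) (∝-refl {t (suc i) * A}))))

  KthRatio : ℕ → Carrier → Carrier → Set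
  KthRatio k x y = ∃[ a ] ∃[ b ] ((¬ a ≈ 0#) × (¬ b ≈ 0#) × a ^ k * x ≈ b ^ k * y)

  KthRatio-refl : ∀ {k x} → KthRatio k x x
  KthRatio-refl = 1# , 1# , 1≉0 , 1≉0 , refl

  KthRatio-sym : ∀ {k x y} → KthRatio k x y → KthRatio k y x
  KthRatio-sym (a , b , a≉0 , b≉0 , eq) = b , a , b≉0 , a≉0 , sym eq

  KthRatio-* : ∀ {k x y z w} → KthRatio k x y → KthRatio k z w → KthRatio k (x * z) (y * w)
  KthRatio-* {k} {x} {y} {z} {w} (a , b , a≉0 , b≉0 , eq) (c , d , c≉0 , d≉0 , eq′) =
    a * c , b * d , *-≉0 a≉0 c≉0 , *-≉0 b≉0 d≉0 , (begin
      (a * c) ^ k * (x * z) ≈⟨ *-congʳ (^-distrib-* a c k) ⟩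
      a ^ k * c ^ k * (x * z) ≈⟨ solve 4 (λ a c x z → a :* c :* (x :* z) := (a :* x) :* (c :* z)) refl _ _ _ _ ⟩
      (a ^ k * x) * (c ^ k * z) ≈⟨ *-cong eq eq′ ⟩
      (b ^ k * y) * (d ^ k * w) ≈⟨ solve 4 (λ b d y w → (b :* y) :* (d :* w) := b :* d :* (y :* w)) refl _ _ _ _ ⟩
      b ^ k * d ^ k * (y * w) ≈⟨ *-congʳ (^-distrib-* b d k) ⟨
      (b * d) ^ k * (y * w) ∎)

  KthRatio-trans : ∀ {k x y z} → KthRatio k x y → KthRatio k y z → KthRatio k x z
  KthRatio-trans {k} {x} {y} {z} (a , b , a≉0 , b≉0 , eq) (c , d , c≉0 , d≉0 , eq′) =
    a * c , b * d , *-≉0 a≉0 c≉0 , *-≉0 b≉0 d≉0 , (begin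
      (a * c) ^ k * x ≈⟨ *-congʳ (^-distrib-* a c k) ⟩
      a ^ k * c ^ k * x ≈⟨ solve 3 (λ a c x → a :* c :* x := c :* (a :* x)) refl _ _ _ ⟩
      c ^ k * (a ^ k * x) ≈⟨ *-congˡ eq ⟩
      c ^ k * (b ^ k * y) ≈⟨ solve 3 (λ c b y → c :* (b :* y) := b :* (c :* y)) refl _ _ _ ⟩
      b ^ k * (c ^ k * y) ≈⟨ *-congˡ eq′ ⟩
      b ^ k * (d ^ k * z) ≈⟨ *-assoc _ _ _ ⟨
      b ^ k * d ^ k * z ≈⟨ *-congʳ (^-distrib-* b d k) ⟨
      (b * d) ^ k * z ∎)

  KthRatio-respˡ : ∀ {k x x′ y} → x ≈ x′ → KthRatio k x y → KthRatio k x′ y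
  KthRatio-respˡ eq (a , b , a≉0 , b≉0 , h) = a , b , a≉0 , b≉0 , trans (*-congˡ (sym eq)) h

  KthRatio-neg : ∀ {k x y} → KthRatio k x y → KthRatio k (- x) (- y)
  KthRatio-neg (a , b , a≉0 , b≉0 , h) = a , b , a≉0 , b≉0 ,
    trans (sym (-‿distribʳ-* _ _)) (trans (-‿cong h) (-‿distribʳ-* _ _))
    where open import Algebra.Properties.Ring ring using (-‿distribʳ-*)

  KthRatio⇒coprime : ∀ {k x y} → KthRatio k x y →
    ¬ ¬ (∃[ a ] ∃[ b ] ((¬ a ≈ 0#) × (¬ b ≈ 0#) × Coprime a b × a ^ k * x ≈ b ^ k * y))
  KthRatio⇒coprime {k} {x} {y} (a , b , a≉0 , b≉0 , eq) = do
    (a′ , b′ , u , v , ab′≈ba′ , b′≉0 , const , c≉0) ← bezout a b b≉0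
    return (a′ , b′ , *-≉0ʳ (λ h → *-≉0 a≉0 b′≉0 (trans ab′≈ba′ h)) , b′≉0 , (u , v , const , c≉0) ,
      *-cancelˡ (^-≉0 k b≉0) (begin
        b ^ k * (a′ ^ k * x) ≈⟨ *-assoc _ _ _ ⟨
        b ^ k * a′ ^ k * x ≈⟨ *-congʳ (^-swap {a} {b′} {b} {a′} k ab′≈ba′) ⟨
        a ^ k * b′ ^ k * x ≈⟨ solve 3 (λ a b x → a :* b :* x := b :* (a :* x)) refl _ _ _ ⟩
        b′ ^ k * (a ^ k * x) ≈⟨ *-congˡ eq ⟩
        b′ ^ k * (b ^ k * y) ≈⟨ solve 3 (λ c b y → c :* (b :* y) := b :* (c :* y)) refl _ _ _ ⟩
        b ^ k * (b′ ^ k * y) ∎))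

  -- The requirements for all smaller numbers of terms are added up. This makes the bound monotone
  -- and leaves, for each m < M, an exponent K = k - m above `degreeFactor m 0` (m + 1).
  threshold : ℕ → ℕ
  threshold zero    = 0
  threshold (suc M) = threshold M ℕ.+ (M ℕ.+ suc (degreeFactor M 0 ℕ.* suc M))

  threshold-split : ∀ M {k} → threshold M ℕ.≤ k → ∀ m → m ℕ.< M → ∃[ K ] (m ℕ.+ K ≡ k × degreeFactor m 0 ℕ.* suc m ℕ.< K)
  threshold-split (suc M) {k} le m (s≤s m≤M) with ℕ.m≤n⇒m<n∨m≡n m≤M
  ... | inj₁ m<M = threshold-split M (ℕ.≤-trans (ℕ.m≤m+n _ _) le) m m<M
  ... | inj₂ ≡.refl = k ℕ.∸ M , ℕ.m+[n∸m]≡n (ℕ.≤-trans (ℕ.m≤m+n M _) M+X≤k) ,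
      ℕ.≤-trans (ℕ.≤-reflexive (≡.sym (ℕ.m+n∸m≡n M _))) (ℕ.∸-monoˡ-≤ M M+X≤k)
    where
    M+X≤k : M ℕ.+ suc (degreeFactor M 0 ℕ.* suc M) ℕ.≤ k
    M+X≤k = ℕ.≤-trans (ℕ.m≤n+m _ (threshold M)) le

  threshold-mono : ∀ {M N} → M ℕ.≤ N → threshold M ℕ.≤ threshold N
  threshold-mono {M} {N} M≤N with ℕ.m≤n⇒∃[o]m+o≡n M≤N
  ... | o , ≡.refl = go o
    where
    go : ∀ o → threshold M ℕ.≤ threshold (M ℕ.+ o)
    go zero    = ℕ.≤-reflexive (≡.cong threshold (≡.sym (ℕ.+-identityʳ M)))
    go (suc o) = ℕ.≤-trans (go o) (ℕ.≤-trans (ℕ.m≤m+n _ _) (ℕ.≤-reflexive (≡.cong threshold (≡.sym (ℕ.+-suc M o)))))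

  -- Induction on the number of terms. If the relation is rigid, `rigid⇒∝` applies; otherwise a
  -- second relation serves to remove a term while the coefficient of `t zero` stays nonzero.
  -- Rigidity is thus derived from the assumption that the goal fails.
  dependent⇒∝ : ∀ M {k} → threshold M ℕ.≤ k →
    (t : Fin (suc M) → Carrier) → (∀ i → ¬ t i ≈ 0#) → (∀ i → KthRatio k (t (suc i)) (t zero)) →
    (c : Fin (suc M) → Carrier) → (∀ i → Constant (c i)) → sum (λ i → c i * t i) ≈ 0# → ¬ c zero ≈ 0# →
    ¬ ¬ (∃[ i ] t (suc i) ∝ t zero)
  dependent⇒∝ zero le t t≉0 related c c-const Σ≈0 c₀≉0 =
    ⊥-elim (*-≉0 c₀≉0 (t≉0 zero) (trans (sym (+-identityʳ _)) Σ≈0))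
  dependent⇒∝ (suc m) {k} le t t≉0 related c c-const Σ≈0 c₀≉0 ¬goal =
    (¬¬-∀Fin (λ i → KthRatio⇒coprime {k} (related i)) >>= λ r →
      let K , m+K≡k , K-large = threshold-split (suc m) le m ℕ.≤-refl in
      return (zero , rigid⇒∝ {m} {K} K-large t t≉0 (λ i → proj₁ (r i)) (λ i → proj₁ (proj₂ (r i)))
        (λ i → proj₁ (proj₂ (proj₂ (r i)))) (λ i → proj₁ (proj₂ (proj₂ (proj₂ (r i)))))
        (λ i → proj₁ (proj₂ (proj₂ (proj₂ (proj₂ (r i))))))
        (λ i → ≡.subst (λ k → proj₁ (r i) ^ k * t (suc i) ≈ proj₁ (proj₂ (r i)) ^ k * t zero) (≡.sym m+K≡k) (proj₂ (proj₂ (proj₂ (proj₂ (proj₂ (r i)))))))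
        c c-const rigid Σ≈0 zero)) ¬goal
    where
    drop : ∀ i (f : Fin (suc (suc m)) → Carrier) → (∀ l → Constant (f l)) → sum (λ l → f l * t l) ≈ 0# →
           f (suc i) ≈ 0# → ¬ f zero ≈ 0# → ⊥
    drop i f f-const rel fi≈0 f₀≉0 = (dependent⇒∝ m (ℕ.≤-trans (ℕ.m≤m+n _ _) le) (t ∘ Fin.punchIn (suc i)) (t≉0 ∘ Fin.punchIn (suc i))
        (λ l → related (Fin.punchIn i l)) (f ∘ Fin.punchIn (suc i)) (f-const ∘ Fin.punchIn (suc i))
        (trans (sym (+-identityˡ _)) (trans (+-congʳ (sym (trans (*-congʳ fi≈0) (zeroˡ _)))) (trans (sym (sum-remove {i = suc i} (λ l → f l * t l))) rel)))
        f₀≉0 >>= λ (l , h) → return (Fin.punchIn i l , h)) ¬goal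
    rigid : Rigid (λ i → c i * t i)
    rigid d d-const rel i di≈0 j = stable λ dj≉0 → em (d zero ≈ 0#) (split i j di≈0 dj≉0)
      where
      split : ∀ i j → d i ≈ 0# → ¬ d j ≈ 0# → Dec (d zero ≈ 0#) → ⊥
      split zero    j       d₀≈0 _ (no d₀≉0) = d₀≉0 d₀≈0
      -- The second relation itself contains `t zero` and lacks a term, so it is a shorter instance.
      split (suc i) j       di≈0 _ (no d₀≉0) = drop i (λ l → d l * c l) (λ l → Constant-* (d-const l) (c-const l))
        (trans (sum-cong-≋ λ l → *-assoc (d l) (c l) (t l)) rel) (trans (*-congʳ di≈0) (zeroˡ _)) (*-≉0 d₀≉0 c₀≉0)
      split i       zero    _ d₀≉0 (yes d₀≈0) = d₀≉0 d₀≈0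
      -- Subtracting the second relation from `d (suc j)` times the first removes the term `suc j`.
      -- The coefficient of `t zero` stays nonzero because `d zero` vanishes.
      split i       (suc j) _ dj≉0 (yes d₀≈0) = drop j (λ l → (d (suc j) - d l) * c l)
        (λ l → Constant-* (Deg<-+ (d-const (suc j)) (Deg<-neg (d-const l))) (c-const l))
        shifted (trans (*-congʳ (-‿inverseʳ _)) (zeroˡ _))
        (*-≉0 (λ h → dj≉0 (trans (sym (+-identityʳ _)) (trans (+-congˡ (sym (trans (-‿cong d₀≈0) -0#≈0#))) h))) c₀≉0)
        where
        open import Algebra.Properties.Ring ring using (-0#≈0#)
        shifted : sum (λ l → (d (suc j) - d l) * c l * t l) ≈ 0#
        shifted = begin
          sum (λ l → (d (suc j) - d l) * c l * t l)
            ≈⟨ +-identityʳ _ ⟨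
          sum (λ l → (d (suc j) - d l) * c l * t l) + 0#
            ≈⟨ +-congˡ rel ⟨
          sum (λ l → (d (suc j) - d l) * c l * t l) + sum (λ l → d l * (c l * t l))
            ≈⟨ ∑-distrib-+ (λ l → (d (suc j) - d l) * c l * t l) (λ l → d l * (c l * t l)) ⟨
          sum (λ l → (d (suc j) - d l) * c l * t l + d l * (c l * t l))
            ≈⟨ sum-cong-≋ (λ l → solve 4 (λ e d c t → (e :- d) :* c :* t :+ d :* (c :* t) := e :* (c :* t)) refl (d (suc j)) (d l) (c l) (t l)) ⟩
          sum (λ l → d (suc j) * (c l * t l))
            ≈⟨ *-distribˡ-sum (d (suc j)) (λ l → c l * t l) ⟨
          d (suc j) * sum (λ l → c l * t l)
            ≈⟨ *-congˡ Σ≈0 ⟩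
          d (suc j) * 0#
            ≈⟨ zeroʳ _ ⟩
          0# ∎

-- Counting with undecidable predicates

Sublist : {A : Set} → List A → List A → Set
Sublist L′ L = ∀ a → a ∈ L′ → a ∈ L

-- The count goes through sublists because `P` cannot be decided and so cannot filter `L`.
BoundedBy : {A : Set} → ℕ → List A → (A → Set) → Set
BoundedBy b L P = ∀ L′ → Unique L′ → Sublist L′ L → All P L′ → length L′ ℕ.≤ b

Unique-∷ : {A : Set} {x : A} {L L′ : List A} → Sublist L′ L → All (x ≢_) L → Unique L′ → Unique (x ∷ L′)
Unique-∷ sub x≢ u = All.tabulate (λ y∈ → All.lookup x≢ (sub _ y∈)) ∷ u

Sublist-∷ : {A : Set} {x : A} {L L′ : List A} → Sublist L′ L → Sublist (x ∷ L′) (x ∷ L)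
Sublist-∷ sub a (here eq)  = here eq
Sublist-∷ sub a (there a∈) = there (sub a a∈)

partition : {A : Set} (P : A → Set) (L : List A) → Unique L → ¬ ¬ (∃[ L₁ ] ∃[ L₂ ]
  (Unique L₁ × Unique L₂ × Sublist L₁ L × Sublist L₂ L × All P L₁ × All (λ a → ¬ P a) L₂ × length L ≡ length L₁ ℕ.+ length L₂))
partition P []      u = return ([] , [] , [] , [] , (λ _ ()) , (λ _ ()) , [] , [] , ≡.refl)
partition P (x ∷ L) (x≢ ∷ u) = do
  (L₁ , L₂ , u₁ , u₂ , s₁ , s₂ , p , ¬p , eq) ← partition P L u
  em (P x) >>= λ where
    (yes px) → return (x ∷ L₁ , L₂ , Unique-∷ s₁ x≢ u₁ , u₂ , Sublist-∷ s₁ , (λ a → there ∘ s₂ a) , px ∷ p , ¬p , ≡.cong suc eq)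
    (no ¬px) → return (L₁ , x ∷ L₂ , u₁ , Unique-∷ s₂ x≢ u₂ , (λ a → there ∘ s₁ a) , Sublist-∷ s₂ , p , ¬px ∷ ¬p ,
      ≡.trans (≡.cong suc eq) (≡.sym (ℕ.+-suc (length L₁) (length L₂))))

-- Union bound: every predicate removes at most b elements, and something is left after all of them.
avoid : {A : Set} (b : ℕ) (L : List A) (Ps : List (A → Set)) → Unique L → All (BoundedBy b L) Ps →
  length Ps ℕ.* b ℕ.< length L → ¬ ¬ (∃[ a ] (a ∈ L × All (λ P → ¬ P a) Ps))
avoid b (a ∷ L) []       u bounded lt = return (a , here ≡.refl , [])
avoid b L       (P ∷ Ps) u (bounded ∷ bs) lt = do
  (L₁ , L₂ , u₁ , u₂ , s₁ , s₂ , p , ¬p , eq) ← partition P L u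
  (a , a∈ , ¬ps) ← avoid b L₂ Ps u₂ (All.map (λ h L′ u′ s′ → h L′ u′ (λ a → s₂ a ∘ s′ a)) bs)
    (ℕ.+-cancelˡ-< b _ _ (ℕ.<-≤-trans lt (ℕ.≤-trans (ℕ.≤-reflexive eq) (ℕ.+-monoˡ-≤ (length L₂) (bounded L₁ u₁ s₁ p)))))
  return (a , s₂ a a∈ , All.lookup ¬p a∈ ∷ ¬ps)

-- Determinants whose columns agree up to k-th powers

module UnitEquations (D : DifferentialDomain) where
  open DifferentialDomain D
  open DifferentialDomainProperties D
  open LinearIndependence D
  open RingSolver commutativeRing
  open import Algebra.Properties.CommutativeMonoid.Sum *-commutativeMonoid using ()
    renaming (sum to product; sum-remove to product-remove)
  open import Data.Unit.Base using (⊤; tt)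
  open import Data.Vec.Functional using () renaming (_∷_ to cons)
  open import Relation.Binary.Reasoning.Setoid setoid

  Matrix : ℕ → Set
  Matrix m = Fin m → Fin m → Carrier

  minor : ∀ {m} → Matrix (suc m) → Fin (suc m) → Matrix m
  minor M j i l = M (suc i) (Fin.punchIn j l)

  sgn : ∀ {n} → Fin n → Carrier
  sgn zero    = 1#
  sgn (suc j) = - sgn j

  det : ∀ m → Matrix m → Carrier
  det zero    M = 1#
  det (suc m) M = sum (λ j → sgn j * (M zero j * det m (minor M j)))

  Term : Set
  Term = Carrier × Carrier

  eval : List Term → Carrier
  eval []            = 0#
  eval ((c , t) ∷ L) = c * t + eval L

  multiply : Carrier → Carrier → Term → Term
  multiply s x (c , t) = s * c , x * t

  diagonal : ∀ m → Matrix m → Carrier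
  diagonal zero    M = 1#
  diagonal (suc m) M = M zero zero * diagonal m (minor M zero)

  -- The Leibniz formula as a list of signs and monomials. The diagonal monomial stands at the head
  -- because it is the one to be isolated; `expandAt` collects the terms through the other entries
  -- of the top row.
  offDiagonal : ∀ m → Matrix m → List Term
  leibniz : ∀ m → Matrix m → List Term
  expandAt : ∀ m → Matrix (suc m) → Fin m → List Term

  leibniz m M = (1# , diagonal m M) ∷ offDiagonal m M
  expandAt m M j = map (multiply (- sgn j) (M zero (suc j))) (leibniz m (minor M (suc j)))
  offDiagonal zero    M = []
  offDiagonal (suc m) M = map (multiply 1# (M zero zero)) (offDiagonal m (minor M zero))
    ++ concatMap (expandAt m M) (allFin m)

  eval-++ : ∀ L L′ → eval (L ++ L′) ≈ eval L + eval L′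
  eval-++ []            L′ = sym (+-identityˡ _)
  eval-++ ((c , t) ∷ L) L′ = trans (+-congˡ (eval-++ L L′)) (sym (+-assoc _ _ _))

  eval-multiply : ∀ s x L → eval (map (multiply s x) L) ≈ s * (x * eval L)
  eval-multiply s x []            = sym (trans (*-congˡ (zeroʳ x)) (zeroʳ s))
  eval-multiply s x ((c , t) ∷ L) = trans (+-congˡ (eval-multiply s x L))
    (solve 5 (λ s x c t e → s :* c :* (x :* t) :+ s :* (x :* e) := s :* (x :* (c :* t :+ e))) refl s x c t (eval L))

  eval-concatMap : ∀ {A : Set} {n} (f : A → List Term) (g : Fin n → A) →
    eval (concatMap f (List.tabulate g)) ≈ sum (λ i → eval (f (g i)))
  eval-concatMap {n = zero}  f g = refl
  eval-concatMap {n = suc n} f g = trans (eval-++ (f (g zero)) _) (+-congˡ (eval-concatMap f (g ∘ suc)))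

  eval-leibniz : ∀ m M → eval (leibniz m M) ≈ det m M
  eval-leibniz zero    M = trans (+-identityʳ _) (*-identityˡ 1#)
  eval-leibniz (suc m) M = begin
    1# * (M zero zero * diagonal m (minor M zero)) + eval (map (multiply 1# (M zero zero)) (offDiagonal m (minor M zero)) ++ concatMap (expandAt m M) (allFin m))
      ≈⟨ +-congˡ (eval-++ (map (multiply 1# (M zero zero)) (offDiagonal m (minor M zero))) _) ⟩
    1# * (M zero zero * diagonal m (minor M zero)) + (eval (map (multiply 1# (M zero zero)) (offDiagonal m (minor M zero))) + eval (concatMap (expandAt m M) (allFin m)))
      ≈⟨ +-congˡ (+-cong (eval-multiply 1# (M zero zero) (offDiagonal m (minor M zero))) (eval-concatMap (expandAt m M) id)) ⟩
    1# * (M zero zero * diagonal m (minor M zero)) + (1# * (M zero zero * eval (offDiagonal m (minor M zero))) + sum (λ j → eval (expandAt m M j)))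
      ≈⟨ solve 5 (λ o x d e s → o :* (x :* d) :+ (o :* (x :* e) :+ s) := o :* (x :* (d :+ e)) :+ s) refl 1# (M zero zero) (diagonal m (minor M zero)) (eval (offDiagonal m (minor M zero))) (sum (λ j → eval (expandAt m M j))) ⟩
    1# * (M zero zero * (diagonal m (minor M zero) + eval (offDiagonal m (minor M zero)))) + sum (λ j → eval (expandAt m M j))
      ≈⟨ +-cong (*-congˡ (*-congˡ (trans (+-congʳ (sym (*-identityˡ _))) (eval-leibniz m (minor M zero)))))
                (sum-cong-≋ λ j → trans (eval-multiply (- sgn j) (M zero (suc j)) (leibniz m (minor M (suc j)))) (*-congˡ (*-congˡ (eval-leibniz m (minor M (suc j)))))) ⟩
    det (suc m) M ∎

  length-concatMap : ∀ {a b} {A : Set a} {B : Set b} {n} (f : A → List B) (g : Fin n → A) l → (∀ i → length (f (g i)) ≡ l) →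
    length (concatMap f (List.tabulate g)) ≡ n ℕ.* l
  length-concatMap {n = zero}  f g l h = ≡.refl
  length-concatMap {n = suc n} f g l h = ≡.trans (List.length-++ (f (g zero))) (≡.cong₂ ℕ._+_ (h zero) (length-concatMap f (g ∘ suc) l (h ∘ suc)))

  length-leibniz : ∀ m M → length (leibniz m M) ≡ m ℕ.!
  length-leibniz zero    M = ≡.refl
  length-leibniz (suc m) M = ≡.trans (≡.cong suc (List.length-++ (map (multiply 1# (M zero zero)) (offDiagonal m (minor M zero)))))
    (≡.cong₂ ℕ._+_ (≡.trans (≡.cong suc (List.length-map _ (offDiagonal m (minor M zero)))) (length-leibniz m (minor M zero)))
      (length-concatMap (expandAt m M) id (m ℕ.!) λ j → ≡.trans (List.length-map _ (leibniz m (minor M (suc j)))) (length-leibniz m (minor M (suc j)))))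

  module _ {k : ℕ} where
    Monomial : Carrier → Term → Set
    Monomial r (c , t) = Constant c × (¬ t ≈ 0#) × KthRatio k t r

    sgn-constant : ∀ {n} (j : Fin n) → Constant (sgn j)
    sgn-constant zero    = Constant-1
    sgn-constant (suc j) = Deg<-neg (sgn-constant j)

    -- A term takes one entry from every column, so up to a k-th power it is the product of the
    -- column representatives.
    leibniz-monomials : ∀ m M (r : Fin m → Carrier) → (∀ i j → ¬ M i j ≈ 0#) → (∀ i j → KthRatio k (M i j) (r j)) →
      All (Monomial (product r)) (leibniz m M)
    leibniz-monomials zero    M r M≉0 related = (Constant-1 , 1≉0 , KthRatio-refl {k}) ∷ []
    leibniz-monomials (suc m) M r M≉0 related =
      (Constant-1 , proj₂ (scale-monomial zero 1# Constant-1 (All.head diag))) ∷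
      All.++⁺ (All.map⁺ (All.map (λ {x} h → scale-monomial zero 1# Constant-1 h) (All.tail diag)))
        (All.concat⁺ (All.map⁺ {xs = allFin m} {f = expandAt m M} (All.tabulate λ {j} _ → All.map⁺ (All.map (scale-monomial (suc j) (- sgn j) (Deg<-neg (sgn-constant j)))
          (minor-monomials (suc j))))))
      where
      minor-monomials : ∀ j → All (Monomial (product (removeAt r j))) (leibniz m (minor M j))
      minor-monomials j = leibniz-monomials m (minor M j) (removeAt r j) (λ i l → M≉0 _ _) (λ i l → related _ _)
      diag = minor-monomials zero
      scale-monomial : ∀ j s → Constant s → ∀ {x} → Monomial (product (removeAt r j)) x → Monomial (product r) (multiply s (M zero j) x)
      scale-monomial j s s-const {c , t} (c-const , t≉0 , ratio) = Constant-* s-const c-const , *-≉0 (M≉0 zero j) t≉0 ,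
        KthRatio-trans {k} (KthRatio-* {k} (related zero j) ratio) (KthRatio-respˡ {k} (product-remove {i = j} r) (KthRatio-refl {k}))

    vanishing-sum : ∀ t₀ L → threshold (length L) ℕ.≤ k → ¬ t₀ ≈ 0# → All (Monomial t₀) L →
      t₀ + eval L ≈ 0# → ¬ ¬ (∃[ i ] proj₂ (List.lookup L i) ∝ t₀)
    vanishing-sum t₀ L le t₀≉0 mono Σ≈0 = dependent⇒∝ (length L) le t
      (λ { zero → t₀≉0 ; (suc i) → proj₁ (proj₂ (All.lookup mono (∈.∈-lookup i))) })
      (λ i → proj₂ (proj₂ (All.lookup mono (∈.∈-lookup i))))
      c (λ { zero → Constant-1 ; (suc i) → proj₁ (All.lookup mono (∈.∈-lookup i)) })
      (trans (+-cong (*-identityˡ t₀) (sum-lookup L)) Σ≈0) 1≉0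
      where
      t c : Fin (suc (length L)) → Carrier
      t zero    = t₀
      t (suc i) = proj₂ (List.lookup L i)
      c zero    = 1#
      c (suc i) = proj₁ (List.lookup L i)
      sum-lookup : ∀ L → sum (λ i → proj₁ (List.lookup L i) * proj₂ (List.lookup L i)) ≈ eval L
      sum-lookup []      = refl
      sum-lookup (x ∷ L) = +-congˡ (sum-lookup L)

  -- The conditions are sorted by rows: each one compares single entries of the top row, multiplied
  -- by monomials in the rows below. Rows can therefore be chosen greedily from the bottom up. Terms
  -- through the corner entry are left to the minor.
  Isolated : ∀ m → Matrix m → Set
  Isolated zero    M = ⊤
  Isolated (suc m) M = Isolated m (minor M zero) ×
    (∀ j → All (λ (c , t) → ¬ M zero zero * diagonal m (minor M zero) ∝ M zero (suc j) * t) (leibniz m (minor M (suc j))))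

  isolated⇒ : ∀ m M → (∀ i j → ¬ M i j ≈ 0#) → Isolated m M → All (λ (c , t) → ¬ t ∝ diagonal m M) (offDiagonal m M)
  isolated⇒ zero    M M≉0 iso = []
  isolated⇒ (suc m) M M≉0 (iso , iso′) =
    All.++⁺ (All.map⁺ (All.map (λ ¬∝ h → ¬∝ (∝-cancelʳ (M≉0 zero zero) (∝-cong (*-comm _ _) (*-comm _ _) h)))
              (isolated⇒ m (minor M zero) (λ i j → M≉0 _ _) iso)))
      (All.concat⁺ (All.map⁺ {xs = allFin m} {f = expandAt m M} (All.tabulate λ {j} _ → All.map⁺ (All.map (λ ¬∝ h → ¬∝ (∝-sym h)) (iso′ j)))))

  -- In a vanishing expansion the diagonal term would be proportional to another term, which
  -- isolation forbids. The expansion has m ! terms, whence the threshold.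
  isolated⇒det≉0 : ∀ {k} m M (r : Fin m → Carrier) → threshold (m ℕ.!) ℕ.≤ k → (∀ i j → ¬ M i j ≈ 0#) →
    (∀ i j → KthRatio k (M i j) (r j)) → Isolated m M → ¬ det m M ≈ 0#
  isolated⇒det≉0 {k} m M r le M≉0 related iso det≈0 =
    vanishing-sum {k} (diagonal m M) (offDiagonal m M)
      (ℕ.≤-trans (ℕ.≤-trans (ℕ.m≤m+n _ _) (ℕ.≤-reflexive (≡.cong threshold (length-leibniz m M)))) le)
      (proj₁ (proj₂ (All.head mono)))
      (All.map (λ (a , b , ratio) → a , b , KthRatio-trans {k} ratio (KthRatio-sym {k} (proj₂ (proj₂ (All.head mono))))) (All.tail mono))
      (trans (+-congʳ (sym (*-identityˡ _))) (trans (eval-leibniz m M) det≈0))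
      λ (i , h) → All.lookup (isolated⇒ m M M≉0 iso) (∈.∈-lookup i) h
    where
    mono = leibniz-monomials {k} m M r M≉0 related

  module _ {A : Set} {w k : ℕ} (row : A → Fin w → Carrier) (b : ℕ) (L : List A) (unique : Unique L)
    (row≉0 : ∀ {a} → a ∈ L → ∀ j → ¬ row a j ≈ 0#)
    (r : Fin w → Carrier) (related : ∀ {a} → a ∈ L → ∀ j → KthRatio k (row a j) (r j))
    (collisions : ∀ i j → i ≢ j → ∀ x y → ¬ x ≈ 0# → ¬ y ≈ 0# → BoundedBy b L (λ a → row a i * x ∝ row a j * y))
    where

    private
      submatrix : ∀ {m n} → (Fin m → A) → (Fin n → Fin w) → Fin m → Fin n → Carrier
      submatrix a ι i j = row (a i) (ι j)

      leibniz-≉0 : ∀ {m} (a : Fin m → A) (ι : Fin m → Fin w) → (∀ i → a i ∈ L) →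
        All (λ (c , t) → ¬ t ≈ 0#) (leibniz m (submatrix a ι))
      leibniz-≉0 {m} a ι a∈ = All.map (λ h → proj₁ (proj₂ h))
        (leibniz-monomials {k} m (submatrix a ι) (r ∘ ι) (λ i j → row≉0 (a∈ i) (ι j)) (λ i j → related (a∈ i) (ι j)))

    -- A new top row has to avoid m · m ! conditions, each met by at most b elements of `L`, and b m
    -- · m ! is at most b (m + 1) !. The map `ι` records which columns the current trailing minor
    -- occupies.
    choose-rows : ∀ m (ι : Fin m → Fin w) → (∀ {i j} → ι i ≡ ι j → i ≡ j) → b ℕ.* m ℕ.! ℕ.< length L →
      ¬ ¬ (Σ[ a ∈ (Fin m → A) ] ((∀ i → a i ∈ L) × Isolated m (submatrix a ι)))
    choose-rows zero    ι inj lt = return ((λ ()) , (λ ()) , tt)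
    choose-rows (suc m) ι inj lt = do
      (a , a∈ , iso) ← choose-rows m (ι ∘ suc) (Fin.suc-injective ∘ inj) (ℕ.≤-<-trans (ℕ.*-monoʳ-≤ b (ℕ.m≤m+n _ _)) lt)
      let d = diagonal m (submatrix a (ι ∘ suc))
          N = λ j → submatrix a (ι ∘ Fin.punchIn (suc j))
          Ps : List (A → Set)
          Ps = concatMap (λ j → map (λ (c , t) a → row a (ι zero) * d ∝ row a (ι (suc j)) * t) (leibniz m (N j))) (allFin m)
          length-Ps : length Ps ≡ m ℕ.* m ℕ.!
          length-Ps = length-concatMap _ id (m ℕ.!) λ j → ≡.trans (List.length-map _ (leibniz m (N j))) (length-leibniz m (N j))
          d≉0 : ¬ d ≈ 0#
          d≉0 = All.head (leibniz-≉0 a (ι ∘ suc) a∈)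
      (a₀ , a₀∈ , ¬ps) ← avoid b L Ps unique
        (All.concat⁺ (All.map⁺ {xs = allFin m} (All.tabulate λ {j} _ → All.map⁺ (All.map
          (λ {x} t≉0 → collisions (ι zero) (ι (suc j)) (λ eq → Fin.0≢1+n (inj eq)) d (proj₂ x) d≉0 t≉0)
          (leibniz-≉0 a (ι ∘ Fin.punchIn (suc j)) a∈)))))
        (ℕ.≤-<-trans (ℕ.≤-trans (ℕ.≤-reflexive (≡.trans (≡.cong (ℕ._* b) length-Ps) (ℕ.*-comm (m ℕ.* m ℕ.!) b))) (ℕ.*-monoʳ-≤ b (ℕ.m≤n+m _ (m ℕ.!)))) lt)
      return (cons a₀ a , (λ { zero → a₀∈ ; (suc i) → a∈ i }) , iso ,
        λ j → All.map⁻ (All.lookup (All.map⁻ (All.concat⁻ ¬ps)) (∈.∈-allFin j)))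

    rows-bounded : threshold (w ℕ.!) ℕ.≤ k → (∀ M → (∀ i → sum (M i) ≈ 0#) → det w M ≈ 0#) →
      (∀ {a} → a ∈ L → sum (row a) ≈ 0#) → length L ℕ.≤ b ℕ.* w ℕ.!
    rows-bounded le vanishes sum≈0 = ℕ.≮⇒≥ λ lt → choose-rows w id id lt λ (a , a∈ , iso) →
      isolated⇒det≉0 {k} w (submatrix a id) r le (λ i → row≉0 (a∈ i)) (λ i → related (a∈ i)) iso
        (vanishes _ λ i → sum≈0 (a∈ i))

-- Determinants of sizes three and four with vanishing row sums

module SmallDeterminants (D : DifferentialDomain) where
  open DifferentialDomain D
  open DifferentialDomainProperties D
  open UnitEquations D
  open RingSolver commutativeRing
  open import Algebra.Properties.Group +-group using (inverseˡ-unique; ⁻¹-involutive)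
  open import Algebra.Properties.Ring ring using (-1*x≈-x)
  open import Data.Fin.Patterns using (1F; 2F; 3F)

  det-cong : ∀ m {M N : Matrix m} → (∀ i j → M i j ≈ N i j) → det m M ≈ det m N
  det-cong zero    h = refl
  det-cong (suc m) h = sum-cong-≋ λ j → *-congˡ {sgn j} (*-cong (h zero j) (det-cong m λ i l → h (suc i) (Fin.punchIn j l)))

  det₁ : ∀ M → det 1 M ≈ M zero zero
  det₁ M = trans (+-identityʳ _) (trans (*-identityˡ _) (*-identityʳ _))

  alternating₂ : ∀ x y → 1# * x + (- 1# * y + 0#) ≈ x - y
  alternating₂ x y = +-cong (*-identityˡ x) (trans (+-identityʳ _) (-1*x≈-x y))

  alternating₃ : ∀ x y z → 1# * x + (- 1# * y + (- - 1# * z + 0#)) ≈ x - y + z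
  alternating₃ x y z = trans (+-cong (*-identityˡ x) (+-cong (-1*x≈-x y) (trans (+-identityʳ _) (trans (*-congʳ (⁻¹-involutive 1#)) (*-identityˡ z)))))
    (sym (+-assoc x (- y) z))

  alternating₄ : ∀ x y z w → 1# * x + (- 1# * y + (- - 1# * z + (- - - 1# * w + 0#))) ≈ x - y + z - w
  alternating₄ x y z w = trans (+-cong (*-identityˡ x) (+-cong (-1*x≈-x y) (+-cong (trans (*-congʳ (⁻¹-involutive 1#)) (*-identityˡ z))
      (trans (+-identityʳ _) (trans (*-congʳ (⁻¹-involutive (- 1#))) (-1*x≈-x w))))))
    (solve 4 (λ x y z w → x :+ ((:- y) :+ (z :+ (:- w))) := x :- y :+ z :- w) refl x y z w)

  det₂ : ∀ M → det 2 M ≈ M zero zero * M 1F 1F - M zero 1F * M 1F zero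
  det₂ M = trans (alternating₂ _ _) (+-cong (*-congˡ (det₁ (minor M zero))) (-‿cong (*-congˡ (det₁ (minor M 1F)))))

  det₃ : ∀ M → let a = M zero ; b = M 1F ; c = M 2F in det 3 M ≈
    a zero * (b 1F * c 2F - b 2F * c 1F)
    - a 1F * (b zero * c 2F - b 2F * c zero)
    + a 2F * (b zero * c 1F - b 1F * c zero)
  det₃ M = trans (alternating₃ _ _ _) (+-cong (+-cong (*-congˡ (det₂ (minor M zero))) (-‿cong (*-congˡ (det₂ (minor M 1F)))))
    (*-congˡ (det₂ (minor M 2F))))

  det₄ : ∀ M → det 4 M ≈
    M zero zero * det 3 (minor M zero) - M zero 1F * det 3 (minor M 1F)
    + M zero 2F * det 3 (minor M 2F) - M zero 3F * det 3 (minor M 3F)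
  det₄ M = alternating₄ (M zero zero * det 3 (minor M zero)) (M zero 1F * det 3 (minor M 1F))
    (M zero 2F * det 3 (minor M 2F)) (M zero 3F * det 3 (minor M 3F))

  -- The first column is minus the sum of the others; after this substitution the expansion vanishes
  -- identically in the remaining entries.
  det₃-vanishes : ∀ M → (∀ i → sum (M i) ≈ 0#) → det 3 M ≈ 0#
  det₃-vanishes M h = trans (det-cong 3 M≈) (trans (det₃ M′) (trans
    (solve 6 (λ a b d e g h → let c = :- (a :+ b) ; f = :- (d :+ e) ; i = :- (g :+ h) in
        c :* (d :* h :- e :* g) :- a :* (f :* h :- e :* i) :+ b :* (f :* g :- d :* i) := con (0 , 0))
      refl (M zero 1F) (M zero 2F) (M 1F 1F) (M 1F 2F) (M 2F 1F) (M 2F 2F))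
    (-‿inverseʳ 0#)))
    where
    M′ : Matrix 3
    M′ i zero    = - (M i 1F + M i 2F)
    M′ i (suc j) = M i (suc j)
    M≈ : ∀ i j → M i j ≈ M′ i j
    M≈ i zero    = inverseˡ-unique _ _ (trans (+-congˡ (+-congˡ (sym (+-identityʳ _)))) (h i))
    M≈ i (suc j) = refl

  det₄-vanishes : ∀ M → (∀ i → sum (M i) ≈ 0#) → det 4 M ≈ 0#
  det₄-vanishes M h = trans (det-cong 4 M≈) (trans (det₄ M′) (trans
    (+-cong (+-cong (+-cong (*-congˡ (det₃ (minor M′ zero))) (-‿cong (*-congˡ (det₃ (minor M′ 1F)))))
      (*-congˡ (det₃ (minor M′ 2F)))) (-‿cong (*-congˡ (det₃ (minor M′ 3F)))))
    (trans (solve 12 (λ a b c d e f g h i j k l →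
        let D = λ x y z p q r u v w → x :* (q :* w :- r :* v) :- y :* (p :* w :- r :* u) :+ z :* (p :* v :- q :* u)
            s = :- (a :+ (b :+ c)) ; t = :- (d :+ (e :+ f)) ; u = :- (g :+ (h :+ i)) ; v = :- (j :+ (k :+ l)) in
        s :* D d e f g h i j k l :- a :* D t e f u h i v k l :+ b :* D t d f u g i v j l :- c :* D t d e u g h v j k := con (0 , 0))
      refl (M zero 1F) (M zero 2F) (M zero 3F) (M 1F 1F) (M 1F 2F) (M 1F 3F)
           (M 2F 1F) (M 2F 2F) (M 2F 3F) (M 3F 1F) (M 3F 2F) (M 3F 3F))
    (-‿inverseʳ 0#))))
    where
    M′ : Matrix 4
    M′ i zero    = - (M i 1F + (M i 2F + M i 3F))
    M′ i (suc j) = M i (suc j)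
    M≈ : ∀ i j → M i j ≈ M′ i j
    M≈ i zero    = inverseˡ-unique _ _ (trans (+-congˡ (+-congˡ (+-congˡ (sym (+-identityʳ _))))) (h i))
    M≈ i (suc j) = refl

-- Counting by fibres, and words over a finite alphabet

length≤1 : {A : Set} (L : List A) → Unique L → (∀ {a b} → a ∈ L → b ∈ L → a ≡ b) → length L ℕ.≤ 1
length≤1 []          u same = z≤n
length≤1 (a ∷ [])    u same = s≤s z≤n
length≤1 (a ∷ b ∷ L) ((a≢b ∷ _) ∷ u) same = ⊥-elim (a≢b (same (here ≡.refl) (there (here ≡.refl))))

fiber-bound : {A B : Set} (f : A → B) (ys : List B) (b : ℕ) (L : List A) → Unique L → (∀ {a} → a ∈ L → f a ∈ ys) →
  (∀ y → BoundedBy b L (λ a → f a ≡ y)) → length L ℕ.≤ length ys ℕ.* b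
fiber-bound f []       b []      u f∈ bounded = z≤n
fiber-bound f []       b (a ∷ L) u f∈ bounded with () ← f∈ (here ≡.refl)
fiber-bound f (y ∷ ys) b L       u f∈ bounded = Dec.decidable-stable (length L ℕ.≤? _) do
  (L₁ , L₂ , u₁ , u₂ , s₁ , s₂ , p , ¬p , eq) ← partition (λ a → f a ≡ y) L u
  return (ℕ.≤-trans (ℕ.≤-reflexive eq) (ℕ.+-mono-≤ (bounded y L₁ u₁ s₁ p)
    (fiber-bound f ys b L₂ u₂ (λ a∈ → Any.tail (All.lookup ¬p a∈) (f∈ (s₂ _ a∈)))
      λ y L′ u′ s′ → bounded y L′ u′ (λ a → s₂ a ∘ s′ a))))

unique-length-≤ : {A : Set} (L L′ : List A) → Unique L → Sublist L L′ → length L ℕ.≤ length L′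
unique-length-≤ L L′ u sub = ℕ.≤-trans (fiber-bound id L′ 1 L u (λ {a} → sub a)
    λ y L₁ u₁ _ eqs → length≤1 L₁ u₁ λ a∈ b∈ → ≡.trans (All.lookup eqs a∈) (≡.sym (All.lookup eqs b∈)))
  (ℕ.≤-reflexive (ℕ.*-identityʳ _))

words : ∀ {n} j → List (Vec (Fin n) j)
words zero    = [] ∷ []
words (suc j) = cartesianProductWith _∷_ (allFin _) (words j)

∈-words : ∀ {n j} (w : Vec (Fin n) j) → w ∈ words j
∈-words []      = here ≡.refl
∈-words (i ∷ w) = ∈.∈-cartesianProductWith⁺ _∷_ (∈.∈-allFin i) (∈-words w)

words-unique : ∀ {n} j → Unique (words {n} j)
words-unique zero    = [] ∷ []
words-unique (suc j) = Unique.cartesianProductWith⁺ _∷_ (λ { ≡.refl → ≡.refl , ≡.refl }) (Unique.allFin⁺ _) (words-unique j)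

length-cartesianProductWith : {A B C : Set} (f : A → B → C) (xs : List A) (ys : List B) →
  length (cartesianProductWith f xs ys) ≡ length xs ℕ.* length ys
length-cartesianProductWith f []       ys = ≡.refl
length-cartesianProductWith f (x ∷ xs) ys = ≡.trans (List.length-++ (map (f x) ys))
  (≡.cong₂ ℕ._+_ (List.length-map (f x) ys) (length-cartesianProductWith f xs ys))

length-words : ∀ {n} j → length (words {n} j) ≡ n ℕ.^ j
length-words zero    = ≡.refl
length-words {n} (suc j) = ≡.trans (length-cartesianProductWith _∷_ (allFin n) (words j))
  (≡.cong₂ ℕ._*_ (List.length-tabulate {n = n} id) (length-words j))

-- Nontrivial solutions of x + y = z + w

module Quadruples (D : DifferentialDomain) where
  open DifferentialDomain D
  open DifferentialDomainProperties D
  open LinearIndependence D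
  open UnitEquations D
  open SmallDeterminants D
  open RingSolver commutativeRing
  open import Algebra.Properties.Group +-group using (inverseˡ-unique; inverseʳ-unique; ⁻¹-involutive)
    renaming (x∙y⁻¹≈ε⇒x≈y to x-y≈0⇒x≈y; x≈y⇒x∙y⁻¹≈ε to x≈y⇒x-y≈0)
  open import Algebra.Properties.Ring ring using (-0#≈0#; -‿distribˡ-*; -‿distribʳ-*)
  open import Algebra.Properties.CommutativeMonoid.Sum +-commutativeMonoid using (sum-remove)
  open import Data.Fin.Patterns using (1F; 2F; 3F)
  open import Relation.Binary.Reasoning.Setoid setoid

  module _ {n : ℕ} (v : Fin n → Carrier)
    (v≉0 : ∀ i → ¬ v i ≈ 0#)
    (v-injective : ∀ {i j} → v i ∝ v j → i ≡ j)
    (v*v : ∀ i j i′ j′ → v i * v j ∝ v i′ * v j′ → v i * v j ≈ v i′ * v j′)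
    (v+v≉0 : ∀ i j → ¬ v i + v j ≈ 0#)
    {k : ℕ} (k-large : threshold 24 ℕ.≤ k)
    where

    Quad : Set
    Quad = Vec (Fin n) 4

    -- The last two columns carry a minus sign, so that a solution becomes a row with sum zero.
    signed : Fin 4 → Carrier → Carrier
    signed zero          x = x
    signed 1F    x = x
    signed (suc (suc _)) x = - x

    row : Quad → Fin 4 → Carrier
    row q j = signed j (v (Vec.lookup q j))

    Solution : Quad → Set
    Solution q = sum (row q) ≈ 0# × Vec.lookup q zero ≢ Vec.lookup q 2F × Vec.lookup q zero ≢ Vec.lookup q 3F

    v-injective′ : ∀ {i j} → v i - v j ≈ 0# → i ≡ j
    v-injective′ h = v-injective (∝-reflexive (x-y≈0⇒x≈y _ _ h))

    signed-≉0 : ∀ j {x} → ¬ x ≈ 0# → ¬ signed j x ≈ 0#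
    signed-≉0 zero          h = h
    signed-≉0 1F    h = h
    signed-≉0 (suc (suc _)) h eq = h (trans (sym (⁻¹-involutive _)) (trans (-‿cong eq) -0#≈0#))

    row≉0 : ∀ q j → ¬ row q j ≈ 0#
    row≉0 q j = signed-≉0 j (v≉0 _)

    neg-∝ : ∀ {x y} → - x ∝ - y → x ∝ y
    neg-∝ {x} {y} h = begin
      δ x * y ≈⟨ solve 2 (λ x y → x :* y := (:- x) :* (:- y)) refl _ _ ⟩
      - δ x * - y ≈⟨ *-congʳ (δ-neg x) ⟨
      δ (- x) * - y ≈⟨ h ⟩
      - x * δ (- y) ≈⟨ *-congˡ (δ-neg y) ⟩
      - x * - δ y ≈⟨ solve 2 (λ x y → (:- x) :* (:- y) := x :* y) refl _ _ ⟩
      x * δ y ∎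

    signed-∝ : ∀ j {x y} → signed j x ∝ signed j y → x ∝ y
    signed-∝ zero          h = h
    signed-∝ 1F    h = h
    signed-∝ (suc (suc _)) h = neg-∝ h

    row-injective : ∀ {q q′} j → row q j ∝ row q′ j → Vec.lookup q j ≡ Vec.lookup q′ j
    row-injective j h = v-injective (signed-∝ j h)

    signed-KthRatio : ∀ j {x y} → KthRatio k x y → KthRatio k (signed j x) (signed j y)
    signed-KthRatio zero          h = h
    signed-KthRatio 1F    h = h
    signed-KthRatio (suc (suc _)) h = KthRatio-neg {k} h

    signed-* : ∀ p q → (∀ x y → signed p x * signed q y ≈ x * y) ⊎ (∀ x y → signed p x * signed q y ≈ - (x * y))
    signed-* zero          zero          = inj₁ λ x y → refl
    signed-* zero          1F    = inj₁ λ x y → refl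
    signed-* zero          (suc (suc _)) = inj₂ λ x y → sym (-‿distribʳ-* x y)
    signed-* 1F    zero          = inj₁ λ x y → refl
    signed-* 1F    1F    = inj₁ λ x y → refl
    signed-* 1F    (suc (suc _)) = inj₂ λ x y → sym (-‿distribʳ-* x y)
    signed-* (suc (suc _)) zero          = inj₂ λ x y → sym (-‿distribˡ-* x y)
    signed-* (suc (suc _)) 1F    = inj₂ λ x y → sym (-‿distribˡ-* x y)
    signed-* (suc (suc _)) (suc (suc _)) = inj₁ (solve 2 (λ x y → (:- x) :* (:- y) := x :* y) refl)

    row-* : ∀ {q q′} i j → row q i * row q′ j ∝ row q′ i * row q j → row q i * row q′ j ≈ row q′ i * row q j
    row-* i j h with signed-* i j
    ... | inj₁ eq = trans (eq _ _) (trans (v*v _ _ _ _ (∝-cong (eq _ _) (eq _ _) h)) (sym (eq _ _)))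
    ... | inj₂ eq = trans (eq _ _) (trans (-‿cong (v*v _ _ _ _ (neg-∝ (∝-cong (eq _ _) (eq _ _) h)))) (sym (eq _ _)))

    -- Allows a sum of two columns to serve as a nonzero matrix entry. The two inequalities in
    -- `Solution` suffice, since b = c would force a = d, and b = d would force a = c.
    no-vanishing-pair : ∀ q → Solution q → ∀ i j → i ≢ j → ¬ row q i + row q j ≈ 0#
    no-vanishing-pair (a ∷ b ∷ c ∷ d ∷ []) (Σ≈0 , a≢c , a≢d) = pairs
      where
      complement : ∀ x y → v a + v b ≈ x + y → v b - x ≈ 0# → v a - y ≈ 0#
      complement x y eq h = begin
        v a - y ≈⟨ solve 4 (λ a b x y → a :- y := ((a :+ b) :- (x :+ y)) :- (b :- x)) refl _ _ _ _ ⟩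
        ((v a + v b) - (x + y)) - (v b - x) ≈⟨ +-cong (x≈y⇒x-y≈0 eq) (-‿cong h) ⟩
        0# - 0# ≈⟨ -‿inverseʳ 0# ⟩
        0# ∎
      sums : v a + v b ≈ v c + v d
      sums = x-y≈0⇒x≈y _ _ (trans (solve 4 (λ a b c d → (a :+ b) :- (c :+ d) := a :+ (b :+ ((:- c) :+ (:- d)))) refl _ _ _ _)
        (trans (+-congˡ (+-congˡ (+-congˡ (sym (+-identityʳ _))))) Σ≈0))
      ab : ¬ v a + v b ≈ 0#
      ab = v+v≉0 a b
      ac : ¬ v a - v c ≈ 0#
      ac h = a≢c (v-injective′ h)
      ad : ¬ v a - v d ≈ 0#
      ad h = a≢d (v-injective′ h)
      bc : ¬ v b - v c ≈ 0#
      bc h = ad (complement (v c) (v d) sums h)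
      bd : ¬ v b - v d ≈ 0#
      bd h = ac (complement (v d) (v c) (trans sums (+-comm _ _)) h)
      cd : ¬ - v c + - v d ≈ 0#
      cd h = v+v≉0 c d (trans (solve 2 (λ c d → c :+ d := :- ((:- c) :+ (:- d))) refl _ _) (trans (-‿cong h) -0#≈0#))
      flip : ∀ {x y} → ¬ x + y ≈ 0# → ¬ y + x ≈ 0#
      flip h eq = h (trans (+-comm _ _) eq)
      pairs : ∀ i j → i ≢ j → ¬ row (a ∷ b ∷ c ∷ d ∷ []) i + row (a ∷ b ∷ c ∷ d ∷ []) j ≈ 0#
      pairs zero zero i≢j = ⊥-elim (i≢j ≡.refl)
      pairs zero 1F _ = ab
      pairs zero 2F _ = ac
      pairs zero 3F _ = ad
      pairs 1F zero _ = flip ab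
      pairs 1F 1F i≢j = ⊥-elim (i≢j ≡.refl)
      pairs 1F 2F _ = bc
      pairs 1F 3F _ = bd
      pairs 2F zero _ = flip ac
      pairs 2F 1F _ = flip bc
      pairs 2F 2F i≢j = ⊥-elim (i≢j ≡.refl)
      pairs 2F 3F _ = cd
      pairs 3F zero _ = flip ad
      pairs 3F 1F _ = flip bd
      pairs 3F 2F _ = flip cd
      pairs 3F 3F i≢j = ⊥-elim (i≢j ≡.refl)

    Related : List Quad → Set
    Related L = ∀ {q q′} → q ∈ L → q′ ∈ L → ∀ j → KthRatio k (v (Vec.lookup q j)) (v (Vec.lookup q′ j))

    module _ {i j : Fin 4} (i≢j : i ≢ j) where
      private
        j′ = Fin.punchOut i≢j
        p₁ = Fin.punchIn i (Fin.punchIn j′ zero)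
        p₂ = Fin.punchIn i (Fin.punchIn j′ 1F)

      sum-split : ∀ x → sum x ≈ (x p₁ + x p₂) + (x i + x j)
      sum-split x = begin
        sum x ≈⟨ sum-remove {i = i} x ⟩
        x i + sum (removeAt x i) ≈⟨ +-congˡ (sum-remove {i = j′} (removeAt x i)) ⟩
        x i + (x (Fin.punchIn i j′) + (x p₁ + (x p₂ + 0#))) ≈⟨ +-congˡ (+-cong (reflexive (≡.cong x (Fin.punchIn-punchOut i≢j))) (+-congˡ (+-identityʳ _))) ⟩
        x i + (x j + (x p₁ + x p₂)) ≈⟨ solve 4 (λ a b c d → a :+ (b :+ (c :+ d)) := (c :+ d) :+ (a :+ b)) refl _ _ _ _ ⟩
        (x p₁ + x p₂) + (x i + x j) ∎

      agree : ∀ (q q′ : Quad) → Vec.lookup q i ≡ Vec.lookup q′ i → Vec.lookup q j ≡ Vec.lookup q′ j →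
        Vec.lookup q p₁ ≡ Vec.lookup q′ p₁ → Vec.lookup q p₂ ≡ Vec.lookup q′ p₂ → q ≡ q′
      agree q q′ eqᵢ eqⱼ eq₁ eq₂ = ≡.trans (≡.sym (Vec.tabulate∘lookup q)) (≡.trans (Vec.tabulate-cong pointwise) (Vec.tabulate∘lookup q′))
        where
        At : Fin 4 → Set
        At l = Vec.lookup q l ≡ Vec.lookup q′ l
        rest : ∀ l → At (Fin.punchIn i (Fin.punchIn j′ l))
        rest zero       = eq₁
        rest 1F = eq₂
        outside-i : ∀ l → At (Fin.punchIn i l)
        outside-i l with j′ Fin.≟ l
        ... | yes ≡.refl = ≡.subst At (≡.sym (Fin.punchIn-punchOut i≢j)) eqⱼ
        ... | no j′≢l = ≡.subst (At ∘ Fin.punchIn i) (Fin.punchIn-punchOut j′≢l) (rest _)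
        pointwise : ∀ l → At l
        pointwise l with i Fin.≟ l
        ... | yes ≡.refl = eqᵢ
        ... | no i≢l = ≡.subst At (Fin.punchIn-punchOut i≢l) (outside-i _)

      -- The two fixed columns merge into one nonzero constant column `d`, and the solutions become
      -- rows of width 3 with sum zero. There a collision determines the row, which gives the bound
      -- 1 · 3 ! = 6.
      two-columns-fixed : ∀ L → Unique L → (∀ {q} → q ∈ L → Solution q) → Related L →
        (∀ {q q′} → q ∈ L → q′ ∈ L → Vec.lookup q i ≡ Vec.lookup q′ i × Vec.lookup q j ≡ Vec.lookup q′ j) →
        length L ℕ.≤ 6
      two-columns-fixed []         u solution related fixed = z≤n
      two-columns-fixed L@(q₀ ∷ _) u solution related fixed =
        rows-bounded {w = 3} {k} reduced 1 L u reduced≉0 (reduced q₀) reduced-related collisions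
          (ℕ.≤-trans (threshold-mono (ℕ.m≤m+n 6 18)) k-large) det₃-vanishes reduced-sum
        where
        d = row q₀ i + row q₀ j
        d≉0 : ¬ d ≈ 0#
        d≉0 = no-vanishing-pair q₀ (solution (here ≡.refl)) i j i≢j
        reduced : Quad → Fin 3 → Carrier
        reduced q zero             = row q p₁
        reduced q 1F       = row q p₂
        reduced q 2F = d
        same-row : ∀ {q q′} l → Vec.lookup q l ≡ Vec.lookup q′ l → row q l ≈ row q′ l
        same-row l eq = reflexive (≡.cong (signed l ∘ v) eq)
        pair-sum : ∀ {q} → q ∈ L → (row q p₁ + row q p₂) + d ≈ 0#
        pair-sum {q} q∈ = trans (+-congˡ (+-cong (same-row {q₀} {q} i (proj₁ (fixed (here ≡.refl) q∈))) (same-row {q₀} {q} j (proj₂ (fixed (here ≡.refl) q∈)))))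
          (trans (sym (sum-split (row q))) (proj₁ (solution q∈)))
        reduced-sum : ∀ {q} → q ∈ L → sum (reduced q) ≈ 0#
        reduced-sum {q} q∈ = trans (trans (+-congˡ (+-congˡ (+-identityʳ d))) (sym (+-assoc _ _ _))) (pair-sum q∈)
        reduced≉0 : ∀ {q} → q ∈ L → ∀ l → ¬ reduced q l ≈ 0#
        reduced≉0 {q} q∈ zero             = row≉0 q p₁
        reduced≉0 {q} q∈ 1F       = row≉0 q p₂
        reduced≉0 {q} q∈ 2F = d≉0
        reduced-related : ∀ {q} → q ∈ L → ∀ l → KthRatio k (reduced q l) (reduced q₀ l)
        reduced-related {q} q∈ zero             = signed-KthRatio p₁ (related q∈ (here ≡.refl) p₁)
        reduced-related {q} q∈ 1F       = signed-KthRatio p₂ (related q∈ (here ≡.refl) p₂)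
        reduced-related {q} q∈ 2F = KthRatio-refl {k}
        same-sum : ∀ {q q′} → q ∈ L → q′ ∈ L → row q p₁ + row q p₂ ≈ row q′ p₁ + row q′ p₂
        same-sum q∈ q′∈ = trans (inverseˡ-unique _ _ (pair-sum q∈)) (sym (inverseˡ-unique _ _ (pair-sum q′∈)))
        via₁ : ∀ {q q′} → q ∈ L → q′ ∈ L → row q p₁ ∝ row q′ p₁ → q ≡ q′
        via₁ {q} {q′} q∈ q′∈ h = agree q q′ (proj₁ (fixed q∈ q′∈)) (proj₂ (fixed q∈ q′∈)) eq (row-injective {q} {q′} p₂ (∝-reflexive (begin
          row q p₂ ≈⟨ solve 2 (λ a b → b := (a :+ b) :- a) refl (row q p₁) (row q p₂) ⟩
          (row q p₁ + row q p₂) - row q p₁ ≈⟨ +-cong (same-sum q∈ q′∈) (-‿cong (same-row {q} {q′} p₁ eq)) ⟩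
          (row q′ p₁ + row q′ p₂) - row q′ p₁ ≈⟨ solve 2 (λ a b → (a :+ b) :- a := b) refl (row q′ p₁) (row q′ p₂) ⟩
          row q′ p₂ ∎)))
          where eq = row-injective {q} {q′} p₁ h
        via₂ : ∀ {q q′} → q ∈ L → q′ ∈ L → row q p₂ ∝ row q′ p₂ → q ≡ q′
        via₂ {q} {q′} q∈ q′∈ h = via₁ q∈ q′∈ (∝-reflexive (begin
          row q p₁ ≈⟨ solve 2 (λ a b → a := (a :+ b) :- b) refl (row q p₁) (row q p₂) ⟩
          (row q p₁ + row q p₂) - row q p₂ ≈⟨ +-cong (same-sum q∈ q′∈) (-‿cong (same-row {q} {q′} p₂ (row-injective {q} {q′} p₂ h))) ⟩
          (row q′ p₁ + row q′ p₂) - row q′ p₂ ≈⟨ solve 2 (λ a b → (a :+ b) :- b := a) refl (row q′ p₁) (row q′ p₂) ⟩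
          row q′ p₁ ∎))
        -- From x/y = x′/y′ and x + y = x′ + y′ = - d.
        via₁₂ : ∀ {q q′} → q ∈ L → q′ ∈ L → row q p₁ * row q′ p₂ ∝ row q′ p₁ * row q p₂ → q ≡ q′
        via₁₂ {q} {q′} q∈ q′∈ h = via₁ q∈ q′∈ (∝-reflexive (*-cancelˡ d≉0 (begin
          d * row q p₁ ≈⟨ *-congʳ (inverseʳ-unique _ _ (pair-sum q′∈)) ⟩
          - (row q′ p₁ + row q′ p₂) * row q p₁ ≈⟨ solve 3 (λ a b c → (:- (a :+ b)) :* c := :- (a :* c :+ c :* b)) refl _ _ _ ⟩
          - (row q′ p₁ * row q p₁ + row q p₁ * row q′ p₂) ≈⟨ -‿cong (+-congˡ (row-* {q} {q′} p₁ p₂ h)) ⟩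
          - (row q′ p₁ * row q p₁ + row q′ p₁ * row q p₂) ≈⟨ solve 3 (λ a b c → :- (a :* b :+ a :* c) := (:- (b :+ c)) :* a) refl _ _ _ ⟩
          - (row q p₁ + row q p₂) * row q′ p₁ ≈⟨ *-congʳ (inverseʳ-unique _ _ (pair-sum q∈)) ⟨
          d * row q′ p₁ ∎)))
        -- Dividing one collision by the other eliminates the unknown factors `x` and `y`.
        cross : ∀ {q q′} c c′ {x y} → ¬ x ≈ 0# → ¬ y ≈ 0# → reduced q c * x ∝ reduced q c′ * y → reduced q′ c * x ∝ reduced q′ c′ * y →
          reduced q c * reduced q′ c′ ∝ reduced q′ c * reduced q c′
        cross {q} {q′} c c′ {x} {y} x≉0 y≉0 h h′ = ∝-cancelʳ (*-≉0 x≉0 y≉0)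
          (∝-cong (solve 4 (λ a x b y → (a :* x) :* (b :* y) := a :* b :* (x :* y)) refl _ _ _ _)
                  (solve 4 (λ a y b x → (a :* y) :* (b :* x) := b :* a :* (x :* y)) refl _ _ _ _)
                  (∝-* h (∝-sym h′)))
        equal : ∀ {q q′} → q ∈ L → q′ ∈ L → ∀ c c′ → c ≢ c′ → reduced q c * reduced q′ c′ ∝ reduced q′ c * reduced q c′ → q ≡ q′
        equal q∈ q′∈ zero             zero             c≢ h = ⊥-elim (c≢ ≡.refl)
        equal q∈ q′∈ zero             1F       c≢ h = via₁₂ q∈ q′∈ h
        equal q∈ q′∈ zero             2F c≢ h = via₁ q∈ q′∈ (∝-cancelʳ d≉0 h)
        equal q∈ q′∈ 1F       zero             c≢ h = via₁₂ q∈ q′∈ (∝-cong (*-comm _ _) (*-comm _ _) (∝-sym h))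
        equal q∈ q′∈ 1F       1F       c≢ h = ⊥-elim (c≢ ≡.refl)
        equal q∈ q′∈ 1F       2F c≢ h = via₂ q∈ q′∈ (∝-cancelʳ d≉0 h)
        equal q∈ q′∈ 2F zero             c≢ h = via₁ q∈ q′∈ (∝-cancelʳ d≉0 (∝-cong (*-comm _ _) (*-comm _ _) (∝-sym h)))
        equal q∈ q′∈ 2F 1F       c≢ h = via₂ q∈ q′∈ (∝-cancelʳ d≉0 (∝-cong (*-comm _ _) (*-comm _ _) (∝-sym h)))
        equal q∈ q′∈ 2F 2F c≢ h = ⊥-elim (c≢ ≡.refl)
        collisions : ∀ c c′ → c ≢ c′ → ∀ x y → ¬ x ≈ 0# → ¬ y ≈ 0# → BoundedBy 1 L (λ q → reduced q c * x ∝ reduced q c′ * y)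
        collisions c c′ c≢c′ x y x≉0 y≉0 L′ u′ sub P = length≤1 L′ u′ λ {q} {q′} q∈ q′∈ →
          equal (sub _ q∈) (sub _ q′∈) c c′ c≢c′ (cross {q} {q′} c c′ x≉0 y≉0 (All.lookup P q∈) (All.lookup P q′∈))

    -- To bound a collision, fix the entry in column i among its n values. The condition then
    -- determines the entry in column j up to a constant, hence exactly, and `two-columns-fixed`
    -- leaves at most 6 solutions.
    related-solutions-bounded : ∀ L → Unique L → (∀ {q} → q ∈ L → Solution q) → Related L → length L ℕ.≤ n ℕ.* 6 ℕ.* 24
    related-solutions-bounded []         u solution related = z≤n
    related-solutions-bounded L@(q₀ ∷ _) u solution related =
      rows-bounded {w = 4} {k} row (n ℕ.* 6) L u (λ {q} _ → row≉0 q) (row q₀) (λ q∈ j → signed-KthRatio j (related q∈ (here ≡.refl) j))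
        collisions k-large det₄-vanishes (λ q∈ → proj₁ (solution q∈))
      where
      collisions : ∀ i j → i ≢ j → ∀ x y → ¬ x ≈ 0# → ¬ y ≈ 0# → BoundedBy (n ℕ.* 6) L (λ q → row q i * x ∝ row q j * y)
      collisions i j i≢j x y x≉0 y≉0 L′ u′ sub P = ≡.subst (λ m → length L′ ℕ.≤ m ℕ.* 6) (List.length-tabulate {n = n} id)
        (fiber-bound (λ q → Vec.lookup q i) (allFin n) 6 L′ u′ (λ _ → ∈.∈-allFin _) λ s L″ u″ sub′ eqs →
          two-columns-fixed i≢j L″ u″ (λ q∈ → solution (sub _ (sub′ _ q∈))) (λ q∈ q′∈ → related (sub _ (sub′ _ q∈)) (sub _ (sub′ _ q′∈)))
            λ {q} {q′} q∈ q′∈ →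
              let eq = ≡.trans (All.lookup eqs q∈) (≡.sym (All.lookup eqs q′∈)) in
              eq , row-injective {q} {q′} j (∝-cancelʳ y≉0 (∝-trans (*-≉0 (row≉0 q i) x≉0)
                (∝-sym (All.lookup P (sub′ _ q∈)))
                (∝-cong (*-congʳ (reflexive (≡.cong (signed i ∘ v) (≡.sym eq)))) refl (All.lookup P (sub′ _ q′∈))))))

    -- Fibres over the m⁴ assignments of classes to columns; inside a fibre all solutions are
    -- related column by column.
    solutions-bounded : ∀ {m} (class : Fin n → Fin m) → (∀ {i j} → class i ≡ class j → KthRatio k (v i) (v j)) →
      ∀ L → Unique L → (∀ {q} → q ∈ L → Solution q) → length L ℕ.≤ m ℕ.^ 4 ℕ.* (n ℕ.* 6 ℕ.* 24)
    solutions-bounded {m} class class-KthRatio L u solution = ≡.subst (λ l → length L ℕ.≤ l ℕ.* (n ℕ.* 6 ℕ.* 24)) (length-words {m} 4)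
      (fiber-bound (Vec.map class) (words 4) (n ℕ.* 6 ℕ.* 24) L u (λ _ → ∈-words _) λ y L′ u′ sub eqs →
        related-solutions-bounded L′ u′ (λ q∈ → solution (sub _ q∈)) λ {q} {q′} q∈ q′∈ j →
          class-KthRatio (≡.trans (≡.sym (Vec.lookup-map j class q))
            (≡.trans (≡.cong (λ w → Vec.lookup w j) (≡.trans (All.lookup eqs q∈) (≡.sym (All.lookup eqs q′∈)))) (Vec.lookup-map j class q′))))

-- Finite quotients under double negation

transversal : {A : Set} (R : A → A → Set) (xs : List A) → (∀ x → R x x) →
  ¬ ¬ (∃[ T ] (All (λ x → Any (R x) T) xs × AllPairs (λ s t → ¬ R t s) T))
transversal R []       R-refl = return ([] , [] , [])
transversal R (x ∷ xs) R-refl = do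
  (T , covers , apart) ← transversal R xs R-refl
  em (Any (R x) T) >>= λ where
    (yes x∈) → return (T , x∈ ∷ covers , apart)
    -- A new representative goes to the end of the list, so the separation condition relates later
    -- elements to earlier ones.
    (no x∉) → return (T ++ (x ∷ []) ,
      Any.++⁺ʳ T (here (R-refl x)) ∷ All.map Any.++⁺ˡ covers ,
      AllPairs-++ apart (All.¬Any⇒All¬ T x∉))
  where
  AllPairs-++ : ∀ {T} → AllPairs (λ s t → ¬ R t s) T → All (λ t → ¬ R x t) T → AllPairs (λ s t → ¬ R t s) (T ++ (x ∷ []))
  AllPairs-++ []         []         = [] ∷ []
  AllPairs-++ (pt ∷ pts) (xt ∷ xts) = All.++⁺ pt (xt ∷ []) ∷ AllPairs-++ pts xts

record Classification {A : Set} (R : A → A → Set) : Set where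
  field
    size          : ℕ
    class         : A → Fin size
    rep           : Fin size → A
    class-sound   : ∀ {x y} → class x ≡ class y → R x y
    class-respects : ∀ {x y} → R x y → class x ≡ class y
    rep-injective : ∀ {i j} → R (rep i) (rep j) → i ≡ j

module _ {A : Set} (R : A → A → Set)
  (R-refl : ∀ x → R x x) (R-sym : ∀ {x y} → R x y → R y x) (R-trans : ∀ {x y z} → R x y → R y z → R x z)
  (xs : List A) (complete : ∀ x → x ∈ xs)
  where

  classify : ¬ ¬ Classification R
  classify = do
    (T , covers , apart) ← transversal R xs R-refl
    let cover : ∀ x → Any (R x) T
        cover x = All.lookup covers (complete x)
        R-rep : ∀ x → R x (List.lookup T (Any.index (cover x)))
        R-rep x = Any.lookup-index (cover x)
    return record
      { size = length T
      ; class = λ x → Any.index (cover x)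
      ; rep = List.lookup T
      ; class-sound = λ {x} {y} eq → R-trans (R-rep x) (R-sym (≡.subst (λ i → R y (List.lookup T i)) (≡.sym eq) (R-rep y)))
      ; class-respects = λ {x} {y} r → injective apart _ _ (R-trans (R-sym (R-rep x)) (R-trans r (R-rep y)))
      ; rep-injective = λ {i} {j} → injective apart i j
      }
    where
    injective : ∀ {T} → AllPairs (λ s t → ¬ R t s) T → ∀ i j → R (List.lookup T i) (List.lookup T j) → i ≡ j
    injective (p ∷ ps) zero    zero    r = ≡.refl
    injective (p ∷ ps) zero    (suc j) r = ⊥-elim (All.lookup p (∈.∈-lookup j) (R-sym r))
    injective (p ∷ ps) (suc i) zero    r = ⊥-elim (All.lookup p (∈.∈-lookup i) r)
    injective (p ∷ ps) (suc i) (suc j) r = ≡.cong suc (injective ps i j r)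

-- Cardinalities and Petridis' inequality

module Cardinality where
  open import Data.List.Membership.DecPropositional ℕ._≟_ public using (_∈?_)

  -- Products of ring elements are replaced by natural numbers as codes, because codes can be
  -- compared.
  card : List ℕ → ℕ
  card []       = 0
  card (x ∷ xs) = if does (x ∈? xs) then card xs else suc (card xs)

  card-∈ : ∀ {x} xs → x ∈ xs → card (x ∷ xs) ≡ card xs
  card-∈ {x} xs x∈ rewrite Dec.dec-true (x ∈? xs) x∈ = ≡.refl

  card-∉ : ∀ {x} xs → x ∉ xs → card (x ∷ xs) ≡ suc (card xs)
  card-∉ {x} xs x∉ rewrite Dec.dec-false (x ∈? xs) x∉ = ≡.refl

  distinct : ∀ xs → ∃[ U ] (Unique U × Sublist U xs × Sublist xs U × length U ≡ card xs)
  distinct []       = [] , [] , (λ _ ()) , (λ _ ()) , ≡.refl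
  distinct (x ∷ xs) with distinct xs | x ∈? xs
  ... | U , u , s , s′ , eq | yes x∈ = U , u , (λ a a∈ → there (s a a∈)) , (λ { a (here ≡.refl) → s′ a x∈ ; a (there a∈) → s′ a a∈ }) , eq
  ... | U , u , s , s′ , eq | no x∉ = x ∷ U , All.tabulate (λ a∈ x≡a → x∉ (≡.subst (_∈ xs) (≡.sym x≡a) (s _ a∈))) ∷ u ,
    Sublist-∷ s , Sublist-∷ s′ , ≡.cong suc eq

  unique⇒length≤card : ∀ L xs → Unique L → Sublist L xs → length L ℕ.≤ card xs
  unique⇒length≤card L xs u sub with distinct xs
  ... | U , _ , _ , s′ , eq = ℕ.≤-trans (unique-length-≤ L U u λ a a∈ → s′ a (sub a a∈)) (ℕ.≤-reflexive eq)

  card-mono : ∀ xs ys → Sublist xs ys → card xs ℕ.≤ card ys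
  card-mono xs ys sub with distinct xs
  ... | U , u , s , _ , eq = ℕ.≤-trans (ℕ.≤-reflexive (≡.sym eq)) (unique⇒length≤card U ys u λ a a∈ → sub a (s a a∈))

  card≤length : ∀ xs → card xs ℕ.≤ length xs
  card≤length []       = z≤n
  card≤length (x ∷ xs) with does (x ∈? xs)
  ... | true  = ℕ.m≤n⇒m≤1+n (card≤length xs)
  ... | false = s≤s (card≤length xs)

  inclusion-exclusion : ∀ xs ys → card (xs ++ ys) ℕ.+ card (filter (_∈? ys) xs) ≡ card xs ℕ.+ card ys
  inclusion-exclusion []       ys = ℕ.+-identityʳ _
  inclusion-exclusion (x ∷ xs) ys with x ∈? ys | inclusion-exclusion xs ys | x ∈? xs
  ... | yes x∈ys | ih | yes x∈xs = ≡.trans (≡.cong₂ ℕ._+_ (card-∈ (xs ++ ys) (∈.∈-++⁺ˡ x∈xs)) (card-∈ (filter (_∈? ys) xs) (∈.∈-filter⁺ (_∈? ys) x∈xs x∈ys)))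
        ih
  ... | yes x∈ys | ih | no x∉xs = ≡.trans (≡.cong₂ ℕ._+_ (card-∈ (xs ++ ys) (∈.∈-++⁺ʳ xs x∈ys)) (card-∉ (filter (_∈? ys) xs) λ h → x∉xs (proj₁ (∈.∈-filter⁻ (_∈? ys) h))))
        (≡.trans (ℕ.+-suc _ _) (≡.cong suc ih))
  ... | no x∉ys | ih | yes x∈xs = ≡.trans (≡.cong (ℕ._+ card (filter (_∈? ys) xs)) (card-∈ (xs ++ ys) (∈.∈-++⁺ˡ x∈xs))) ih
  ... | no x∉ys | ih | no x∉xs = ≡.trans (≡.cong (ℕ._+ card (filter (_∈? ys) xs)) (card-∉ (xs ++ ys) λ h → [ x∉xs , x∉ys ]′ (∈.∈-++⁻ xs h))) (≡.cong suc ih)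

  -- Multiplication by a fixed nonzero element changes the codes but not which of them coincide;
  -- this lemma then equates the two counts.
  card-map-cong : ∀ {A : Set} (f g : A → ℕ) xs → (∀ x y → f x ≡ f y → g x ≡ g y) → (∀ x y → g x ≡ g y → f x ≡ f y) →
    card (map f xs) ≡ card (map g xs)
  card-map-cong f g []       fg gf = ≡.refl
  card-map-cong f g (x ∷ xs) fg gf with f x ∈? map f xs
  ... | yes f∈ = ≡.trans (card-map-cong f g xs fg gf) (≡.sym (card-∈ (map g xs) (transfer f∈)))
    where
    transfer : f x ∈ map f xs → g x ∈ map g xs
    transfer h with ∈.∈-map⁻ f h
    ... | y , y∈ , eq = ≡.subst (_∈ map g xs) (≡.sym (fg x y eq)) (∈.∈-map⁺ g y∈)
  ... | no f∉ = ≡.trans (≡.cong suc (card-map-cong f g xs fg gf)) (≡.sym (card-∉ (map g xs) λ h → f∉ (transfer h)))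
    where
    transfer : g x ∈ map g xs → f x ∈ map f xs
    transfer h with ∈.∈-map⁻ g h
    ... | y , y∈ , eq = ≡.subst (_∈ map f xs) (≡.sym (gf x y eq)) (∈.∈-map⁺ f y∈)

-- Petridis' induction on C for |X·A·C| |X| ≤ |X·A| |X·C|, where X minimises |X·A| / |X|.
module Petridis {n : ℕ} (ρ : Fin n × Fin n → ℕ) where
  open Cardinality

  A : List (Fin n)
  A = allFin n

  ρ* : List (Fin n) → ℕ
  ρ* X = card (map ρ (cartesianProduct X A))

  ρ*-mono : ∀ {X Y} → Sublist X Y → ρ* X ℕ.≤ ρ* Y
  ρ*-mono {X} {Y} sub = card-mono (map ρ (cartesianProduct X A)) (map ρ (cartesianProduct Y A)) λ z z∈ → included (∈.∈-map⁻ ρ z∈)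
    where
    included : ∀ {z} → ∃[ xy ] (xy ∈ cartesianProduct X A × z ≡ ρ xy) → z ∈ map ρ (cartesianProduct Y A)
    included (xy , xy∈ , ≡.refl) = let x∈ , y∈ = ∈.∈-cartesianProduct⁻ X A xy∈ in
      ∈.∈-map⁺ ρ (∈.∈-cartesianProduct⁺ (sub _ x∈) y∈)

  -- The comparison of |Z·A| / |Z| is cross-multiplied so that it makes sense for empty `Z` too; the
  -- set `V` in `petridis` may be empty.
  Minimal : List (Fin n) → Set
  Minimal X = ∀ Z → Unique Z → Sublist Z X → ρ* X ℕ.* length Z ℕ.≤ ρ* Z ℕ.* length X

  -- A subset with a smaller ratio is either shorter or equally long with a smaller product set, so
  -- the sum of both sizes decreases. The ratio stays at most κ / n throughout.
  minimiser : ∀ fuel X → Unique X → 0 ℕ.< length X → length X ℕ.+ ρ* X ℕ.< fuel →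
    ∀ {κ} → ρ* X ℕ.* n ℕ.≤ κ ℕ.* length X →
    ¬ ¬ (∃[ X ] (Unique X × 0 ℕ.< length X × Minimal X × ρ* X ℕ.* n ℕ.≤ κ ℕ.* length X))
  minimiser (suc fuel) X u 0<X (s≤s X<) {κ} ratio = em Better >>= step
    where
    Better = ∃[ Z ] (Unique Z × Sublist Z X × ρ* Z ℕ.* length X ℕ.< ρ* X ℕ.* length Z)
    nonempty : ∀ {Z} → ρ* Z ℕ.* length X ℕ.< ρ* X ℕ.* length Z → 0 ℕ.< length Z
    nonempty {[]}    lt = ⊥-elim (ℕ.n≮0 (ℕ.<-≤-trans lt (ℕ.≤-reflexive (ℕ.*-zeroʳ (ρ* X)))))
    nonempty {_ ∷ _} lt = s≤s z≤n
    decrease : ∀ {Z} → Unique Z → Sublist Z X → ρ* Z ℕ.* length X ℕ.< ρ* X ℕ.* length Z → length Z ℕ.+ ρ* Z ℕ.< length X ℕ.+ ρ* X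
    decrease {Z} uz sub lt with ℕ.m≤n⇒m<n∨m≡n (unique-length-≤ Z X uz sub)
    ... | inj₁ Z<X = ℕ.+-mono-<-≤ Z<X (ρ*-mono sub)
    ... | inj₂ Z≡X = ℕ.+-mono-≤-< (ℕ.≤-reflexive Z≡X) (ℕ.*-cancelʳ-< (length X) (ρ* Z) (ρ* X) (ℕ.<-≤-trans lt (ℕ.≤-reflexive (≡.cong (ρ* X ℕ.*_) Z≡X))))
    ratio′ : ∀ {Z} → ρ* Z ℕ.* length X ℕ.< ρ* X ℕ.* length Z → ρ* Z ℕ.* n ℕ.≤ κ ℕ.* length Z
    ratio′ {Z} lt = ℕ.*-cancelʳ-≤ (ρ* Z ℕ.* n) (κ ℕ.* length Z) (length X) {{ℕ.>-nonZero 0<X}} (begin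
      ρ* Z ℕ.* n ℕ.* length X ≡⟨ swap (ρ* Z) n (length X) ⟩
      ρ* Z ℕ.* length X ℕ.* n ≤⟨ ℕ.*-monoˡ-≤ n (ℕ.<⇒≤ lt) ⟩
      ρ* X ℕ.* length Z ℕ.* n ≡⟨ swap (ρ* X) (length Z) n ⟩
      ρ* X ℕ.* n ℕ.* length Z ≤⟨ ℕ.*-monoˡ-≤ (length Z) ratio ⟩
      κ ℕ.* length X ℕ.* length Z ≡⟨ swap κ (length X) (length Z) ⟩
      κ ℕ.* length Z ℕ.* length X ∎)
      where
      open ℕ.≤-Reasoning
      swap : ∀ a b c → a ℕ.* b ℕ.* c ≡ a ℕ.* c ℕ.* b
      swap a b c = ≡.trans (ℕ.*-assoc a b c) (≡.trans (≡.cong (a ℕ.*_) (ℕ.*-comm b c)) (≡.sym (ℕ.*-assoc a c b)))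
    step : Dec Better → ¬ ¬ (∃[ X ] (Unique X × 0 ℕ.< length X × Minimal X × ρ* X ℕ.* n ℕ.≤ κ ℕ.* length X))
    step (no ∄Z) = return (X , u , 0<X , (λ Z uz sub → ℕ.≮⇒≥ λ lt → ∄Z (Z , uz , sub , lt)) , ratio)
    step (yes (Z , uz , sub , lt)) = minimiser fuel Z uz (nonempty {Z} lt) (ℕ.<-≤-trans (decrease uz sub lt) X<) {κ} (ratio′ {Z} lt)

  -- `P x c` and `Q (x , a) c` code the products x c and x a c, as `ρ (x , a)` codes x a. Only
  -- coincidences between codes matter.
  module _ {W : Set} (P : Fin n → W → ℕ) (Q : Fin n × Fin n → W → ℕ)
    (P-injective : ∀ {x x′} c → P x c ≡ P x′ c → x ≡ x′)
    (P⇒Q : ∀ {x x′ c c′} a → P x c ≡ P x′ c′ → Q (x , a) c ≡ Q (x′ , a) c′)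
    (Q⇒ρ : ∀ {y y′} c → Q y c ≡ Q y′ c → ρ y ≡ ρ y′) (ρ⇒Q : ∀ {y y′} c → ρ y ≡ ρ y′ → Q y c ≡ Q y′ c)
    (X : List (Fin n)) (X-unique : Unique X) (minimal : Minimal X)
    where

    PX QX : W → List ℕ
    PX c = map (λ x → P x c) X
    QX c = map (λ y → Q y c) (cartesianProduct X A)

    private
      combine : ∀ {g′ g f′ f q w N M} → g′ ℕ.+ q ℕ.≤ M ℕ.+ g → N ℕ.+ f ℕ.≤ f′ ℕ.+ w → M ℕ.* w ℕ.≤ q ℕ.* N →
        g ℕ.* N ℕ.≤ M ℕ.* f → g′ ℕ.* N ℕ.≤ M ℕ.* f′
      combine {g′} {g} {f′} {f} {q} {w} {N} {M} a b c d = ℕ.+-cancelʳ-≤ (q ℕ.* N) _ _ (begin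
        g′ ℕ.* N ℕ.+ q ℕ.* N ≡⟨ ℕ.*-distribʳ-+ N g′ q ⟨
        (g′ ℕ.+ q) ℕ.* N ≤⟨ ℕ.*-monoˡ-≤ N a ⟩
        (M ℕ.+ g) ℕ.* N ≡⟨ ℕ.*-distribʳ-+ N M g ⟩
        M ℕ.* N ℕ.+ g ℕ.* N ≤⟨ ℕ.+-monoʳ-≤ (M ℕ.* N) d ⟩
        M ℕ.* N ℕ.+ M ℕ.* f ≡⟨ ℕ.*-distribˡ-+ M N f ⟨
        M ℕ.* (N ℕ.+ f) ≤⟨ ℕ.*-monoʳ-≤ M b ⟩
        M ℕ.* (f′ ℕ.+ w) ≡⟨ ℕ.*-distribˡ-+ M f′ w ⟩
        M ℕ.* f′ ℕ.+ M ℕ.* w ≤⟨ ℕ.+-monoʳ-≤ (M ℕ.* f′) c ⟩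
        M ℕ.* f′ ℕ.+ q ℕ.* N ∎)
        where open ℕ.≤-Reasoning

    -- When c joins C, let V consist of the x whose product x c is already present. Then X·C gains
    -- at least |X| - |V| elements, while X·A·C gains at most |X·A| - |V·A|, because V·A·c is
    -- already present. Minimality bounds |V·A| from below by |X·A| |V| / |X|.
    petridis : ∀ C → card (concatMap QX C) ℕ.* length X ℕ.≤ ρ* X ℕ.* card (concatMap PX C)
    petridis []      = z≤n
    petridis (c ∷ C) = combine {g = card G} {f = card F} {q = ρ* V} {w = length V} {M = ρ* X} step-Q step-P (minimal V V-unique V⊆X) (petridis C)
      where
      F = concatMap PX C
      G = concatMap QX C
      V = filter (λ x → P x c ∈? F) X
      V-unique : Unique V
      V-unique = Unique.filter⁺ (λ x → P x c ∈? F) X-unique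
      V⊆X : Sublist V X
      V⊆X a a∈ = proj₁ (∈.∈-filter⁻ (λ x → P x c ∈? F) {xs = X} a∈)
      PV : List ℕ
      PV = map (λ x → P x c) V
      QV : List ℕ
      QV = map (λ y → Q y c) (cartesianProduct V A)
      F-member : ∀ {z} → z ∈ F → ∃[ x ] ∃[ d ] (x ∈ X × d ∈ C × z ≡ P x d)
      F-member z∈ with ∈.∈-concatMap⁻ PX {xs = C} z∈
      ... | z∈′ with find z∈′
      ... | d , d∈ , z∈PX with ∈.∈-map⁻ (λ x → P x d) z∈PX
      ... | x , x∈ , eq = x , d , x∈ , d∈ , eq
      QV⊆G : ∀ {z} → z ∈ QV → z ∈ G
      QV⊆G z∈ with ∈.∈-map⁻ (λ y → Q y c) z∈
      ... | (x , a) , xa∈ , eq with ∈.∈-cartesianProduct⁻ V A xa∈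
      ... | x∈V , a∈ with F-member (proj₂ (∈.∈-filter⁻ (λ x → P x c ∈? F) {xs = X} x∈V))
      ... | x′ , d , x′∈ , d∈ , eq′ = ∈.∈-concatMap⁺ QX (lose d∈ (≡.subst (_∈ QX d) (≡.sym (≡.trans eq (P⇒Q a eq′)))
            (∈.∈-map⁺ (λ y → Q y d) (∈.∈-cartesianProduct⁺ x′∈ a∈))))
      QV⊆QX : ∀ {z} → z ∈ QV → z ∈ QX c
      QV⊆QX z∈ with ∈.∈-map⁻ (λ y → Q y c) z∈
      ... | (x , a) , xa∈ , eq with ∈.∈-cartesianProduct⁻ V A xa∈
      ... | x∈V , a∈ = ≡.subst (_∈ QX c) (≡.sym eq) (∈.∈-map⁺ (λ y → Q y c) (∈.∈-cartesianProduct⁺ (V⊆X _ x∈V) a∈))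
      step-Q : card (QX c ++ G) ℕ.+ ρ* V ℕ.≤ ρ* X ℕ.+ card G
      step-Q = begin
        card (QX c ++ G) ℕ.+ ρ* V ≡⟨ ≡.cong (card (QX c ++ G) ℕ.+_) (card-map-cong ρ (λ y → Q y c) (cartesianProduct V A) (λ _ _ → ρ⇒Q c) (λ _ _ → Q⇒ρ c)) ⟩
        card (QX c ++ G) ℕ.+ card QV ≤⟨ ℕ.+-monoʳ-≤ (card (QX c ++ G)) (card-mono QV (filter (_∈? G) (QX c)) λ z z∈ → ∈.∈-filter⁺ (_∈? G) (QV⊆QX z∈) (QV⊆G z∈)) ⟩
        card (QX c ++ G) ℕ.+ card (filter (_∈? G) (QX c)) ≡⟨ inclusion-exclusion (QX c) G ⟩
        card (QX c) ℕ.+ card G ≡⟨ ≡.cong (ℕ._+ card G) (card-map-cong (λ y → Q y c) ρ (cartesianProduct X A) (λ _ _ → Q⇒ρ c) (λ _ _ → ρ⇒Q c)) ⟩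
        ρ* X ℕ.+ card G ∎
        where open ℕ.≤-Reasoning
      step-P : length X ℕ.+ card F ℕ.≤ card (PX c ++ F) ℕ.+ length V
      step-P = begin
        length X ℕ.+ card F ≡⟨ ≡.cong (ℕ._+ card F) (List.length-map (λ x → P x c) X) ⟨
        length (PX c) ℕ.+ card F ≤⟨ ℕ.+-monoˡ-≤ (card F) (unique⇒length≤card (PX c) (PX c) (Unique.map⁺ (P-injective c) X-unique) λ _ → id) ⟩
        card (PX c) ℕ.+ card F ≡⟨ inclusion-exclusion (PX c) F ⟨
        card (PX c ++ F) ℕ.+ card (filter (_∈? F) (PX c)) ≤⟨ ℕ.+-monoʳ-≤ (card (PX c ++ F)) (card-mono (filter (_∈? F) (PX c)) PV filter⊆PV) ⟩
        card (PX c ++ F) ℕ.+ card PV ≤⟨ ℕ.+-monoʳ-≤ (card (PX c ++ F)) (ℕ.≤-trans (card≤length PV) (ℕ.≤-reflexive (List.length-map (λ x → P x c) V))) ⟩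
        card (PX c ++ F) ℕ.+ length V ∎
        where
        open ℕ.≤-Reasoning
        filter⊆PV : Sublist (filter (_∈? F) (PX c)) PV
        filter⊆PV z z∈ with ∈.∈-filter⁻ (_∈? F) {xs = PX c} z∈
        ... | z∈PX , z∈F with ∈.∈-map⁻ (λ x → P x c) z∈PX
        ... | x , x∈ , ≡.refl = ∈.∈-map⁺ (λ x → P x c) (∈.∈-filter⁺ (λ x → P x c ∈? F) x∈ z∈F)

-- Growth of product sets and the number of classes

module Growth (D : DifferentialDomain) where
  open DifferentialDomain D
  open DifferentialDomainProperties D
  open LinearIndependence D
  open Cardinality

  module _ {n : ℕ} (v : Fin n → Carrier)
    (v≉0 : ∀ i → ¬ v i ≈ 0#)
    (v-injective : ∀ {i j} → v i ∝ v j → i ≡ j)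
    {κ : ℕ} (π : Fin n × Fin n → Fin κ)
    (π-sound : ∀ {i j i′ j′} → π (i , j) ≡ π (i′ , j′) → v i * v j ≈ v i′ * v j′)
    (π-respects : ∀ {i j i′ j′} → v i * v j ≈ v i′ * v j′ → π (i , j) ≡ π (i′ , j′))
    where

    ρ : Fin n × Fin n → ℕ
    ρ = Fin.toℕ ∘ π

    open Petridis ρ

    prod : ∀ {j} → Vec (Fin n) j → Carrier
    prod []      = 1#
    prod (i ∷ w) = v i * prod w

    prod≉0 : ∀ {j} (w : Vec (Fin n) j) → ¬ prod w ≈ 0#
    prod≉0 []      = 1≉0
    prod≉0 (i ∷ w) = *-≉0 (v≉0 i) (prod≉0 w)

    Coding : ℕ → Set
    Coding j = Classification {Vec (Fin n) j} (λ w w′ → prod w ≈ prod w′)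

    code : ∀ {j} → Coding j → Vec (Fin n) j → ℕ
    code C w = Fin.toℕ (Classification.class C w)

    code-sound : ∀ {j} (C : Coding j) w w′ → code C w ≡ code C w′ → prod w ≈ prod w′
    code-sound C w w′ eq = Classification.class-sound C (Fin.toℕ-injective eq)

    code-respects : ∀ {j} (C : Coding j) w w′ → prod w ≈ prod w′ → code C w ≡ code C w′
    code-respects C w w′ eq = ≡.cong Fin.toℕ (Classification.class-respects C eq)

    coding : ∀ j → ¬ ¬ Coding j
    coding j = classify _ (λ _ → refl) sym trans (words j) ∈-words

    codes : ∀ {j} → Coding (suc j) → List (Fin n) → List ℕ
    codes {j} C X = concatMap (λ c → map (λ x → code C (x ∷ c)) X) (words j)

    ∈-codes : ∀ {j} (C : Coding (suc j)) {X} {x} → x ∈ X → ∀ c → code C (x ∷ c) ∈ codes C X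
    ∈-codes {j} C {X} {x} x∈ c = ∈.∈-concatMap⁺ (λ c → map (λ x → code C (x ∷ c)) X) {xs = words j}
      (lose (∈-words c) (∈.∈-map⁺ (λ x → code C (x ∷ c)) x∈))

    module _ (X : List (Fin n)) (X-unique : Unique X) (nonempty : 0 ℕ.< length X) (minimal : Minimal X)
      (ratio : ρ* X ℕ.* n ℕ.≤ κ ℕ.* length X) where

      private
        N = length X

        arithmetic : ∀ {g h p M} j → g ℕ.* N ℕ.≤ M ℕ.* h → M ℕ.* n ℕ.≤ κ ℕ.* N → h ℕ.* p ℕ.≤ κ ℕ.^ j ℕ.* N →
          g ℕ.* (n ℕ.* p) ℕ.≤ κ ℕ.* κ ℕ.^ j ℕ.* N
        arithmetic {g} {h} {p} {M} j b c d = ℕ.*-cancelʳ-≤ (g ℕ.* (n ℕ.* p)) (κ ℕ.* κ ℕ.^ j ℕ.* N) N {{ℕ.>-nonZero nonempty}} (begin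
          g ℕ.* (n ℕ.* p) ℕ.* N ≡⟨ solve 4 (λ g n p N → g :* (n :* p) :* N := g :* N :* (n :* p)) ≡.refl g n p N ⟩
          g ℕ.* N ℕ.* (n ℕ.* p) ≤⟨ ℕ.*-monoˡ-≤ (n ℕ.* p) b ⟩
          M ℕ.* h ℕ.* (n ℕ.* p) ≡⟨ solve 4 (λ M h n p → M :* h :* (n :* p) := M :* n :* (h :* p)) ≡.refl M h n p ⟩
          M ℕ.* n ℕ.* (h ℕ.* p) ≤⟨ ℕ.*-mono-≤ c d ⟩
          κ ℕ.* N ℕ.* (κ ℕ.^ j ℕ.* N) ≡⟨ solve 3 (λ κ N q → κ :* N :* (q :* N) := κ :* q :* N :* N) ≡.refl κ N (κ ℕ.^ j) ⟩
          κ ℕ.* κ ℕ.^ j ℕ.* N ℕ.* N ∎)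
          where
          open ℕ.≤-Reasoning
          open ℕ-Solver

      -- Petridis' inequality with C the set of all words of length j. The new factor is inserted
      -- right after the one from `X`, which commutativity permits.
      growth-step : ∀ {j} (C′ : Coding (suc j)) (C″ : Coding (suc (suc j))) → card (codes C″ X) ℕ.* N ℕ.≤ ρ* X ℕ.* card (codes C′ X)
      growth-step {j} C′ C″ = ℕ.≤-trans (ℕ.*-monoˡ-≤ N (card-mono _ _ included)) (petridis P Q
          (λ {x} {x′} c eq → v-injective (∝-reflexive (*-cancelˡ (prod≉0 c) (trans (*-comm _ _) (trans (code-sound C′ (x ∷ c) (x′ ∷ c) eq) (*-comm _ _))))))
          (λ {x} {x′} {c} {c′} a eq → code-respects C″ (x ∷ a ∷ c) (x′ ∷ a ∷ c′)
            (trans (swap x a (prod c)) (trans (*-congʳ (code-sound C′ (x ∷ c) (x′ ∷ c′) eq)) (sym (swap x′ a (prod c′))))))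
          (λ { {y₁ , y₂} {y₁′ , y₂′} c eq → ≡.cong Fin.toℕ (π-respects (*-cancelˡ (prod≉0 c) (trans (*-comm _ _) (trans (*-assoc _ _ _)
            (trans (code-sound C″ (y₁ ∷ y₂ ∷ c) (y₁′ ∷ y₂′ ∷ c) eq) (trans (sym (*-assoc _ _ _)) (*-comm _ _))))))) })
          (λ { {y₁ , y₂} {y₁′ , y₂′} c eq → code-respects C″ (y₁ ∷ y₂ ∷ c) (y₁′ ∷ y₂′ ∷ c)
            (trans (sym (*-assoc _ _ _)) (trans (*-congʳ (π-sound (Fin.toℕ-injective eq))) (*-assoc _ _ _))) })
          X X-unique minimal (words j))
        where
        P : Fin n → Vec (Fin n) j → ℕ
        P x c = code C′ (x ∷ c)
        Q : Fin n × Fin n → Vec (Fin n) j → ℕ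
        Q (x , a) c = code C″ (x ∷ a ∷ c)
        Qs = concatMap (λ c → map (λ y → Q y c) (cartesianProduct X A)) (words j)
        swap : ∀ x a c → v x * (v a * c) ≈ (v x * c) * v a
        swap x a c = trans (*-congˡ (*-comm (v a) c)) (sym (*-assoc _ _ _))
        place : ∀ c′ {x z} → x ∈ X → z ≡ code C″ (x ∷ c′) → z ∈ Qs
        place (a ∷ c) x∈ ≡.refl = ∈.∈-concatMap⁺ (λ c → map (λ y → Q y c) (cartesianProduct X A)) {xs = words j}
          (lose (∈-words c) (∈.∈-map⁺ (λ y → Q y c) (∈.∈-cartesianProduct⁺ x∈ (∈.∈-allFin a))))
        included : Sublist (codes C″ X) Qs
        included z z∈ with find (∈.∈-concatMap⁻ (λ c → map (λ x → code C″ (x ∷ c)) X) {xs = words (suc j)} z∈)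
        ... | c′ , _ , z∈map with ∈.∈-map⁻ (λ x → code C″ (x ∷ c′)) z∈map
        ... | x , x∈ , eq = place c′ x∈ eq

      -- The same minimiser `X` serves for every j, and each further factor costs at most |X·A| /
      -- |X|, which is at most κ / n.
      growth : ∀ j (C : Coding (suc j)) → card (codes C X) ℕ.* n ℕ.^ j ℕ.≤ κ ℕ.^ j ℕ.* N
      growth zero C = ≡.subst₂ ℕ._≤_ (≡.sym (ℕ.*-identityʳ _)) (≡.sym (ℕ.+-identityʳ N))
        (ℕ.≤-trans (card≤length (codes C X)) (ℕ.≤-reflexive (≡.trans (≡.cong length (List.++-identityʳ (map (λ x → code C (x ∷ [])) X))) (List.length-map (λ x → code C (x ∷ [])) X))))
      growth (suc j) C″ = Dec.decidable-stable (_ ℕ.≤? _) do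
        C′ ← coding (suc j)
        return (arithmetic {card (codes C″ X)} {p = n ℕ.^ j} {ρ* X} j (growth-step C′ C″) ratio (growth j C′))

    prod-replicate : ∀ k s → prod (Vec.replicate k s) ≈ v s ^ k
    prod-replicate zero    s = refl
    prod-replicate (suc k) s = *-congˡ (prod-replicate k s)

    -- Growth is controlled only for products that start in `X`, so each t s^(k+1) is preceded by a
    -- fixed `x₀` of `X`. It contributes k + 2 factors, and |X| ≤ n absorbs the size of `X` on the
    -- right.
    classes-bounded : 0 ℕ.< n → ∀ k → (C : Classification (λ i j → KthRatio (suc k) (v i) (v j))) →
      Classification.size C ℕ.* n ℕ.^ suc (suc k) ℕ.≤ κ ℕ.^ suc (suc k)
    classes-bounded 0<n k classes = Dec.decidable-stable (_ ℕ.≤? _) do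
      (X , X-unique , nonempty , minimal , ratio) ← minimiser _ A (Unique.allFin⁺ n)
        (≡.subst (0 ℕ.<_) (≡.sym length-A) 0<n) (ℕ.n<1+n _) {κ} (ℕ.≤-trans (ℕ.*-monoˡ-≤ n ρ*A≤κ) (ℕ.≤-reflexive (≡.cong (κ ℕ.*_) (≡.sym length-A))))
      C ← coding (suc (suc (suc k)))
      let x₀ , x₀∈ = first X nonempty
          f = card (codes C X)
          mn≤f : size ℕ.* n ℕ.≤ f
          mn≤f = ≡.subst (ℕ._≤ f) (length-pairs C x₀) (unique⇒length≤card _ _ (Unique.map⁺ (pair-injective C x₀) pairs-unique)
            λ z z∈ → let (i , s) , _ , eq = ∈.∈-map⁻ (pair-code C x₀) z∈ in ≡.subst (_∈ codes C X) (≡.sym eq) (∈-codes C x₀∈ (rep i ∷ Vec.replicate (suc k) s)))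
      return (ℕ.*-cancelʳ-≤ (size ℕ.* n ℕ.^ suc (suc k)) (κ ℕ.^ suc (suc k)) n {{ℕ.>-nonZero 0<n}}
        (ℕ.≤-trans (ℕ.≤-reflexive (≡.trans (ℕ.*-assoc size _ n) (≡.trans (≡.cong (size ℕ.*_) (ℕ.*-comm _ n)) (≡.sym (ℕ.*-assoc size n _)))))
        (ℕ.≤-trans (ℕ.*-monoˡ-≤ (n ℕ.^ suc (suc k)) mn≤f)
        (ℕ.≤-trans (growth X X-unique nonempty minimal ratio (suc (suc k)) C)
          (ℕ.*-monoʳ-≤ (κ ℕ.^ suc (suc k)) (ℕ.≤-trans (unique-length-≤ X A X-unique λ a _ → ∈.∈-allFin a) (ℕ.≤-reflexive length-A)))))))
      where
      open Classification classes
      length-A : length A ≡ n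
      length-A = List.length-tabulate id
      ρ*A≤κ : ρ* A ℕ.≤ κ
      ρ*A≤κ = ℕ.≤-trans (card-mono (map ρ (cartesianProduct A A)) (map Fin.toℕ (allFin κ)) λ z z∈ →
          let y , _ , eq = ∈.∈-map⁻ ρ z∈ in ≡.subst (_∈ map Fin.toℕ (allFin κ)) (≡.sym eq) (∈.∈-map⁺ Fin.toℕ (∈.∈-allFin (π y))))
        (ℕ.≤-trans (card≤length (map Fin.toℕ (allFin κ))) (ℕ.≤-reflexive (≡.trans (List.length-map Fin.toℕ (allFin κ)) (List.length-tabulate id))))
      first : ∀ X → 0 ℕ.< length X → ∃[ x ] x ∈ X
      first (x ∷ X) _ = x , here ≡.refl
      pair-code : Coding (suc (suc (suc k))) → Fin n → Fin size × Fin n → ℕ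
      pair-code C x₀ (i , s) = code C (x₀ ∷ rep i ∷ Vec.replicate (suc k) s)
      pairs : List (Fin size × Fin n)
      pairs = cartesianProduct (allFin size) (allFin n)
      pairs-unique : Unique pairs
      pairs-unique = Unique.cartesianProduct⁺ (Unique.allFin⁺ size) (Unique.allFin⁺ n)
      length-pairs : ∀ C x₀ → length (map (pair-code C x₀) pairs) ≡ size ℕ.* n
      length-pairs C x₀ = ≡.trans (List.length-map (pair-code C x₀) pairs) (≡.trans (length-cartesianProductWith _,_ (allFin size) (allFin n))
        (≡.cong₂ ℕ._*_ (List.length-tabulate {n = size} id) (List.length-tabulate {n = n} id)))
      pair-injective : ∀ C x₀ {y y′} → pair-code C x₀ y ≡ pair-code C x₀ y′ → y ≡ y′
      -- Equal products exhibit the ratio of the two representatives as a (k + 1)-st power, so the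
      -- representatives coincide; afterwards equal powers force s = s′.
      pair-injective C x₀ {i , s} {i′ , s′} eq with rep-injective {i} {i′} (v s , v s′ , v≉0 s , v≉0 s′ , trans (*-comm _ _) (trans powers (*-comm _ _)))
        where
        powers : v (rep i) * v s ^ suc k ≈ v (rep i′) * v s′ ^ suc k
        powers = trans (*-congˡ (sym (prod-replicate (suc k) s))) (trans
          (*-cancelˡ (v≉0 x₀) (code-sound C (x₀ ∷ rep i ∷ Vec.replicate (suc k) s) (x₀ ∷ rep i′ ∷ Vec.replicate (suc k) s′) eq))
          (*-congˡ (prod-replicate (suc k) s′)))
      ... | ≡.refl = ≡.cong (i ,_) (v-injective (∝-root k (v≉0 s) (v≉0 s′) (trans (sym (prod-replicate (suc k) s)) (trans
          (*-cancelˡ (v≉0 (rep i)) (*-cancelˡ (v≉0 x₀) (code-sound C (x₀ ∷ rep i ∷ Vec.replicate (suc k) s) (x₀ ∷ rep i ∷ Vec.replicate (suc k) s′) eq)))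
          (prod-replicate (suc k) s′)))))

-- From nontrivial solutions to the number of sums

module SumCounting (D : DifferentialDomain) where
  open DifferentialDomain D
  open DifferentialDomainProperties D
  open LinearIndependence D
  open RingSolver commutativeRing
  open import Algebra.Properties.Group +-group using (x≈y⇒x∙y⁻¹≈ε; ∙-cancelˡ)

  module _ {n : ℕ} (v : Fin n → Carrier)
    (v≉0 : ∀ i → ¬ v i ≈ 0#)
    (v-injective : ∀ {i j} → v i ∝ v j → i ≡ j)
    (v*v : ∀ i j i′ j′ → v i * v j ∝ v i′ * v j′ → v i * v j ≈ v i′ * v j′)
    (v+v≉0 : ∀ i j → ¬ v i + v j ≈ 0#)
    {l : ℕ} (σ : Fin n → Fin n → Fin l)
    (σ-sound : ∀ {i j i′ j′} → σ i j ≡ σ i′ j′ → v i + v j ≈ v i′ + v j′)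
    {k : ℕ} (k-large : threshold 24 ℕ.≤ k)
    where

    open Quadruples D

    Collision : Vec (Fin n) 4 → Set
    Collision (a ∷ b ∷ c ∷ d ∷ []) = σ a b ≡ σ c d × a ≢ c × a ≢ d

    collision? : ∀ q → Dec (Collision q)
    collision? (a ∷ b ∷ c ∷ d ∷ []) = (σ a b Fin.≟ σ c d) ×-dec (¬? (a Fin.≟ c) ×-dec ¬? (a Fin.≟ d))

    collisions : List (Vec (Fin n) 4)
    collisions = filter collision? (words 4)

    collisions-bounded : ∀ {m} (class : Fin n → Fin m) → (∀ {i j} → class i ≡ class j → KthRatio k (v i) (v j)) →
      length collisions ℕ.≤ m ℕ.^ 4 ℕ.* (n ℕ.* 6 ℕ.* 24)
    collisions-bounded class class-KthRatio = solutions-bounded v v≉0 v-injective v*v v+v≉0 k-large class class-KthRatio collisions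
      (Unique.filter⁺ collision? (words-unique 4)) λ {q} q∈ → solution q (proj₂ (∈.∈-filter⁻ collision? {xs = words 4} q∈))
      where
      solution : ∀ q → Collision q → Solution v v≉0 v-injective v*v v+v≉0 k-large q
      solution (a ∷ b ∷ c ∷ d ∷ []) (eq , a≢c , a≢d) =
        trans (+-congˡ (+-congˡ (+-congˡ (+-identityʳ _)))) (trans
          (solve 4 (λ a b c d → a :+ (b :+ ((:- c) :+ (:- d))) := (a :+ b) :- (c :+ d)) refl _ _ _ _)
          (x≈y⇒x∙y⁻¹≈ε (σ-sound eq))) , a≢c , a≢d

    firstPair : Vec (Fin n) 4 → Vec (Fin n) 2
    firstPair (a ∷ b ∷ _) = a ∷ b ∷ []

    swap : Vec (Fin n) 2 → Vec (Fin n) 2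
    swap (a ∷ b ∷ []) = b ∷ a ∷ []

    σ₂ : Vec (Fin n) 2 → Fin l
    σ₂ (a ∷ b ∷ []) = σ a b

    -- If `p` starts no nontrivial collision, a different pair with the same sum contains the first
    -- entry of `p`. In first place this would make the pairs equal by cancellation; in second place
    -- it makes the pair the swap.
    swapped : ∀ p p′ → ¬ p ∈ map firstPair collisions → σ₂ p ≡ σ₂ p′ → p ≢ p′ → p′ ≡ swap p
    swapped (a ∷ b ∷ []) (c ∷ d ∷ []) good eq p≢p′ with a Fin.≟ c | a Fin.≟ d
    ... | yes ≡.refl | _ = ⊥-elim (p≢p′ (≡.cong (λ b → a ∷ b ∷ []) (v-injective (∝-reflexive (∙-cancelˡ (v a) _ _ (σ-sound eq))))))
    ... | no a≢c | yes ≡.refl = ≡.cong (λ c → c ∷ a ∷ []) (v-injective (∝-reflexive (sym (∙-cancelˡ (v a) _ _ (trans (σ-sound eq) (+-comm _ _))))))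
    ... | no a≢c | no a≢d = ⊥-elim (good (∈.∈-map⁺ firstPair
      (∈.∈-filter⁺ collision? {xs = words 4} (∈-words (a ∷ b ∷ c ∷ d ∷ [])) (eq , a≢c , a≢d))))

    -- Pairs that start a collision are counted by `collisions`; the others lie at most two over
    -- each sum.
    pairs-bounded : n ℕ.^ 2 ℕ.≤ length collisions ℕ.+ l ℕ.* 2
    pairs-bounded = Dec.decidable-stable (_ ℕ.≤? _) do
      (L₁ , L₂ , u₁ , u₂ , s₁ , s₂ , bad , good , eq) ← partition (_∈ map firstPair collisions) (words {n} 2) (words-unique 2)
      return (ℕ.≤-trans (ℕ.≤-reflexive (≡.trans (≡.sym (length-words {n} 2)) eq)) (ℕ.+-mono-≤
        (ℕ.≤-trans (unique-length-≤ L₁ _ u₁ λ a a∈ → All.lookup bad a∈) (ℕ.≤-reflexive (List.length-map firstPair collisions)))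
        (ℕ.≤-trans (fiber-bound σ₂ (allFin l) 2 L₂ u₂ (λ _ → ∈.∈-allFin _) λ s L u sub eqs → at-most-two L u (λ a∈ → All.lookup good (sub _ a∈)) eqs)
          (ℕ.≤-reflexive (≡.cong (ℕ._* 2) (List.length-tabulate {n = l} id))))))
      where
      at-most-two : ∀ {s} L → Unique L → (∀ {p} → p ∈ L → ¬ p ∈ map firstPair collisions) → All (λ p → σ₂ p ≡ s) L → length L ℕ.≤ 2
      at-most-two []            _ _ _ = z≤n
      at-most-two (_ ∷ [])      _ _ _ = s≤s z≤n
      at-most-two (_ ∷ _ ∷ [])  _ _ _ = s≤s (s≤s z≤n)
      at-most-two (p ∷ p₁ ∷ p₂ ∷ _) ((p≢p₁ ∷ p≢p₂ ∷ _) ∷ (p₁≢p₂ ∷ _) ∷ _) good (eq ∷ eq₁ ∷ eq₂ ∷ _) =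
        ⊥-elim (p₁≢p₂ (≡.trans (swapped p p₁ (good (here ≡.refl)) (≡.trans eq (≡.sym eq₁)) p≢p₁)
          (≡.sym (swapped p p₂ (good (here ≡.refl)) (≡.trans eq (≡.sym eq₂)) p≢p₂))))

-- Numerical estimates

module Arithmetic where
  open import Data.Nat.Base using (_+_; _*_; _^_; _<_; _≤_; NonZero)
  open ℕ.≤-Reasoning

  -- Raising m n^p ≤ κ^p to the power q = 8 p and comparing with the p-th power of κ^q < n^(q+1)
  -- leaves m^(8 p) < n^p.
  few-classes : ∀ p .{{_ : NonZero p}} {m n κ} → 0 < n → m * n ^ p ≤ κ ^ p → κ ^ (8 * p) < n ^ (8 * p + 1) → m ^ 8 < n
  few-classes p {m} {n} {κ} 0<n classes small = ℕ.≰⇒> λ n≤m^8 → ℕ.<-irrefl ≡.refl (begin-strict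
    n ^ (p * q) * n ^ p ≤⟨ ℕ.*-monoʳ-≤ (n ^ (p * q)) (ℕ.^-monoˡ-≤ p n≤m^8) ⟩
    n ^ (p * q) * (m ^ 8) ^ p ≡⟨ ≡.cong (n ^ (p * q) *_) (ℕ.^-*-assoc m 8 p) ⟩
    n ^ (p * q) * m ^ q ≡⟨ ℕ.*-comm (n ^ (p * q)) (m ^ q) ⟩
    m ^ q * n ^ (p * q) ≡⟨ ≡.cong (m ^ q *_) (ℕ.^-*-assoc n p q) ⟨
    m ^ q * (n ^ p) ^ q ≡⟨ ^-distrib m (n ^ p) q ⟨
    (m * n ^ p) ^ q ≤⟨ ℕ.^-monoˡ-≤ q classes ⟩
    (κ ^ p) ^ q ≡⟨ ≡.trans (ℕ.^-*-assoc κ p q) (≡.trans (≡.cong (κ ^_) (ℕ.*-comm p q)) (≡.sym (ℕ.^-*-assoc κ q p))) ⟩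
    (κ ^ q) ^ p <⟨ ℕ.^-monoˡ-< p small ⟩
    (n ^ (q + 1)) ^ p ≡⟨ ℕ.^-*-assoc n (q + 1) p ⟩
    n ^ ((q + 1) * p) ≡⟨ ≡.cong (n ^_) (solve 2 (λ q p → (q :+ con 1) :* p := p :* q :+ p) ≡.refl q p) ⟩
    n ^ (p * q + p) ≡⟨ ℕ.^-distribˡ-+-* n (p * q) p ⟩
    n ^ (p * q) * n ^ p ∎)
    where
    open ℕ-Solver
    q = 8 * p
    ^-distrib : ∀ a b q → (a * b) ^ q ≡ a ^ q * b ^ q
    ^-distrib a b zero    = ≡.refl
    ^-distrib a b (suc q) = ≡.trans (≡.cong (a * b *_) (^-distrib a b q))
      (solve 4 (λ a b x y → a :* b :* (x :* y) := a :* x :* (b :* y)) ≡.refl a b (a ^ q) (b ^ q))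

  -- Squaring turns the claim into a² m⁸ ≤ n², a product of the two hypotheses.
  small-fourth-power : ∀ a {m n} → a * a ≤ n → m ^ 8 < n → a * m ^ 4 ≤ n
  small-fourth-power a {m} {n} a²≤n m^8<n = ℕ.≮⇒≥ λ n<am⁴ → ℕ.<-irrefl ≡.refl (begin-strict
    n * n <⟨ ℕ.*-mono-< n<am⁴ n<am⁴ ⟩
    a * m ^ 4 * (a * m ^ 4) ≡⟨ solve 2 (λ a x → a :* x :* (a :* x) := a :* a :* (x :* x)) ≡.refl a (m ^ 4) ⟩
    a * a * (m ^ 4 * m ^ 4) ≡⟨ ≡.cong (a * a *_) (ℕ.^-distribˡ-+-* m 4 4) ⟨
    a * a * m ^ 8 ≤⟨ ℕ.*-mono-≤ a²≤n (ℕ.<⇒≤ m^8<n) ⟩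
    n * n ∎)
    where open ℕ-Solver

  -- As 288 = 2 · 6 · 24, the collisions account for at most n² / 2 pairs, so that 2 l is at least
  -- n² / 2.
  quarter : ∀ {m n q l} → n ^ 2 ≤ q + l * 2 → q ≤ m ^ 4 * (n * 6 * 24) → 288 * m ^ 4 ≤ n → n ^ 2 ≤ 4 * l
  quarter {m} {n} {q} {l} pairs collisions m-small = ℕ.+-cancelˡ-≤ (n ^ 2) (n ^ 2) (4 * l) (begin
    n ^ 2 + n ^ 2 ≤⟨ ℕ.+-mono-≤ pairs pairs ⟩
    (q + l * 2) + (q + l * 2) ≡⟨ solve 2 (λ q l → (q :+ l :* con 2) :+ (q :+ l :* con 2) := con 2 :* q :+ con 4 :* l) ≡.refl q l ⟩
    2 * q + 4 * l ≤⟨ ℕ.+-monoˡ-≤ (4 * l) (begin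
      2 * q ≤⟨ ℕ.*-monoʳ-≤ 2 collisions ⟩
      2 * (m ^ 4 * (n * 6 * 24)) ≡⟨ solve 2 (λ x n → con 2 :* (x :* (n :* con 6 :* con 24)) := n :* (con 288 :* x)) ≡.refl (m ^ 4) n ⟩
      n * (288 * m ^ 4) ≤⟨ ℕ.*-monoʳ-≤ n m-small ⟩
      n * n ≡⟨ ≡.cong (n *_) (ℕ.*-identityʳ n) ⟨
      n ^ 2 ∎) ⟩
    n ^ 2 + 4 * l ∎)
    where open ℕ-Solver

-- Explicit rational constants

module Exponents where
  open import Defs using (_<_^ℚ_; ℕ→ℚ)
  open import Data.Rational.Base using (mkℚ; toℚᵘ)
  open import Data.Rational.Unnormalised.Base using (mkℚᵘ; *≡*; *≤*)

  -- The denominator is stored as its predecessor, so this is 1 / (q + 1).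
  reciprocal : ℕ → ℚ
  reciprocal q = mkℚ (ℤ.+ 1) q (Coprimality.1-coprimeTo (suc q))

  -- `_<_^ℚ_` reads off numerator and denominator, so the sum is needed in lowest terms: (q + 2) /
  -- (q + 1), a quotient of consecutive numbers.
  1+reciprocal : ℕ → ℚ
  1+reciprocal q = mkℚ (ℤ.+ (suc q ℕ.+ 1)) q (Coprimality.coprime-+ (Coprimality.1-coprimeTo (suc q)))

  1+reciprocal-correct : ∀ q → 1ℚ ℚ.+ reciprocal q ≡ 1+reciprocal q
  1+reciprocal-correct q = ℚ.toℚᵘ-injective (ℚᵘ.≃-trans (ℚ.toℚᵘ-homo-+ 1ℚ (reciprocal q))
    (*≡* (≡.cong ℤ.+_ (solve 1 (λ q → (con 1 :+ (q :+ con 0) :+ con 1) :* (con 1 :+ q) := (con 1 :+ q :+ con 1) :* (con 1 :+ (q :+ con 0))) ≡.refl q))))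
    where open ℕ-Solver

  below-power : ∀ q {m n} → m < n ^ℚ (1ℚ ℚ.+ reciprocal q) → m ℕ.^ suc q ℕ.< n ℕ.^ (suc q ℕ.+ 1)
  below-power q {m} {n} h = ≡.subst (m < n ^ℚ_) (1+reciprocal-correct q) h

  quarter-≤ : ∀ {a b} → a ℕ.≤ 4 ℕ.* b → reciprocal 3 ℚ.* ℕ→ℚ a ℚ.≤ ℕ→ℚ b
  quarter-≤ {a} {b} a≤4b = ℚ.toℚᵘ-cancel-≤ (begin
    toℚᵘ (reciprocal 3 ℚ.* ℕ→ℚ a) ≃⟨ ℚ.toℚᵘ-homo-* (reciprocal 3) (ℕ→ℚ a) ⟩
    mkℚᵘ (ℤ.+ 1) 3 ℚᵘ.* toℚᵘ (ℕ→ℚ a) ≃⟨ ℚᵘ.*-congˡ {mkℚᵘ (ℤ.+ 1) 3} (ℚ.toℚᵘ-fromℚᵘ (mkℚᵘ (ℤ.+ a) 0)) ⟩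
    mkℚᵘ (ℤ.+ 1) 3 ℚᵘ.* mkℚᵘ (ℤ.+ a) 0 ≤⟨ *≤* (≡.subst₂ ℤ._≤_ (≡.sym (≡.trans (ℤ.*-identityʳ _) (ℤ.*-identityˡ _))) (ℤ.pos-* b 4) (ℤ.+≤+ (ℕ.≤-trans a≤4b (ℕ.≤-reflexive (ℕ.*-comm 4 b))))) ⟩
    mkℚᵘ (ℤ.+ b) 0 ≃⟨ ℚ.toℚᵘ-fromℚᵘ (mkℚᵘ (ℤ.+ b) 0) ⟨
    toℚᵘ (ℕ→ℚ b) ∎)
    where open ℚᵘ.≤-Reasoning

-- Conclusion for complex polynomials

ℂ-domain : CharacteristicZeroDomain
ℂ-domain = record
  { commutativeRing = ℂ-commutativeRing
  ; stable = λ {z} {w} → ℂ-stable {z} {w}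
  ; 1≉0 = λ h → ℝ-nontrivial (proj₁ h)
  ; domain = Complexes.ℂ-domain
  ; char0 = ℂ-char0
  }
  where
  open Complexes hiding (ℂ-domain)
  open Reals using (ℝ-nontrivial)

open PolynomialDomain ℂ-domain using (differentialDomain; mk; at; HasDegree⇒≉0; Monic⇒HasDegree; Monic-∝⇒≋; Monic-*; ¬-Monic-+-≋0)
open LinearIndependence differentialDomain using (threshold; KthRatio; KthRatio-refl; KthRatio-sym; KthRatio-trans)

open import Defs

-- Equals 1 / (8 (k + 2)): the growth argument involves p = k + 2 factors, and `few-classes` asks
-- for κ^(8 p) < n^(8 p + 1).
exponent : ℕ → ℚ
exponent k = Exponents.reciprocal (ℕ.pred (8 ℕ.* suc (suc k)))

sum-product : ∀ k → threshold 24 ℕ.≤ suc k →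
  ∀ n → 288 ℕ.* 288 ℕ.≤ n → (S : Pred ℂ[x] 0ℓ) → HasCardinality S n → S ⊆ Monic →
  ∀ κ l → HasCardinality (S ∙ S) κ → HasCardinality (S ∔ S) l →
  κ < n ^ℚ (1ℚ ℚ.+ exponent k) → n ℕ.^ 2 ℕ.≤ 4 ℕ.* l
sum-product k k-large n n₀≤n S (f , f-injective , _) monic κ l (g , g-injective , g-surjective) (h , _ , h-surjective) κ-small =
  Dec.decidable-stable (_ ℕ.≤? _) do
    classes ← classify (λ i j → KthRatio (suc k) (v i) (v j)) (λ _ → KthRatio-refl {suc k}) (KthRatio-sym {suc k}) (KthRatio-trans {suc k}) (allFin n) ∈.∈-allFin
    let open Classification classes
        m^8<n = few-classes (suc (suc k)) {size} {n} {κ} 0<n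
          (classes-bounded v v≉0 v-injective π π-sound π-respects 0<n k classes)
          (Exponents.below-power (ℕ.pred (8 ℕ.* suc (suc k))) {κ} {n} κ-small)
    return (quarter {size} {n} {_} {l} (pairs-bounded v v≉0 v-injective v*v v+v≉0 σ σ-sound k-large)
      (collisions-bounded v v≉0 v-injective v*v v+v≉0 σ σ-sound k-large class class-sound)
      -- Here 288² ≤ n enters: together with m⁸ < n it gives 288 m⁴ ≤ n.
      (small-fourth-power 288 {size} n₀≤n m^8<n))
  where
  open Arithmetic
  open Growth differentialDomain using (classes-bounded)
  open SumCounting differentialDomain using (pairs-bounded; collisions-bounded)
  module P = DifferentialDomain differentialDomain
  0<n : 0 ℕ.< n
  0<n = ℕ.≤-trans (s≤s z≤n) n₀≤n
  v : Fin n → ℂ[x]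
  v i = proj₁ (f i)
  v-monic : ∀ i → Monic (v i)
  v-monic i = monic (proj₂ (f i))
  v≉0 : ∀ i → ¬ v i P.≈ P.0#
  v≉0 i = HasDegree⇒≉0 {p = v i} (Monic⇒HasDegree {v i} (v-monic i))
  v-injective : ∀ {i j} → v i P.∝ v j → i ≡ j
  v-injective {i} {j} i∝j = f-injective (at (Monic-∝⇒≋ {v i} {v j} (v-monic i) (v-monic j) i∝j))
  v*v : ∀ i j i′ j′ → v i P.* v j P.∝ v i′ P.* v j′ → v i P.* v j P.≈ v i′ P.* v j′
  v*v i j i′ j′ = Monic-∝⇒≋ {v i P.* v j} {v i′ P.* v j′} (Monic-* {v i} {v j} (v-monic i) (v-monic j)) (Monic-* {v i′} {v j′} (v-monic i′) (v-monic j′))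
  v+v≉0 : ∀ i j → ¬ v i P.+ v j P.≈ P.0#
  v+v≉0 i j = ¬-Monic-+-≋0 {v i} {v j} (v-monic i) (v-monic j)
  product∈ : Fin n × Fin n → ∃ (S ∙ S)
  product∈ (i , j) = v i P.* v j , v i , v j , proj₂ (f i) , proj₂ (f j) , at (P.refl {v i P.* v j})
  -- The enumeration of S.S assigns an index to every product, as that of S+S does to every sum;
  -- indices, unlike polynomials, can be compared.
  π : Fin n × Fin n → Fin κ
  π y = proj₁ (g-surjective (product∈ y))
  g∘π : ∀ y → proj₁ (g (π y)) P.≈ proj₁ (product∈ y)
  g∘π y = mk (proj₂ (g-surjective (product∈ y)) ≡.refl)
  π-sound : ∀ {i j i′ j′} → π (i , j) ≡ π (i′ , j′) → v i P.* v j P.≈ v i′ P.* v j′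
  π-sound {i} {j} {i′} {j′} eq = P.trans (P.sym (g∘π (i , j))) (P.trans (P.reflexive (≡.cong (proj₁ ∘ g) eq)) (g∘π (i′ , j′)))
  π-respects : ∀ {i j i′ j′} → v i P.* v j P.≈ v i′ P.* v j′ → π (i , j) ≡ π (i′ , j′)
  π-respects {i} {j} {i′} {j′} eq = g-injective (at (P.trans (g∘π (i , j)) (P.trans eq (P.sym (g∘π (i′ , j′))))))
  sum∈ : Fin n → Fin n → ∃ (S ∔ S)
  sum∈ i j = v i P.+ v j , v i , v j , proj₂ (f i) , proj₂ (f j) , at (P.refl {v i P.+ v j})
  σ : Fin n → Fin n → Fin l
  σ i j = proj₁ (h-surjective (sum∈ i j))
  h∘σ : ∀ i j → proj₁ (h (σ i j)) P.≈ v i P.+ v j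
  h∘σ i j = mk (proj₂ (h-surjective (sum∈ i j)) ≡.refl)
  σ-sound : ∀ {i j i′ j′} → σ i j ≡ σ i′ j′ → v i P.+ v j P.≈ v i′ P.+ v j′
  σ-sound {i} {j} {i′} {j′} eq = P.trans (P.sym (h∘σ i j)) (P.trans (P.reflexive (≡.cong (proj₁ ∘ h) eq)) (h∘σ i′ j′))

theorem1 : ∃[ c ] ∃[ C ] ∃[ n₀ ]
    ( 0ℚ ℚ.< c
    × 0ℚ ℚ.< C
    × ( (n : ℕ) → n₀ ℕ.≤ n →
    (S : Pred ℂ[x] 0ℓ) → S Respects _≈_ →
    HasCardinality S n → S ⊆ Monic →
    (k l : ℕ) → HasCardinality (S ∙ S) k → HasCardinality (S ∔ S) l →
    k < n ^ℚ (1ℚ ℚ.+ c) →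
    C ℚ.* ℕ→ℚ (n ℕ.^ 2) ℚ.≤ ℕ→ℚ l ) )
-- The 4 × 4 determinant has 24 = 4 ! terms. The power in use is `suc (threshold 24)`, and the
-- constant C is 1 / 4.
theorem1 = exponent (threshold 24) , Exponents.reciprocal 3 , 288 ℕ.* 288 ,
  ℚ.positive⁻¹ (exponent (threshold 24)) , ℚ.positive⁻¹ (Exponents.reciprocal 3) ,
  λ n n₀≤n S _ S-card monic k l SS-card S+S-card k-small → Exponents.quarter-≤ {n ℕ.^ 2} {l}
    (sum-product (threshold 24) (ℕ.n≤1+n (threshold 24)) n n₀≤n S S-card monic k l SS-card S+S-card k-small)
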